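{- Over $\mathrm{RCA}_0$, Martin's pointed tree theorem $\mathrm{MPT}$ does not imply $\mathrm{WKL}_0$; that is, $\mathrm{RCA}_0 + \mathrm{MPT} \not\vdash \mathrm{WKL}_0$.
   Context: All theories are in the language of second order arithmetic, with models $(N,M,0,1,+,\times,<)$, where $N$ is the number sort and $M$ is the sort of sets of numbers (equivalently, up to coding, functions from numbers to numbers, called reals). $\mathrm{RCA}_0$ is the usual base system of reverse mathematics. $\mathrm{WKL}_0$ is $\mathrm{RCA}_0$ plus the statement that every infinite binary tree has an infinite path. $\leq_{\rm T}$ denotes Turing reducibility. A tree $T\subseteq\omega^{<\omega}$ is a set of finite strings closed under initial segments; $[T]$ is the collection of its infinite paths. A perfect tree is a nonempty tree in which every node has two incompatible extensions in the tree. A set $A$ of reals is cofinal if for every real $x$ there is some $y\in A$ with $y\geq_{\rm T} x$. A pointed tree $T$ is a perfect tree such that $T\leq_{\rm T} x$ for every infinite path $x\in[T]$. Martin's pointed tree theorem, $\mathrm{MPT}$, is the statement (formulated in second order arithmetic): for every tree $T\subseteq\omega^{<\omega}$, if $[T]$ is cofinal, then $T$ has a pointed subtree. -}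

module Defs where

open import Data.Nat.Base as ℕ using (ℕ; zero; suc)
open import Data.Fin.Base using (Fin; zero; suc)
open import Data.List.Base using (List; []; _∷_; map)
import Data.List.Membership.Propositional as List
open import Function.Base using (id; _∘_)
open import Level using (0ℓ)
open import Relation.Nullary using (¬_)
open import Relation.Unary using (Pred)

private
  variable
    n n′ m m′ : ℕ

------------------------------------------------------------------------
-- The language of second order arithmetic

infixl 7 _·_
infixl 6 _+_
infix  5 _≐_ _≺_ _ε_
infixr 4 _∧_
infixr 3 _∨_
infixr 2 _⇒_
infix  1 _⇔_

-- Term n: n free number variables.  Formula n m: n free number variables
-- and m free set variables.  Both sorts use de Bruijn indices.

data Term (n : ℕ) : Set where
  var     : Fin n → Term n
  𝟎 𝟏     : Term n
  _+_ _·_ : Term n → Term n → Term n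

data Formula (n m : ℕ) : Set where
  _≐_ _≺_     : Term n → Term n → Formula n m
  _ε_         : Term n → Fin m → Formula n m
  ⊥′          : Formula n m
  _∧_ _∨_ _⇒_ : Formula n m → Formula n m → Formula n m
  all₁ ex₁    : Formula (suc n) m → Formula n m
  all₂ ex₂    : Formula n (suc m) → Formula n m

Sentence : Set
Sentence = Formula 0 0

Theory : Set₁
Theory = Pred Sentence 0ℓ

~_ : Formula n m → Formula n m
~ φ = φ ⇒ ⊥′

_⇔_ : Formula n m → Formula n m → Formula n m
φ ⇔ ψ = (φ ⇒ ψ) ∧ (ψ ⇒ φ)

infix 8 ~_

------------------------------------------------------------------------
-- Substitution

subTerm : (Fin n → Term n′) → Term n → Term n′
subTerm σ (var i) = σ i
subTerm σ 𝟎       = 𝟎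
subTerm σ 𝟏       = 𝟏
subTerm σ (t + u) = subTerm σ t + subTerm σ u
subTerm σ (t · u) = subTerm σ t · subTerm σ u

wkTerm : Term n → Term (suc n)
wkTerm = subTerm (var ∘ suc)

-- Extends an assignment by a value for the variable 0.
_▹_ : {A : Set} → A → (Fin n → A) → Fin (suc n) → A
(a ▹ σ) zero    = a
(a ▹ σ) (suc i) = σ i

infixr 5 _▹_

-- Simultaneous substitution of terms for number variables and of set
-- variables for set variables (the only terms of the set sort).
sub : (Fin n → Term n′) → (Fin m → Fin m′) → Formula n m → Formula n′ m′
sub σ τ (t ≐ u)  = subTerm σ t ≐ subTerm σ u
sub σ τ (t ≺ u)  = subTerm σ t ≺ subTerm σ u
sub σ τ (t ε X)  = subTerm σ t ε τ X
sub σ τ ⊥′       = ⊥′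
sub σ τ (φ ∧ ψ)  = sub σ τ φ ∧ sub σ τ ψ
sub σ τ (φ ∨ ψ)  = sub σ τ φ ∨ sub σ τ ψ
sub σ τ (φ ⇒ ψ)  = sub σ τ φ ⇒ sub σ τ ψ
sub σ τ (all₁ φ) = all₁ (sub (var zero ▹ wkTerm ∘ σ) τ φ)
sub σ τ (ex₁ φ)  = ex₁ (sub (var zero ▹ wkTerm ∘ σ) τ φ)
sub σ τ (all₂ φ) = all₂ (sub σ (zero ▹ suc ∘ τ) φ)
sub σ τ (ex₂ φ)  = ex₂ (sub σ (zero ▹ suc ∘ τ) φ)

wk₁ : Formula n m → Formula (suc n) m
wk₁ = sub (var ∘ suc) id

wk₂ : Formula n m → Formula n (suc m)
wk₂ = sub var suc

_[_]₁ : Formula (suc n) m → Term n → Formula n m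
φ [ t ]₁ = sub (t ▹ var) id φ

_[_]₂ : Formula n (suc m) → Fin m → Formula n m
φ [ X ]₂ = sub var (X ▹ id) φ

infix 9 _[_]₁ _[_]₂

weaken : Sentence → Formula n m
weaken = sub (λ ()) (λ ())

close : Formula n m → Sentence
close {zero}  {zero}  φ = φ
close {zero}  {suc m} φ = close (all₂ φ)
close {suc n} {m}     φ = close (all₁ φ)

------------------------------------------------------------------------
-- Classical two-sorted natural deduction, with equality on numbers

infix 1 _∣_⊢_

data _∣_⊢_ (T : Theory) {n m} (Γ : List (Formula n m)) :
           Formula n m → Set where
  axiom : ∀ {σ} → T σ → T ∣ Γ ⊢ weaken σ
  hyp   : ∀ {φ} → φ List.∈ Γ → T ∣ Γ ⊢ φ

  ⇒I  : ∀ {φ ψ} → T ∣ φ ∷ Γ ⊢ ψ → T ∣ Γ ⊢ φ ⇒ ψ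
  ⇒E  : ∀ {φ ψ} → T ∣ Γ ⊢ φ ⇒ ψ → T ∣ Γ ⊢ φ → T ∣ Γ ⊢ ψ
  ∧I  : ∀ {φ ψ} → T ∣ Γ ⊢ φ → T ∣ Γ ⊢ ψ → T ∣ Γ ⊢ φ ∧ ψ
  ∧E₁ : ∀ {φ ψ} → T ∣ Γ ⊢ φ ∧ ψ → T ∣ Γ ⊢ φ
  ∧E₂ : ∀ {φ ψ} → T ∣ Γ ⊢ φ ∧ ψ → T ∣ Γ ⊢ ψ
  ∨I₁ : ∀ {φ ψ} → T ∣ Γ ⊢ φ → T ∣ Γ ⊢ φ ∨ ψ
  ∨I₂ : ∀ {φ ψ} → T ∣ Γ ⊢ ψ → T ∣ Γ ⊢ φ ∨ ψ
  ∨E  : ∀ {φ ψ χ} → T ∣ Γ ⊢ φ ∨ ψ →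
        T ∣ φ ∷ Γ ⊢ χ → T ∣ ψ ∷ Γ ⊢ χ → T ∣ Γ ⊢ χ
  RAA : ∀ {φ} → T ∣ ~ φ ∷ Γ ⊢ ⊥′ → T ∣ Γ ⊢ φ

  ∀₁I : ∀ {φ} → T ∣ map wk₁ Γ ⊢ φ → T ∣ Γ ⊢ all₁ φ
  ∀₁E : ∀ {φ} → T ∣ Γ ⊢ all₁ φ → ∀ t → T ∣ Γ ⊢ φ [ t ]₁
  ∃₁I : ∀ {φ} t → T ∣ Γ ⊢ φ [ t ]₁ → T ∣ Γ ⊢ ex₁ φ
  ∃₁E : ∀ {φ ψ} → T ∣ Γ ⊢ ex₁ φ →
        T ∣ φ ∷ map wk₁ Γ ⊢ wk₁ ψ → T ∣ Γ ⊢ ψ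

  ∀₂I : ∀ {φ} → T ∣ map wk₂ Γ ⊢ φ → T ∣ Γ ⊢ all₂ φ
  ∀₂E : ∀ {φ} → T ∣ Γ ⊢ all₂ φ → ∀ X → T ∣ Γ ⊢ φ [ X ]₂
  ∃₂I : ∀ {φ} X → T ∣ Γ ⊢ φ [ X ]₂ → T ∣ Γ ⊢ ex₂ φ
  ∃₂E : ∀ {φ ψ} → T ∣ Γ ⊢ ex₂ φ →
        T ∣ φ ∷ map wk₂ Γ ⊢ wk₂ ψ → T ∣ Γ ⊢ ψ

  ≐I  : ∀ {t} → T ∣ Γ ⊢ t ≐ t
  ≐E  : ∀ {t u} φ → T ∣ Γ ⊢ t ≐ u → T ∣ Γ ⊢ φ [ t ]₁ → T ∣ Γ ⊢ φ [ u ]₁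

infix 1 _⊢_ _⊬_

_⊢_ _⊬_ : Theory → Sentence → Set
T ⊢ σ = T ∣ [] ⊢ σ
T ⊬ σ = ¬ (T ⊢ σ)

------------------------------------------------------------------------
-- Binder notation

-- The quantifiers below bind an Agda variable that stands for the newly
-- bound variable in the scope just under the quantifier.  Under d further
-- quantifiers of its sort, a term t is written t ↑ d and a set variable X
-- is written X ⇑ d.

∀₁ ∃₁ : (Term (suc n) → Formula (suc n) m) → Formula n m
∀₁ f = all₁ (f (var zero))
∃₁ f = ex₁ (f (var zero))

∀₂ ∃₂ : (Fin (suc m) → Formula n (suc m)) → Formula n m
∀₂ f = all₂ (f zero)
∃₂ f = ex₂ (f zero)

infix 9 _↑_ _⇑_

_↑_ : Term n → ∀ d → Term (d ℕ.+ n)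
t ↑ zero  = t
t ↑ suc d = wkTerm (t ↑ d)

_⇑_ : Fin m → ∀ d → Fin (d ℕ.+ m)
X ⇑ zero  = X
X ⇑ suc d = suc (X ⇑ d)

------------------------------------------------------------------------
-- RCA₀

data Δ₀ {n m} : Formula n m → Set where
  Δ-≐ : ∀ {t u} → Δ₀ (t ≐ u)
  Δ-≺ : ∀ {t u} → Δ₀ (t ≺ u)
  Δ-ε : ∀ {t X} → Δ₀ (t ε X)
  Δ-⊥ : Δ₀ ⊥′
  Δ-∧ : ∀ {φ ψ} → Δ₀ φ → Δ₀ ψ → Δ₀ (φ ∧ ψ)
  Δ-∨ : ∀ {φ ψ} → Δ₀ φ → Δ₀ ψ → Δ₀ (φ ∨ ψ)
  Δ-⇒ : ∀ {φ ψ} → Δ₀ φ → Δ₀ ψ → Δ₀ (φ ⇒ ψ)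
  Δ-∀ : ∀ {t φ} → Δ₀ φ → Δ₀ (all₁ (var zero ≺ wkTerm t ⇒ φ))
  Δ-∃ : ∀ {t φ} → Δ₀ φ → Δ₀ (ex₁ (var zero ≺ wkTerm t ∧ φ))

data Σ₁ {n m} : Formula n m → Set where
  Σ-∃ : ∀ {φ} → Δ₀ φ → Σ₁ (ex₁ φ)

data Π₁ {n m} : Formula n m → Set where
  Π-∀ : ∀ {φ} → Δ₀ φ → Π₁ (all₁ φ)

-- φ(x) ↦ φ(x + 1), where x is the variable 0.
next : Formula (suc n) m → Formula (suc n) m
next = sub (var zero + 𝟏 ▹ var ∘ suc) id

induction : Formula (suc n) m → Sentence
induction φ = close (φ [ 𝟎 ]₁ ∧ all₁ (φ ⇒ next φ) ⇒ all₁ φ)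

Δ₁-comprehension : Formula (suc n) m → Formula (suc n) m → Sentence
Δ₁-comprehension φ ψ =
  close (all₁ (φ ⇔ ψ) ⇒ ∃₂ λ X → ∀₁ λ x → (x ε X) ⇔ wk₂ φ)

data RCA₀ : Theory where
  suc≢0   : RCA₀ (∀₁ λ a → ~ (a + 𝟏 ≐ 𝟎))
  suc-inj : RCA₀ (∀₁ λ a → ∀₁ λ b → a ↑ 1 + 𝟏 ≐ b + 𝟏 ⇒ a ↑ 1 ≐ b)
  +-zero  : RCA₀ (∀₁ λ a → a + 𝟎 ≐ a)
  +-suc   : RCA₀ (∀₁ λ a → ∀₁ λ b → a ↑ 1 + (b + 𝟏) ≐ (a ↑ 1 + b) + 𝟏)
  ·-zero  : RCA₀ (∀₁ λ a → a · 𝟎 ≐ 𝟎)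
  ·-suc   : RCA₀ (∀₁ λ a → ∀₁ λ b → a ↑ 1 · (b + 𝟏) ≐ a ↑ 1 · b + a ↑ 1)
  ≺-zero  : RCA₀ (∀₁ λ a → ~ (a ≺ 𝟎))
  ≺-suc   : RCA₀ (∀₁ λ a → ∀₁ λ b →
              (a ↑ 1 ≺ b + 𝟏) ⇔ (a ↑ 1 ≺ b ∨ a ↑ 1 ≐ b))
  Σ₁-IND  : ∀ {n m} {φ : Formula (suc n) m} → Σ₁ φ → RCA₀ (induction φ)
  Δ₁-CA   : ∀ {n m} {φ ψ : Formula (suc n) m} → Σ₁ φ → Π₁ ψ →
            RCA₀ (Δ₁-comprehension φ ψ)

------------------------------------------------------------------------
-- Finite sequences of numbers, following Simpson's coding in RCA₀

⟨_,_⟩ : Term n → Term n → Term n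
⟨ a , b ⟩ = (a + b) · (a + b) + a

numeral : ℕ → Term n
numeral zero    = 𝟎
numeral (suc k) = numeral k + 𝟏

Divides : Term n → Term n → Formula n m
Divides a b = ∃₁ λ c → a ↑ 1 · c ≐ b ↑ 1

-- The number ⟨ k , ⟨ a , b ⟩ ⟩ represents the finite set of those i < k
-- for which a · (i + 1) + 1 divides b.
InFinite : Term n → Term n → Formula n m
InFinite i c = ∃₁ λ k → ∃₁ λ a → ∃₁ λ b →
  c ↑ 3 ≐ ⟨ k ↑ 2 , ⟨ a ↑ 1 , b ⟩ ⟩ ∧
  i ↑ 3 ≺ k ↑ 2 ∧
  Divides (a ↑ 1 · (i ↑ 3 + 𝟏) + 𝟏) b

-- The code of a finite set is its least representative.  Numbers not of
-- the above form have no elements, and so they are excluded by 0, which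
-- is ⟨ 0 , ⟨ 0 , 0 ⟩ ⟩.
FiniteSet : Term n → Formula n m
FiniteSet c = ∀₁ λ d →
  d ≺ c ↑ 1 ⇒ ~ (∀₁ λ i → InFinite i (d ↑ 1) ⇔ InFinite i (c ↑ 2))

Entry : Term n → Term n → Term n → Formula n m
Entry s i a = InFinite ⟨ i , a ⟩ s

-- A sequence is the finite graph of a function on some {i | i < l}.
Seq : Term n → Formula n m
Seq s =
  FiniteSet s ∧
  (∀₁ λ u → InFinite u (s ↑ 1) ⇒ ∃₁ λ i → ∃₁ λ a → u ↑ 2 ≐ ⟨ i ↑ 1 , a ⟩) ∧
  (∀₁ λ i → ∀₁ λ a → ∀₁ λ b →
     Entry (s ↑ 3) (i ↑ 2) (a ↑ 1) ∧ Entry (s ↑ 3) (i ↑ 2) b ⇒ a ↑ 1 ≐ b) ∧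
  (∃₁ λ l → ∀₁ λ i → (i ≺ l ↑ 1) ⇔ (∃₁ λ a → Entry (s ↑ 3) (i ↑ 1) a))

Initial : Term n → Term n → Formula n m
Initial s t = ∀₁ λ i → ∀₁ λ a → Entry (s ↑ 2) (i ↑ 1) a ⇒ Entry (t ↑ 2) (i ↑ 1) a

Incompatible : Term n → Term n → Formula n m
Incompatible s t = ~ Initial s t ∧ ~ Initial t s

------------------------------------------------------------------------
-- Turing reducibility

-- Earlier s i e x y: some entry of s before the i-th is ⟨ e , ⟨ x , y ⟩ ⟩.
Earlier : Term n → Term n → Term n → Term n → Term n → Formula n m
Earlier s i e x y = ∃₁ λ j →
  j ≺ i ↑ 1 ∧ Entry (s ↑ 1) j ⟨ e ↑ 1 , ⟨ x ↑ 1 , y ↑ 1 ⟩ ⟩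

-- The claim "e on input x yields y" follows from the entries of s before
-- the i-th by one of the schemes for unary functions partial recursive in
-- the characteristic function of Y:
--   ⟨ 0 , c ⟩            constant c
--   ⟨ 1 , 0 ⟩            identity
--   ⟨ 2 , 0 ⟩            successor
--   ⟨ 3 , 0 ⟩, ⟨ 4 , 0 ⟩ first and second projection of a pair
--   ⟨ 5 , 0 ⟩            characteristic function of Y
--   ⟨ 6 , ⟨ f , g ⟩ ⟩    x ↦ ⟨ f x , g x ⟩
--   ⟨ 7 , ⟨ f , g ⟩ ⟩    x ↦ f (g x)
--   ⟨ 8 , ⟨ f , g ⟩ ⟩    h ⟨ a , 0 ⟩ = f a,
--                        h ⟨ a , c + 1 ⟩ = g ⟨ a , ⟨ c , h ⟨ a , c ⟩ ⟩ ⟩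
--   ⟨ 9 , f ⟩            x ↦ least y with f ⟨ x , y ⟩ = 0, where f ⟨ x , z ⟩
--                        is defined and nonzero for all z < y
Justified : Fin m → Term n → Term n → Term n → Term n → Term n → Formula n m
Justified Y s i e x y =
  e ≐ ⟨ numeral 0 , y ⟩
  ∨ (e ≐ ⟨ numeral 1 , 𝟎 ⟩ ∧ y ≐ x)
  ∨ (e ≐ ⟨ numeral 2 , 𝟎 ⟩ ∧ y ≐ x + 𝟏)
  ∨ (e ≐ ⟨ numeral 3 , 𝟎 ⟩ ∧ ∃₁ λ b → x ↑ 1 ≐ ⟨ y ↑ 1 , b ⟩)
  ∨ (e ≐ ⟨ numeral 4 , 𝟎 ⟩ ∧ ∃₁ λ a → x ↑ 1 ≐ ⟨ a , y ↑ 1 ⟩)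
  ∨ (e ≐ ⟨ numeral 5 , 𝟎 ⟩ ∧ ((x ε Y ∧ y ≐ 𝟏) ∨ (~ (x ε Y) ∧ y ≐ 𝟎)))
  ∨ (∃₁ λ f → ∃₁ λ g → e ↑ 2 ≐ ⟨ numeral 6 , ⟨ f ↑ 1 , g ⟩ ⟩ ∧
      ∃₁ λ a → ∃₁ λ b →
        Earlier (s ↑ 4) (i ↑ 4) (f ↑ 3) (x ↑ 4) (a ↑ 1) ∧
        Earlier (s ↑ 4) (i ↑ 4) (g ↑ 2) (x ↑ 4) b ∧
        y ↑ 4 ≐ ⟨ a ↑ 1 , b ⟩)
  ∨ (∃₁ λ f → ∃₁ λ g → e ↑ 2 ≐ ⟨ numeral 7 , ⟨ f ↑ 1 , g ⟩ ⟩ ∧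
      ∃₁ λ a →
        Earlier (s ↑ 3) (i ↑ 3) (g ↑ 1) (x ↑ 3) a ∧
        Earlier (s ↑ 3) (i ↑ 3) (f ↑ 2) a (y ↑ 3))
  ∨ (∃₁ λ f → ∃₁ λ g → e ↑ 2 ≐ ⟨ numeral 8 , ⟨ f ↑ 1 , g ⟩ ⟩ ∧
      ∃₁ λ a →
        (x ↑ 3 ≐ ⟨ a , 𝟎 ⟩ ∧ Earlier (s ↑ 3) (i ↑ 3) (f ↑ 2) a (y ↑ 3))
        ∨ (∃₁ λ c → ∃₁ λ b →
            x ↑ 5 ≐ ⟨ a ↑ 2 , c ↑ 1 + 𝟏 ⟩ ∧
            Earlier (s ↑ 5) (i ↑ 5) (e ↑ 5) ⟨ a ↑ 2 , c ↑ 1 ⟩ b ∧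
            Earlier (s ↑ 5) (i ↑ 5) (g ↑ 3) ⟨ a ↑ 2 , ⟨ c ↑ 1 , b ⟩ ⟩ (y ↑ 5)))
  ∨ (∃₁ λ f → e ↑ 1 ≐ ⟨ numeral 9 , f ⟩ ∧
      Earlier (s ↑ 1) (i ↑ 1) f ⟨ x ↑ 1 , y ↑ 1 ⟩ 𝟎 ∧
      (∀₁ λ z → z ≺ y ↑ 2 ⇒
        ∃₁ λ w → Earlier (s ↑ 3) (i ↑ 3) (f ↑ 2) ⟨ x ↑ 3 , z ↑ 1 ⟩ (w + 𝟏)))

-- {e}^Y(x) = y, witnessed by a computation s.
Computes : Fin m → Term n → Term n → Term n → Formula n m
Computes Y e x y = ∃₁ λ s →
  Seq s ∧
  (∀₁ λ i → ∀₁ λ d → Entry (s ↑ 2) (i ↑ 1) d ⇒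
    ∃₁ λ e′ → ∃₁ λ x′ → ∃₁ λ y′ →
      d ↑ 3 ≐ ⟨ e′ ↑ 2 , ⟨ x′ ↑ 1 , y′ ⟩ ⟩ ∧
      Justified Y (s ↑ 5) (i ↑ 4) (e′ ↑ 2) (x′ ↑ 1) y′) ∧
  (∃₁ λ i → Entry (s ↑ 1) i ⟨ e ↑ 2 , ⟨ x ↑ 2 , y ↑ 2 ⟩ ⟩)

_≤T_ : Fin m → Fin m → Formula n m
X ≤T Y = ∃₁ λ e → ∀₁ λ x →
  (x ε X ⇒ Computes Y (e ↑ 1) x 𝟏) ∧ (~ (x ε X) ⇒ Computes Y (e ↑ 1) x 𝟎)

infix 5 _≤T_

------------------------------------------------------------------------
-- Trees

Tree : Fin m → Formula n m
Tree T = ∀₁ λ s → s ε T ⇒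
  Seq s ∧ (∀₁ λ t → Seq t ∧ Initial t (s ↑ 1) ⇒ t ε T)

-- F is the graph of a function from numbers to numbers.
Function : Fin m → Formula n m
Function F =
  (∀₁ λ u → u ε F ⇒ ∃₁ λ i → ∃₁ λ a → u ↑ 2 ≐ ⟨ i ↑ 1 , a ⟩) ∧
  (∀₁ λ i → ∃₁ λ a → ⟨ i ↑ 1 , a ⟩ ε F) ∧
  (∀₁ λ i → ∀₁ λ a → ∀₁ λ b →
     ⟨ i ↑ 2 , a ↑ 1 ⟩ ε F ∧ ⟨ i ↑ 2 , b ⟩ ε F ⇒ a ↑ 1 ≐ b)

-- F ∈ [T]
Path : Fin m → Fin m → Formula n m
Path T F = Function F ∧
  (∀₁ λ s →
     Seq s ∧ (∀₁ λ i → ∀₁ λ a → Entry (s ↑ 2) (i ↑ 1) a ⇒ ⟨ i ↑ 1 , a ⟩ ε F) ⇒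
     s ε T)

Perfect : Fin m → Formula n m
Perfect T =
  Tree T ∧
  (∃₁ λ s → s ε T) ∧
  (∀₁ λ s → s ε T ⇒ ∃₁ λ t → ∃₁ λ u →
     t ↑ 1 ε T ∧ u ε T ∧
     Initial (s ↑ 2) (t ↑ 1) ∧ Initial (s ↑ 2) u ∧ Incompatible (t ↑ 1) u)

Pointed : Fin m → Formula n m
Pointed T = Perfect T ∧ (∀₂ λ X → Path (T ⇑ 1) X ⇒ T ⇑ 1 ≤T X)

CofinalPaths : Fin m → Formula n m
CofinalPaths T = ∀₂ λ X → ∃₂ λ Y → Path (T ⇑ 2) Y ∧ X ⇑ 1 ≤T Y

MPT : Sentence
MPT = ∀₂ λ T → Tree T ∧ CofinalPaths T ⇒
  ∃₂ λ S → (∀₁ λ s → s ε S ⇒ s ε T ⇑ 1) ∧ Pointed S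

Binary : Fin m → Formula n m
Binary T = ∀₁ λ s → s ε T ⇒
  ∀₁ λ i → ∀₁ λ a → Entry (s ↑ 2) (i ↑ 1) a ⇒ a ≐ 𝟎 ∨ a ≐ 𝟏

Infinite : Fin m → Formula n m
Infinite T = ∀₁ λ b → ∃₁ λ s → s ε T ∧ ~ (s ≺ b ↑ 1)

WKL : Sentence
WKL = ∀₂ λ T → Tree T ∧ Binary T ∧ Infinite T ⇒ ∃₂ λ F → Path (T ⇑ 1) F

{-# OPTIONS --safe #-}
module Submission where

-- In the ω-model M of all sets computable from finitely many
-- columns of a Cohen generic set G, MPT holds and WKL fails.
--
-- Let T ∈ M be computable from the columns below n and let [T] be cofinal
-- in M.  Then some F ∈ [T] ∩ M computes the columns below n + 1, say by e,
-- and F is a functional of G.  By genericity some condition p forces that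
-- the values of this functional are paths through T from which e recovers
-- the generic columns.  Hence every extension of p that agrees with G below
-- column n can be extended further, inside the n-th column in two ways, to
-- conditions giving longer and longer approximations to F; and the two
-- ways lead to different approximations, because e tells them apart.
-- Searching for such extensions, computably in the columns below n, yields
-- a perfect subtree of T all of whose paths compute, by e, the columns
-- below n, and so the subtree itself.
--
-- The case n = 0 of the same argument shows that a path in M through the
-- Kleene tree, whose paths f are binary with f(i) ≠ {i}(i), could be
-- guessed computably, which is impossible.
--
-- The metatheory is constructive and the goal is negative, so formulas are
-- interpreted by their double-negation translation.

-- The obstacle is that the search may consult only the columns below n, while genericity speaks of
-- initial segments of all of G, and a node of the search tree need not be such a segment. The sets
-- `Projection` bridge this gap. They have an arbitrary condition q₀ as a parameter, and G meets
-- them on account of its columns below n alone; so any q₀ below the root that agrees with G there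
-- has good extensions that still agree with G there, even if G does not extend q₀. The other two
-- families express that the functional stops producing values, or produces wrong ones. Meeting
-- either would contradict what F does in the model, so an initial segment p of G avoids both. Below
-- p everything about F becomes a property of finite strings. The extra column n is never consulted
-- by the search, so its bits are free; but e must recover it, so fixing a bit there in two ways
-- must show in F. One notion of evaluation, with a partial oracle that has separate positive and
-- negative answers, covers sets, conditions and finite approximations to F. For weak König's lemma
-- no recursion theorem is used: the guessing program is run on its own index.

open import Data.Nat.Base
open import Data.Nat.Properties
open import Data.Nat.Divisibility
  using (_∣_; _∣?_; divides; ∣-trans; ∣m+n∣m⇒∣n; m∣m*n; n∣m*n; ∣1⇒≡1; m≤n⇒m!∣n!; ∣-refl)
open import Data.Nat.Coprimality as Coprimality using (Coprime; coprime-divisor)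
open import Data.Nat.Induction using (<-rec)
open import Data.Nat.Tactic.RingSolver using (solve-∀)
open import Data.Fin.Base using (Fin; zero; suc)
open import Data.Vec.Base using (Vec; []; _∷_; lookup; map)
open import Data.List.Base using (List; length)
  renaming ([] to []ᴸ; _∷_ to _∷ᴸ_; _++_ to _++ᴸ_)
open import Data.List.Membership.Propositional using (_∈_)
open import Data.List.Membership.Propositional.Properties using (∈-++⁺ˡ; ∈-++⁺ʳ)
open import Data.List.Membership.DecPropositional _≟_ using (_∈?_)
open import Data.List.Relation.Unary.All as All using (All)
import Data.List.Relation.Unary.All.Properties as Allₚ
open import Data.List.Relation.Unary.Any using (here; there)
open import Data.Product.Base using (Σ; ∃; _×_; _,_; proj₁; proj₂)
open import Data.Sum.Base using (_⊎_; inj₁; inj₂)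
open import Data.Empty using (⊥; ⊥-elim)
open import Function.Base using (id; _∘_; case_of_)
open import Relation.Nullary using (¬_; Dec; yes; no; map′; ¬?; _×-dec_; _⊎-dec_)
open import Relation.Nullary.Decidable using (¬¬-excluded-middle; decidable-stable)
open import Relation.Binary.PropositionalEquality
open import Relation.Binary.Definitions using (tri<; tri≈; tri>)
open import Relation.Unary using (_∪_; ｛_｝)
open import Defs renaming (_+_ to _+′_; +-suc to +-suc′)

-- Classical reasoning

infix 3 ¬¬_
¬¬_ : Set → Set
¬¬ A = ¬ ¬ A

infixl 1 _>>=_
_>>=_ : {A B : Set} → ¬¬ A → (A → ¬¬ B) → ¬¬ B
(m >>= f) k = m λ a → f a k

return : {A : Set} → A → ¬¬ A
return a k = k a

run : ¬¬ ⊥ → ⊥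
run m = m id

em : (A : Set) → ¬¬ Dec A
em A = ¬¬-excluded-middle

¬¬-∀< : ∀ k {P : ℕ → Set} → (∀ i → i < k → ¬¬ P i) → ¬¬ (∀ i → i < k → P i)
¬¬-∀< zero    h = return λ _ ()
¬¬-∀< (suc k) {P} h = do
  p  ← h k ≤-refl
  ps ← ¬¬-∀< k (λ i i<k → h i (m<n⇒m<1+n i<k))
  return λ i i<1+k → case m<1+n⇒m<n∨m≡n i<1+k of λ where
    (inj₁ i<k)  → ps i i<k
    (inj₂ refl) → p

-- Collection: `P` is upward closed in the bound, so a maximum of finitely many bounds serves all
-- `i` at once.
¬¬-bound : ∀ k {P : ℕ → ℕ → Set} → (∀ i {b c} → b ≤ c → P i b → P i c) →
           (∀ i → i < k → ¬¬ ∃ (P i)) → ¬¬ ∃ λ b → ∀ i → i < k → P i b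
¬¬-bound zero    up h = return (0 , λ _ ())
¬¬-bound (suc k) up h = do
  b , p  ← h k ≤-refl
  c , ps ← ¬¬-bound k up (λ i i<k → h i (m<n⇒m<1+n i<k))
  return (b ⊔ c , λ i i<1+k → case m<1+n⇒m<n∨m≡n i<1+k of λ where
    (inj₁ i<k)  → up i (m≤n⊔m b c) (ps i i<k)
    (inj₂ refl) → up i (m≤m⊔n b c) p)

¬¬-least : ∀ {P : ℕ → Set} n → P n → ¬¬ ∃ λ m → P m × ∀ k → k < m → ¬ P k
¬¬-least {P} = <-rec _ λ n rec p → do
  yes (m , m<n , q) ← em (∃ λ m → m < n × P m)
    where no ¬q → return (n , p , λ k k<n q → ¬q (k , k<n , q))
  rec m<n q

-- Pairing

opaque
  -- The polynomial of `⟨_,_⟩`. It is opaque, so codes are compared by `pair-inj`; its value is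
  -- exposed only where formulas meet their meaning.
  pair : ℕ → ℕ → ℕ
  pair a b = (a + b) * (a + b) + a

  pair-def : ∀ a b → pair a b ≡ (a + b) * (a + b) + a
  pair-def a b = refl

private
  -- Pairs with sum m have codes from m² to m² + m, all below (m + 1)². Hence a code determines the
  -- sum, and then the first component.
  square-gap : ∀ {m n} a c → a ≤ m → m < n → m * m + a < n * n + c
  square-gap {m} {n} a c a≤m m<n = begin-strict
    m * m + a         ≤⟨ +-monoʳ-≤ (m * m) a≤m ⟩
    m * m + m         <⟨ +-monoʳ-< (m * m) (n<1+n m) ⟩
    m * m + suc m     ≤⟨ m≤n+m _ m ⟩
    m + (m * m + suc m) ≡⟨ cong (m +_) (+-comm (m * m) (suc m)) ⟩
    m + suc (m + m * m) ≡⟨ +-suc m (m + m * m) ⟩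
    suc (m + (m + m * m)) ≡⟨ cong (λ z → suc (m + z)) (sym (*-suc m m)) ⟩
    suc m * suc m     ≤⟨ *-mono-≤ m<n m<n ⟩
    n * n             ≤⟨ m≤m+n _ c ⟩
    n * n + c         ∎
    where open ≤-Reasoning

pair-inj : ∀ {a b c d} → pair a b ≡ pair c d → a ≡ c × b ≡ d
pair-inj {a} {b} {c} {d} eq = a≡c , +-cancelˡ-≡ a b d (trans s (cong (_+ d) (sym a≡c)))
  where
  eq′ : (a + b) * (a + b) + a ≡ (c + d) * (c + d) + c
  eq′ = trans (sym (pair-def a b)) (trans eq (pair-def c d))
  s : a + b ≡ c + d
  s with <-cmp (a + b) (c + d)
  ... | tri< l _ _ = ⊥-elim (<⇒≢ (square-gap a c (m≤m+n a b) l) eq′)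
  ... | tri≈ _ e _ = e
  ... | tri> _ _ g = ⊥-elim (<⇒≢ (square-gap c a (m≤m+n c d) g) (sym eq′))
  a≡c : a ≡ c
  a≡c = +-cancelˡ-≡ ((c + d) * (c + d)) a c (trans (cong (λ z → z * z + a) (sym s)) eq′)

≤pairˡ : ∀ a b → a ≤ pair a b
≤pairˡ a b = subst (a ≤_) (sym (pair-def a b)) (m≤n+m a _)

≤pairʳ : ∀ a b → b ≤ pair a b
≤pairʳ a b = subst (b ≤_) (sym (pair-def a b)) (begin
  b                       ≤⟨ m≤n+m b a ⟩
  a + b                   ≤⟨ sq (a + b) ⟩
  (a + b) * (a + b)       ≤⟨ m≤m+n _ a ⟩
  (a + b) * (a + b) + a   ∎)
  where
  open ≤-Reasoning
  sq : ∀ n → n ≤ n * n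
  sq zero    = z≤n
  sq (suc n) = m≤m*n (suc n) (suc n)

-- Codes of finite sets

Bit : ℕ → ℕ → ℕ → Set
Bit a b v = Σ ℕ λ c → (a * (v + 1) + 1) * c ≡ b

-- `OutF` also demands v < k, so it is not the complement of `InF`. A number thus codes a binary
-- string of length k; one of another form decides nothing.
InF OutF : ℕ → ℕ → Set
InF  v c = Σ ℕ λ k → Σ ℕ λ a → Σ ℕ λ b → c ≡ pair k (pair a b) × v < k × Bit a b v
OutF v c = Σ ℕ λ k → Σ ℕ λ a → Σ ℕ λ b → c ≡ pair k (pair a b) × v < k × ¬ Bit a b v

bit⇒∣ : ∀ a b v → Bit a b v → a * (v + 1) + 1 ∣ b
bit⇒∣ a b v (c , eq) = divides c (trans (sym eq) (*-comm (a * (v + 1) + 1) c))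

∣⇒bit : ∀ a b v → a * (v + 1) + 1 ∣ b → Bit a b v
∣⇒bit a b v (divides c eq) = c , trans (*-comm (a * (v + 1) + 1) c) (sym eq)

bit? : ∀ a b v → Dec (Bit a b v)
bit? a b v = map′ (∣⇒bit a b v) (bit⇒∣ a b v) (a * (v + 1) + 1 ∣? b)

in<code : ∀ {v c} → InF v c → v < c
in<code {v} (k , a , b , refl , v<k , _) = <-≤-trans v<k (≤pairˡ k (pair a b))

out<code : ∀ {v c} → OutF v c → v < c
out<code {v} (k , a , b , refl , v<k , _) = <-≤-trans v<k (≤pairˡ k (pair a b))

in-out : ∀ {v c} → InF v c → ¬ OutF v c
in-out (k , a , b , eq , _ , β) (k′ , a′ , b′ , eq′ , _ , ¬β)
  with pair-inj (trans (sym eq) eq′)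
... | refl , e with pair-inj e
... | refl , refl = ¬β β

-- Simpson's choice: with k ! dividing a, the moduli a (i + 1) + 1 for
-- i < k are pairwise coprime.
private
  module Moduli (k : ℕ) where
    M : ℕ → ℕ
    M i = k ! * (i + 1) + 1

    -- A common divisor divides j - i, hence k ! because 0 < j - i < k, hence `M i` - 1, and so 1.
    coprime-lt : ∀ {i j} → i < j → j < k → Coprime (M i) (M j)
    coprime-lt {i} {j} i<j j<k {d} (d∣i , d∣j) = ∣1⇒≡1 (∣m+n∣m⇒∣n d∣i d∣a·)
      where
      e = j ∸ i
      -- (i + 1) M j and (j + 1) M i differ by j - i.
      diff : (j + 1) * M i ≡ (i + 1) * M j + e
      diff = begin
        (j + 1) * (k ! * (i + 1) + 1)
          ≡⟨ cong (λ z → (z + 1) * (k ! * (i + 1) + 1)) (sym (m∸n+n≡m (<⇒≤ i<j))) ⟩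
        (e + i + 1) * (k ! * (i + 1) + 1)
          ≡⟨ rearrange e i (k !) ⟩
        (i + 1) * (k ! * (e + i + 1) + 1) + e
          ≡⟨ cong (λ z → (i + 1) * (k ! * (z + 1) + 1) + e) (m∸n+n≡m (<⇒≤ i<j)) ⟩
        (i + 1) * M j + e ∎
        where
        open ≡-Reasoning
        rearrange : ∀ e i f → (e + i + 1) * (f * (i + 1) + 1) ≡ (i + 1) * (f * (e + i + 1) + 1) + e
        rearrange = solve-∀
      d∣e : d ∣ e
      d∣e = ∣m+n∣m⇒∣n (subst (d ∣_) diff (∣-trans d∣i (n∣m*n (j + 1)))) (∣-trans d∣j (n∣m*n (i + 1)))
      e∣k! : e ∣ k !
      e∣k! with e | m<n⇒0<n∸m i<j | ≤-trans (m∸n≤m j i) (<⇒≤ j<k)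
      ... | suc e′ | _ | e≤k = ∣-trans (m∣m*n (e′ !)) (m≤n⇒m!∣n! e≤k)
      d∣a· : d ∣ k ! * (i + 1)
      d∣a· = ∣-trans (∣-trans d∣e e∣k!) (m∣m*n (i + 1))

    coprime-≢ : ∀ {i j} → i < k → j < k → i ≢ j → Coprime (M i) (M j)
    coprime-≢ {i} {j} i<k j<k i≢j with <-cmp i j
    ... | tri< l _ _ = coprime-lt l j<k
    ... | tri≈ _ e _ = ⊥-elim (i≢j e)
    ... | tri> _ _ g = Coprimality.sym (coprime-lt g i<k)

    M≢1 : ∀ i → M i ≢ 1
    M≢1 i eq = <⇒≢ (*-mono-≤ (1≤n! k) (m≤n+m 1 i)) (sym (+-cancelʳ-≡ 1 (k ! * (i + 1)) 0 eq))

    coprime-* : ∀ {m n o} → Coprime m n → Coprime m o → Coprime m (n * o)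
    coprime-* {m} {n} c₁ c₂ {d} (d∣m , d∣no) =
      c₂ (d∣m , coprime-divisor (λ { (x∣d , x∣n) → c₁ (∣-trans x∣d d∣m , x∣n) }) d∣no)

    module _ (P : ℕ → Set) where
      -- The product of the moduli with index in `P`; the remaining ones are coprime to it and,
      -- being different from 1, do not divide it.
      prod : ∀ j → (∀ i → i < j → Dec (P i)) → j ≤ k →
             Σ ℕ λ b → (∀ i → i < j → P i → M i ∣ b) ×
                       (∀ i → i < k → ¬ P i → Coprime (M i) b)
      prod zero    P? _ = 1 , (λ _ ()) , λ i _ _ {d} (_ , d∣1) → ∣1⇒≡1 d∣1
      prod (suc j) P? j<k with prod j (λ i i<j → P? i (m<n⇒m<1+n i<j)) (<⇒≤ j<k) | P? j ≤-refl
      ... | b , divs , cops | yes p = M j * b ,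
        (λ i i<1+j pi → case m<1+n⇒m<n∨m≡n i<1+j of λ where
          (inj₁ i<j)  → ∣-trans (divs i i<j pi) (n∣m*n (M j))
          (inj₂ refl) → m∣m*n b) ,
        λ i i<k ¬pi → coprime-* (coprime-≢ i<k j<k λ { refl → ¬pi p }) (cops i i<k ¬pi)
      ... | b , divs , cops | no ¬p = b ,
        (λ i i<1+j pi → case m<1+n⇒m<n∨m≡n i<1+j of λ where
          (inj₁ i<j)  → divs i i<j pi
          (inj₂ refl) → ⊥-elim (¬p pi)) ,
        cops

-- The characteristic function of `P` cut off at `k`. Such codes serve as oracles, as forcing
-- conditions and as approximations to paths.
record String (k : ℕ) (P : ℕ → Set) : Set where
  field
    str  : ℕ
    in⇒  : ∀ {v} → InF v str → v < k × P v
    ⇒in  : ∀ {v} → v < k → P v → InF v str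
    out⇒ : ∀ {v} → OutF v str → v < k × ¬ P v
    ⇒out : ∀ {v} → v < k → ¬ P v → OutF v str
open String public

string : ∀ k {P : ℕ → Set} → (∀ i → i < k → Dec (P i)) → String k P
string k {P} P? = record
  { str  = pair k (pair a b)
  ; in⇒  = λ { (_ , _ , _ , eq , v<k , β) → in⇒′ eq v<k β }
  ; ⇒in  = λ {v} v<k p → k , a , b , refl , v<k , ∣⇒bit a b v (divs v v<k p)
  ; out⇒ = λ { (_ , _ , _ , eq , v<k , β) → out⇒′ eq v<k β }
  ; ⇒out = λ {v} v<k ¬p → k , a , b , refl , v<k , λ β → M≢1 v (cops v v<k ¬p (∣-refl , bit⇒∣ a b v β))
  }
  where
  open Moduli k
  a = k !
  b = proj₁ (prod P k P? ≤-refl)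
  divs = proj₁ (proj₂ (prod P k P? ≤-refl))
  cops = proj₂ (proj₂ (prod P k P? ≤-refl))
  in⇒′ : ∀ {k′ a′ b′ v} → pair k (pair a b) ≡ pair k′ (pair a′ b′) → v < k′ → Bit a′ b′ v → v < k × P v
  in⇒′ {v = v} eq v<k β with pair-inj eq
  ... | refl , e with pair-inj e
  ... | refl , refl with P? v v<k
  ...   | yes p = v<k , p
  ...   | no ¬p = ⊥-elim (M≢1 v (cops v v<k ¬p (∣-refl , bit⇒∣ a b v β)))
  out⇒′ : ∀ {k′ a′ b′ v} → pair k (pair a b) ≡ pair k′ (pair a′ b′) → v < k′ → ¬ Bit a′ b′ v → v < k × ¬ P v
  out⇒′ {v = v} eq v<k ¬β with pair-inj eq
  ... | refl , e with pair-inj e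
  ... | refl , refl = v<k , λ p → ¬β (∣⇒bit a b v (divs v v<k p))

¬¬-string : ∀ k (P : ℕ → Set) → ¬¬ String k P
¬¬-string k P = do
  P? ← ¬¬-∀< k (λ i _ → em (P i))
  return (string k P?)

listBound : List ℕ → ℕ
listBound []ᴸ       = 0
listBound (u ∷ᴸ us) = suc u ⊔ listBound us

∈⇒<listBound : ∀ {u us} → u ∈ us → u < listBound us
∈⇒<listBound {us = u ∷ᴸ us} (here refl) = m≤m⊔n (suc u) (listBound us)
∈⇒<listBound {us = u ∷ᴸ us} (there p)   = ≤-trans (∈⇒<listBound p) (m≤n⊔m (suc u) (listBound us))

listCode : (us : List ℕ) → String (listBound us) (_∈ us)
listCode us = string (listBound us) (λ i _ → i ∈? us)

-- Partial recursive functions relative to an oracle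

data Nonzero (E : ℕ → ℕ → ℕ → Set) (f x z : ℕ) : Set where
  nonzero : ∀ {w} → E f (pair x z) (suc w) → Nonzero E f x z

-- P and N are the queries which the (partial) oracle answers by 1 and by 0.
data Scheme (P N : ℕ → Set) (E : ℕ → ℕ → ℕ → Set) : (t a x y : ℕ) → Set where
  constˢ : ∀ {a x y} → y ≡ a → Scheme P N E 0 a x y
  idˢ    : ∀ {a x y} → a ≡ 0 → y ≡ x → Scheme P N E 1 a x y
  sucˢ   : ∀ {a x y} → a ≡ 0 → y ≡ suc x → Scheme P N E 2 a x y
  fstˢ   : ∀ {a x y b} → a ≡ 0 → x ≡ pair y b → Scheme P N E 3 a x y
  sndˢ   : ∀ {a x y b} → a ≡ 0 → x ≡ pair b y → Scheme P N E 4 a x y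
  inˢ    : ∀ {a x y} → a ≡ 0 → P x → y ≡ 1 → Scheme P N E 5 a x y
  outˢ   : ∀ {a x y} → a ≡ 0 → N x → y ≡ 0 → Scheme P N E 5 a x y
  pairˢ  : ∀ {a x y f g b c} → a ≡ pair f g → E f x b → E g x c → y ≡ pair b c →
           Scheme P N E 6 a x y
  compˢ  : ∀ {a x y f g b} → a ≡ pair f g → E g x b → E f b y → Scheme P N E 7 a x y
  zeroˢ  : ∀ {a x y f g b} → a ≡ pair f g → x ≡ pair b 0 → E f b y → Scheme P N E 8 a x y
  recˢ   : ∀ {a x y f g b c h} → a ≡ pair f g → x ≡ pair b (suc c) →
           E (pair 8 a) (pair b c) h → E g (pair b (pair c h)) y → Scheme P N E 8 a x y
  μˢ     : ∀ {a x y} → E a (pair x y) 0 → (∀ z → z < y → Nonzero E a x z) →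
           Scheme P N E 9 a x y

-- The recursion is tied outside `Scheme`, so that the same clauses can be read with `E` as the
-- earlier entries of a computation.
data Eval (P N : ℕ → Set) (e x y : ℕ) : Set where
  by : ∀ {t a} → e ≡ pair t a → Scheme P N (Eval P N) t a x y → Eval P N e x y

maxBelow : ∀ k → (∀ z → z < k → ℕ) → ℕ
maxBelow zero    f = 0
maxBelow (suc k) f = f k ≤-refl ⊔ maxBelow k (λ z p → f z (m<n⇒m<1+n p))

≤maxBelow : ∀ k f z (p : z < k) → f z p ≤ maxBelow k f
≤maxBelow (suc k) f z p with m<1+n⇒m<n∨m≡n p
... | inj₁ q = ≤-trans
  (≤-reflexive (cong (f z) (≤-irrelevant p (m<n⇒m<1+n q))))
  (≤-trans (≤maxBelow k (λ z p → f z (m<n⇒m<1+n p)) z q) (m≤n⊔m (f k ≤-refl) _))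
... | inj₂ refl = ≤-trans (≤-reflexive (cong (f z) (≤-irrelevant p ≤-refl)))
  (m≤m⊔n (f z ≤-refl) _)

-- The use principle and uniqueness of values

module _ {P N : ℕ → Set} where
  use : ∀ {e x y} → Eval P N e x y → ℕ
  useˢ : ∀ {t a x y} → Scheme P N (Eval P N) t a x y → ℕ
  useⁿ : ∀ {f x z} → Nonzero (Eval P N) f x z → ℕ
  use (by _ s) = useˢ s
  useⁿ (nonzero ev) = use ev
  useˢ (constˢ _) = 0
  useˢ (idˢ _ _) = 0
  useˢ (sucˢ _ _) = 0
  useˢ (fstˢ _ _) = 0
  useˢ (sndˢ _ _) = 0
  -- The use is a strict bound on the queries.
  useˢ {x = x} (inˢ _ _ _) = suc x
  useˢ {x = x} (outˢ _ _ _) = suc x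
  useˢ (pairˢ _ p q _) = use p ⊔ use q
  useˢ (compˢ _ p q) = use p ⊔ use q
  useˢ (zeroˢ _ _ p) = use p
  useˢ (recˢ _ _ p q) = use p ⊔ use q
  useˢ {y = y} (μˢ p h) = use p ⊔ maxBelow y (λ z z<y → useⁿ (h z z<y))

module _ {P N P′ N′ : ℕ → Set} where
  private
    Agree : ℕ → Set
    Agree L = ∀ v → v < L → (P v → P′ v) × (N v → N′ v)
    lft : ∀ {m n} → Agree (m ⊔ n) → Agree m
    lft {m} {n} h v v<m = h v (≤-trans v<m (m≤m⊔n m n))
    rgt : ∀ {m n} → Agree (m ⊔ n) → Agree n
    rgt {m} {n} h v v<n = h v (≤-trans v<n (m≤n⊔m m n))

  -- Only finitely many answers enter a computation. Agreement is one-sided, so the second oracle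
  -- may answer more queries than the first.
  transfer : ∀ {e x y} (ev : Eval P N e x y) → Agree (use ev) → Eval P′ N′ e x y
  transferˢ : ∀ {t a x y} (s : Scheme P N (Eval P N) t a x y) → Agree (useˢ s) →
              Scheme P′ N′ (Eval P′ N′) t a x y
  transferⁿ : ∀ {f x z} (n : Nonzero (Eval P N) f x z) → Agree (useⁿ n) →
              Nonzero (Eval P′ N′) f x z
  transfer (by eq s) h = by eq (transferˢ s h)
  transferⁿ (nonzero ev) h = nonzero (transfer ev h)
  transferˢ (constˢ p) h = constˢ p
  transferˢ (idˢ p q) h = idˢ p q
  transferˢ (sucˢ p q) h = sucˢ p q
  transferˢ (fstˢ p q) h = fstˢ p q
  transferˢ (sndˢ p q) h = sndˢ p q
  transferˢ (inˢ p q r) h = inˢ p (proj₁ (h _ ≤-refl) q) r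
  transferˢ (outˢ p q r) h = outˢ p (proj₂ (h _ ≤-refl) q) r
  transferˢ (pairˢ eq p q r) h =
    pairˢ eq (transfer p (lft {n = use q} h)) (transfer q (rgt {m = use p} h)) r
  transferˢ (compˢ eq p q) h =
    compˢ eq (transfer p (lft {n = use q} h)) (transfer q (rgt {m = use p} h))
  transferˢ (zeroˢ eq x p) h = zeroˢ eq x (transfer p h)
  transferˢ (recˢ eq x p q) h =
    recˢ eq x (transfer p (lft {n = use q} h)) (transfer q (rgt {m = use p} h))
  transferˢ {y = y} (μˢ p k) h = μˢ (transfer p (lft {n = maxBelow y f} h))
    λ z z<y → transferⁿ (k z z<y) λ v v<u →
      rgt {m = use p} h v (≤-trans v<u (≤maxBelow y f z z<y))
    where f = λ z z<y → useⁿ (k z z<y)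

  monotone : (∀ {v} → P v → P′ v) → (∀ {v} → N v → N′ v) →
             ∀ {e x y} → Eval P N e x y → Eval P′ N′ e x y
  monotone p n ev = transfer ev (λ v _ → p , n)

  module _ (pn : ∀ {v} → P v → ¬ N′ v) (np : ∀ {v} → N v → ¬ P′ v) where
    -- The two oracles may differ as long as they never contradict each other. This compares
    -- computations from two conditions, or from a finite approximation and a full set.
    functional  : ∀ {e x y y′} → Eval P N e x y → Eval P′ N′ e x y′ → y ≡ y′
    functionalˢ : ∀ {t a x y y′} → Scheme P N (Eval P N) t a x y →
                  Scheme P′ N′ (Eval P′ N′) t a x y′ → y ≡ y′
    nonzero≢0   : ∀ {f x z} → Nonzero (Eval P N) f x z → ¬ Eval P′ N′ f (pair x z) 0
    nonzero≢0′  : ∀ {f x z} → Eval P N f (pair x z) 0 → ¬ Nonzero (Eval P′ N′) f x z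
    functional (by eq s) (by eq′ s′) with pair-inj (trans (sym eq) eq′)
    ... | refl , refl = functionalˢ s s′
    nonzero≢0 (nonzero ev) ev′ with () ← functional ev ev′
    nonzero≢0′ ev (nonzero ev′) with () ← functional ev ev′
    functionalˢ (constˢ refl) (constˢ refl) = refl
    functionalˢ (idˢ _ refl) (idˢ _ refl) = refl
    functionalˢ (sucˢ _ refl) (sucˢ _ refl) = refl
    functionalˢ (fstˢ _ p) (fstˢ _ q) = proj₁ (pair-inj (trans (sym p) q))
    functionalˢ (sndˢ _ p) (sndˢ _ q) = proj₂ (pair-inj (trans (sym p) q))
    functionalˢ (inˢ _ _ refl) (inˢ _ _ refl) = refl
    functionalˢ (inˢ _ p _) (outˢ _ q _) = ⊥-elim (pn p q)
    functionalˢ (outˢ _ p _) (inˢ _ q _) = ⊥-elim (np p q)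
    functionalˢ (outˢ _ _ refl) (outˢ _ _ refl) = refl
    functionalˢ (pairˢ eq p q refl) (pairˢ eq′ p′ q′ refl) with pair-inj (trans (sym eq) eq′)
    ... | refl , refl = cong₂ pair (functional p p′) (functional q q′)
    functionalˢ (compˢ eq p q) (compˢ eq′ p′ q′) with pair-inj (trans (sym eq) eq′)
    ... | refl , refl with functional p p′
    ... | refl = functional q q′
    functionalˢ (zeroˢ eq x p) (zeroˢ eq′ x′ p′)
      with pair-inj (trans (sym eq) eq′) | pair-inj (trans (sym x) x′)
    ... | refl , refl | refl , _ = functional p p′
    functionalˢ (zeroˢ eq x p) (recˢ eq′ x′ p′ q′) with () ← proj₂ (pair-inj (trans (sym x) x′))
    functionalˢ (recˢ eq x p q) (zeroˢ eq′ x′ p′) with () ← proj₂ (pair-inj (trans (sym x) x′))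
    functionalˢ (recˢ eq x p q) (recˢ eq′ x′ p′ q′)
      with pair-inj (trans (sym eq) eq′) | pair-inj (trans (sym x) x′)
    ... | refl , refl | refl , refl with functional p p′
    ... | refl = functional q q′
    functionalˢ (μˢ {y = y} p h) (μˢ {y = y′} p′ h′) with <-cmp y y′

    ... | tri≈ _ e _ = e
    ... | tri< y<y′ _ _ = ⊥-elim (nonzero≢0′ p (h′ y y<y′))
    ... | tri> _ _ y′<y = ⊥-elim (nonzero≢0 (h y′ y′<y) p′)

-- Programs for arithmetic, connectives and search

constᶜ : ℕ → ℕ
constᶜ y = pair 0 y

idᶜ sucᶜ fstᶜ sndᶜ oracleᶜ : ℕ
idᶜ     = pair 1 0
sucᶜ    = pair 2 0
fstᶜ    = pair 3 0
sndᶜ    = pair 4 0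
oracleᶜ = pair 5 0

pairᶜ compᶜ recᶜ : ℕ → ℕ → ℕ
pairᶜ f g = pair 6 (pair f g)
compᶜ f g = pair 7 (pair f g)
recᶜ  f g = pair 8 (pair f g)

μᶜ : ℕ → ℕ
μᶜ f = pair 9 f

private
  sndsndᶜ : ℕ
  sndsndᶜ = compᶜ sndᶜ sndᶜ

addᶜ mulᶜ predᶜ subᶜ isZeroᶜ eqᶜ ltᶜ : ℕ
addᶜ    = recᶜ idᶜ (compᶜ sucᶜ sndsndᶜ)
mulᶜ    = recᶜ (constᶜ 0) (compᶜ addᶜ (pairᶜ sndsndᶜ fstᶜ))
-- Recursion along the second component of ⟨ x , x ⟩; its step receives ⟨ a , ⟨ c , h ⟩ ⟩ and
-- returns c.
predᶜ   = compᶜ (recᶜ (constᶜ 0) (compᶜ fstᶜ sndᶜ)) (pairᶜ idᶜ idᶜ)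
subᶜ    = recᶜ idᶜ (compᶜ predᶜ sndsndᶜ)
isZeroᶜ = compᶜ (recᶜ (constᶜ 1) (constᶜ 0)) (pairᶜ idᶜ idᶜ)
-- Equality is (a ∸ b) + (b ∸ a) = 0, and a < b is (a + 1) ∸ b = 0.
eqᶜ     = compᶜ isZeroᶜ (compᶜ addᶜ (pairᶜ subᶜ (compᶜ subᶜ (pairᶜ sndᶜ fstᶜ))))
ltᶜ     = compᶜ isZeroᶜ (compᶜ subᶜ (pairᶜ (compᶜ sucᶜ fstᶜ) sndᶜ))

-- Tuples end in 0; hence the recurring `pairᶜ idᶜ (constᶜ 0)`, which turns a number into a tuple of
-- length one.
encode : ∀ {n} → Vec ℕ n → ℕ
encode []       = 0
encode (x ∷ xs) = pair x (encode xs)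

infixl 7 _⊗_
infixl 6 _⊕_

data Tm (n : ℕ) : Set where
  ν       : Fin n → Tm n
  ♯       : ℕ → Tm n
  _⊕_ _⊗_ : Tm n → Tm n → Tm n
  ⟪_,_⟫   : Tm n → Tm n → Tm n

⟦_⟧ᵗ : ∀ {n} → Tm n → Vec ℕ n → ℕ
⟦ ν i ⟧ᵗ       ρ = lookup ρ i
⟦ ♯ k ⟧ᵗ       ρ = k
⟦ t ⊕ u ⟧ᵗ     ρ = ⟦ t ⟧ᵗ ρ + ⟦ u ⟧ᵗ ρ
⟦ t ⊗ u ⟧ᵗ     ρ = ⟦ t ⟧ᵗ ρ * ⟦ u ⟧ᵗ ρ
⟦ ⟪ t , u ⟫ ⟧ᵗ ρ = pair (⟦ t ⟧ᵗ ρ) (⟦ u ⟧ᵗ ρ)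

lookupᶜ : ∀ {n} → Fin n → ℕ
lookupᶜ zero    = fstᶜ
lookupᶜ (suc i) = compᶜ (lookupᶜ i) sndᶜ

termᶜ : ∀ {n} → Tm n → ℕ
termᶜ (ν i)     = lookupᶜ i
termᶜ (♯ k)     = constᶜ k
termᶜ (t ⊕ u)   = compᶜ addᶜ (pairᶜ (termᶜ t) (termᶜ u))
termᶜ (t ⊗ u)   = compᶜ mulᶜ (pairᶜ (termᶜ t) (termᶜ u))
termᶜ ⟪ t , u ⟫ = pairᶜ (termᶜ t) (termᶜ u)

termsᶜ : ∀ {n k} → Vec (Tm n) k → ℕ
termsᶜ []       = constᶜ 0
termsᶜ (t ∷ ts) = pairᶜ (termᶜ t) (termsᶜ ts)

notᶜ : ℕ → ℕ
notᶜ e = compᶜ isZeroᶜ e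

andᶜ : ℕ → ℕ → ℕ
andᶜ e f = compᶜ mulᶜ (pairᶜ e f)

-- On ⟨ a , c ⟩: whether e accepts ⟨ z , a ⟩ for all z < c.
allᶜ : ℕ → ℕ
allᶜ e = recᶜ (constᶜ 1) (andᶜ sndsndᶜ (compᶜ e (pairᶜ (compᶜ fstᶜ sndᶜ) fstᶜ)))

-- On x: the least z such that e accepts ⟨ z , x ⟩.
searchᶜ : ℕ → ℕ
searchᶜ e = μᶜ (compᶜ (notᶜ e) (pairᶜ sndᶜ fstᶜ))

module Computability (P N : ℕ → Set) where

  Ev : ℕ → ℕ → ℕ → Set
  Ev = Eval P N

  ev-const : ∀ {k x} → Ev (constᶜ k) x k
  ev-const = by refl (constˢ refl)

  ev-id : ∀ {x} → Ev idᶜ x x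
  ev-id = by refl (idˢ refl refl)

  ev-suc : ∀ {x} → Ev sucᶜ x (suc x)
  ev-suc = by refl (sucˢ refl refl)

  ev-fst : ∀ {x y} → Ev fstᶜ (pair x y) x
  ev-fst = by refl (fstˢ refl refl)

  ev-snd : ∀ {x y} → Ev sndᶜ (pair x y) y
  ev-snd = by refl (sndˢ refl refl)

  ev-pair : ∀ {f g x a b} → Ev f x a → Ev g x b → Ev (pairᶜ f g) x (pair a b)
  ev-pair p q = by refl (pairˢ refl p q refl)

  ev-comp : ∀ {f g x a b} → Ev g x a → Ev f a b → Ev (compᶜ f g) x b
  ev-comp p q = by refl (compˢ refl p q)

  ev-zero : ∀ {f g a b} → Ev f a b → Ev (recᶜ f g) (pair a 0) b
  ev-zero p = by refl (zeroˢ refl refl p)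

  ev-rec : ∀ {f g a c h b} → Ev (recᶜ f g) (pair a c) h → Ev g (pair a (pair c h)) b →
           Ev (recᶜ f g) (pair a (suc c)) b
  ev-rec p q = by refl (recˢ refl refl p q)

  private
    ev-sndsnd : ∀ {x y z} → Ev sndsndᶜ (pair x (pair y z)) z
    ev-sndsnd = ev-comp ev-snd ev-snd

  ev-add : ∀ a c → Ev addᶜ (pair a c) (c + a)
  ev-add a zero    = ev-zero ev-id
  ev-add a (suc c) = ev-rec (ev-add a c) (ev-comp ev-sndsnd ev-suc)

  ev-mul : ∀ a c → Ev mulᶜ (pair a c) (c * a)
  ev-mul a zero    = ev-zero ev-const
  ev-mul a (suc c) = ev-rec (ev-mul a c) (ev-comp (ev-pair ev-sndsnd ev-fst) (ev-add (c * a) a))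

  ev-pred : ∀ x → Ev predᶜ x (pred x)
  ev-pred x = ev-comp (ev-pair ev-id ev-id) (go x x)
    where
    go : ∀ a c → Ev (recᶜ (constᶜ 0) (compᶜ fstᶜ sndᶜ)) (pair a c) (pred c)
    go a zero    = ev-zero ev-const
    go a (suc c) = ev-rec (go a c) (ev-comp ev-snd ev-fst)

  ev-sub : ∀ a c → Ev subᶜ (pair a c) (a ∸ c)
  ev-sub a zero    = ev-zero ev-id
  ev-sub a (suc c) = subst (Ev subᶜ (pair a (suc c))) (pred[m∸n]≡m∸[1+n] a c)
    (ev-rec (ev-sub a c) (ev-comp ev-sndsnd (ev-pred (a ∸ c))))

  private
    ev-isZero′ : ∀ a → Ev (recᶜ (constᶜ 1) (constᶜ 0)) (pair a 0) 1
    ev-isZero′ a = ev-zero ev-const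
    ev-isSuc′ : ∀ a c → Ev (recᶜ (constᶜ 1) (constᶜ 0)) (pair a (suc c)) 0
    ev-isSuc′ a zero    = ev-rec (ev-isZero′ a) ev-const
    ev-isSuc′ a (suc c) = ev-rec (ev-isSuc′ a c) ev-const

  ev-isZero : Ev isZeroᶜ 0 1
  ev-isZero = ev-comp (ev-pair ev-id ev-id) (ev-isZero′ 0)

  ev-isSuc : ∀ {c} → Ev isZeroᶜ (suc c) 0
  ev-isSuc = ev-comp (ev-pair ev-id ev-id) (ev-isSuc′ _ _)

  -- A halting program with the right answer, asserted up to double negation, so that `A` may be
  -- undecidable in the metatheory.
  Decides : ℕ → ℕ → Set → Set
  Decides e x A = (A → ¬¬ Ev e x 1) × (¬ A → ¬¬ Ev e x 0)

  private
    isZero-decides : ∀ {e x k A} → Ev e x k → (A → k ≡ 0) → (k ≡ 0 → A) →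
                     Decides (compᶜ isZeroᶜ e) x A
    isZero-decides {k = zero}  ev f g =
      (λ _ → return (ev-comp ev ev-isZero)) , λ ¬a → ⊥-elim (¬a (g refl))
    isZero-decides {k = suc k} ev f g =
      (λ a → case f a of λ ()) , λ _ → return (ev-comp ev ev-isSuc)

  decides-eq : ∀ a b → Decides eqᶜ (pair a b) (a ≡ b)
  decides-eq a b = isZero-decides
    (ev-comp (ev-pair (ev-sub a b) (ev-comp (ev-pair ev-snd ev-fst) (ev-sub b a)))
             (ev-add (a ∸ b) (b ∸ a)))
    (λ { refl → cong₂ _+_ (n∸n≡0 a) (n∸n≡0 a) })
    (λ eq → ≤-antisym (m∸n≡0⇒m≤n (m+n≡0⇒n≡0 (b ∸ a) eq)) (m∸n≡0⇒m≤n (m+n≡0⇒m≡0 (b ∸ a) eq)))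

  decides-lt : ∀ a b → Decides ltᶜ (pair a b) (a < b)
  decides-lt a b = isZero-decides
    (ev-comp (ev-pair (ev-comp ev-fst ev-suc) ev-snd) (ev-sub (suc a) b))
    m≤n⇒m∸n≡0 (m∸n≡0⇒m≤n {suc a})

  decides-resp : ∀ {e x A B} → (A → ¬¬ B) → (B → ¬¬ A) → Decides e x A → Decides e x B
  decides-resp f g (p , q) = (λ b → g b >>= p) , λ ¬b → q λ a → f a ¬b

  decides-comp : ∀ {e f x a A} → Ev f x a → Decides e a A → Decides (compᶜ e f) x A
  decides-comp ev (p , q) =
    (λ a → p a >>= λ ev′ → return (ev-comp ev ev′)) ,
    (λ ¬a → q ¬a >>= λ ev′ → return (ev-comp ev ev′))

  decides-not : ∀ {e x A} → Decides e x A → Decides (notᶜ e) x (¬ A)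
  decides-not {e} {x} {A} (p , q) =
    (λ ¬a → q ¬a >>= λ ev → return (ev-comp ev ev-isZero)) ,
    (λ ¬¬a → ¬¬a >>= p >>= λ ev → return (ev-comp ev ev-isSuc))

  decides-and : ∀ {e f x A B} → Decides e x A → Decides f x B → Decides (andᶜ e f) x (A × B)
  decides-and {e} {f} {x} {A} {B} (p , q) (p′ , q′) =
    (λ (a , b) → p a >>= λ ev → p′ b >>= λ ev′ → return (ev-comp (ev-pair ev ev′) (ev-mul 1 1))) ,
    λ ¬ab → em A >>= λ where
      (no ¬a) → em B >>= λ where
        (no ¬b) → q ¬a >>= λ ev → q′ ¬b >>= λ ev′ →
                  return (ev-comp (ev-pair ev ev′) (ev-mul 0 0))
        (yes b) → q ¬a >>= λ ev → p′ b >>= λ ev′ →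
                  return (ev-comp (ev-pair ev ev′) (ev-mul 0 1))
      (yes a) → em B >>= λ where
        (no ¬b) → p a >>= λ ev → q′ ¬b >>= λ ev′ →
                  return (ev-comp (ev-pair ev ev′) (ev-mul 1 0))
        (yes b) → ⊥-elim (¬ab (a , b))

  decides-all : ∀ {e a} {A : ℕ → Set} → (∀ z → Decides e (pair z a) (A z)) →
                ∀ c → Decides (allᶜ e) (pair a c) (∀ z → z < c → A z)
  decides-all d zero = (λ _ → return (ev-zero ev-const)) , λ ¬h → ⊥-elim (¬h λ _ ())
  decides-all {e} {a} {A} d (suc c) = decides-resp {A = (∀ z → z < c → A z) × A c}
    (λ (h , p) → return λ z z<1+c → case m<1+n⇒m<n∨m≡n z<1+c of λ where
      (inj₁ z<c)  → h z z<c
      (inj₂ refl) → p)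
    (λ h → return ((λ z z<c → h z (m<n⇒m<1+n z<c)) , h c ≤-refl))
    both
    where
    G = andᶜ sndsndᶜ (compᶜ e (pairᶜ (compᶜ fstᶜ sndᶜ) fstᶜ))
    IH = decides-all d c
    both : Decides (allᶜ e) (pair a (suc c)) ((∀ z → z < c → A z) × A c)
    step : ∀ {h y} → Ev (allᶜ e) (pair a c) h → (Ev sndsndᶜ (pair a (pair c h)) h → ¬¬ Ev G (pair a (pair c h)) y) →
           ¬¬ Ev (allᶜ e) (pair a (suc c)) y
    step ev k = k ev-sndsnd >>= λ ev′ → return (ev-rec ev ev′)
    at : ∀ h → Decides (compᶜ e (pairᶜ (compᶜ fstᶜ sndᶜ) fstᶜ)) (pair a (pair c h)) (A c)
    at h = decides-comp (ev-pair (ev-comp ev-snd ev-fst) ev-fst) (d c)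
    both = (λ (h , p) → proj₁ IH h >>= λ ev → step ev λ ev′ →
             proj₁ (decides-and {B = A c} ((λ _ → return ev′) , λ ¬t → ⊥-elim (¬t h)) (at 1)) (h , p)) ,
           λ ¬hp → em (∀ z → z < c → A z) >>= λ where
             (yes h) → proj₁ IH h >>= λ ev → step ev λ ev′ →
               proj₂ (decides-and {B = A c} ((λ _ → return ev′) , λ ¬t → ⊥-elim (¬t h)) (at 1)) ¬hp
             -- The accumulated answer is 0, so it is presented as a decision of `⊥`; the
             -- conjunction then fails by its first component.
             (no ¬h) → proj₂ IH ¬h >>= λ ev → step ev λ ev′ →
               proj₂ (decides-and {A = ⊥} {B = A c} ((λ ()) , λ _ → return ev′) (at 0)) proj₁

  -- `μᶜ` stops at the first value 0, hence the negated program; minimality of z makes the earlier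
  -- values nonzero.
  decides-search : ∀ {e x} {A : ℕ → Set} → (∀ z → Decides e (pair z x) (A z)) →
                   ∀ {z} → A z → (∀ k → k < z → ¬ A k) → ¬¬ Ev (searchᶜ e) x z
  decides-search {e} {x} {A} d {z} a least = do
    ev  ← proj₂ (at z) (λ ¬a → ¬a a)
    evs ← ¬¬-∀< z λ k k<z → proj₁ (at k) (least k k<z) >>= λ ev → return (nonzero ev)
    return (by refl (μˢ ev evs))
    where
    at : ∀ z → Decides (compᶜ (notᶜ e) (pairᶜ sndᶜ fstᶜ)) (pair x z) (¬ A z)
    at z = decides-comp (ev-pair ev-snd ev-fst) (decides-not (d z))

  ev-lookup : ∀ {n} (i : Fin n) ρ → Ev (lookupᶜ i) (encode ρ) (lookup ρ i)
  ev-lookup zero    (x ∷ ρ) = ev-fst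
  ev-lookup (suc i) (x ∷ ρ) = ev-comp ev-snd (ev-lookup i ρ)

  ev-term : ∀ {n} (t : Tm n) ρ → Ev (termᶜ t) (encode ρ) (⟦ t ⟧ᵗ ρ)
  ev-term (ν i)     ρ = ev-lookup i ρ
  ev-term (♯ k)     ρ = ev-const
  ev-term (t ⊕ u)   ρ = subst (Ev _ _) (+-comm (⟦ u ⟧ᵗ ρ) _)
    (ev-comp (ev-pair (ev-term t ρ) (ev-term u ρ)) (ev-add _ _))
  ev-term (t ⊗ u)   ρ = subst (Ev _ _) (*-comm (⟦ u ⟧ᵗ ρ) _)
    (ev-comp (ev-pair (ev-term t ρ) (ev-term u ρ)) (ev-mul _ _))
  ev-term ⟪ t , u ⟫ ρ = ev-pair (ev-term t ρ) (ev-term u ρ)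

  values : ∀ {n k} → Vec (Tm n) k → Vec ℕ n → Vec ℕ k
  values ts ρ = map (λ t → ⟦ t ⟧ᵗ ρ) ts

  ev-terms : ∀ {n k} (ts : Vec (Tm n) k) ρ → Ev (termsᶜ ts) (encode ρ) (encode (values ts ρ))
  ev-terms []       ρ = ev-const
  ev-terms (t ∷ ts) ρ = ev-pair (ev-term t ρ) (ev-terms ts ρ)

  -- Bounded formulas compiled into decision programs

  record Rel (k : ℕ) : Set₁ where
    field
      holds   : Vec ℕ k → Set
      code    : ℕ
      decides : ∀ xs → Decides code (encode xs) (holds xs)
  open Rel public

  infix  5 _≣_ _⋖_
  infix  5 _∙_
  infixr 4 _⩓_
  infixr 3 _⩔_
  infixr 2 _⇛_

  data BF (n : ℕ) : Set₁ where
    _∙_         : ∀ {k} → Rel k → Vec (Tm n) k → BF n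
    _≣_ _⋖_     : Tm n → Tm n → BF n
    𝕗           : BF n
    _⩓_ _⩔_ _⇛_ : BF n → BF n → BF n
    ∀< ∃<       : Tm n → BF (suc n) → BF n

  ⟦_⟧ᵇ : ∀ {n} → BF n → Vec ℕ n → Set
  ⟦ R ∙ ts ⟧ᵇ ρ = holds R (values ts ρ)
  ⟦ t ≣ u ⟧ᵇ  ρ = ⟦ t ⟧ᵗ ρ ≡ ⟦ u ⟧ᵗ ρ
  ⟦ t ⋖ u ⟧ᵇ  ρ = ⟦ t ⟧ᵗ ρ < ⟦ u ⟧ᵗ ρ
  ⟦ 𝕗 ⟧ᵇ      ρ = ⊥
  ⟦ φ ⩓ ψ ⟧ᵇ  ρ = ⟦ φ ⟧ᵇ ρ × ⟦ ψ ⟧ᵇ ρ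
  ⟦ φ ⩔ ψ ⟧ᵇ  ρ = ⟦ φ ⟧ᵇ ρ ⊎ ⟦ ψ ⟧ᵇ ρ
  ⟦ φ ⇛ ψ ⟧ᵇ  ρ = ⟦ φ ⟧ᵇ ρ → ⟦ ψ ⟧ᵇ ρ
  ⟦ ∀< t φ ⟧ᵇ ρ = ∀ z → z < ⟦ t ⟧ᵗ ρ → ⟦ φ ⟧ᵇ (z ∷ ρ)
  ⟦ ∃< t φ ⟧ᵇ ρ = ∃ λ z → z < ⟦ t ⟧ᵗ ρ × ⟦ φ ⟧ᵇ (z ∷ ρ)

  formulaᶜ : ∀ {n} → BF n → ℕ
  formulaᶜ (R ∙ ts)  = compᶜ (code R) (termsᶜ ts)
  formulaᶜ (t ≣ u)   = compᶜ eqᶜ (pairᶜ (termᶜ t) (termᶜ u))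
  formulaᶜ (t ⋖ u)   = compᶜ ltᶜ (pairᶜ (termᶜ t) (termᶜ u))
  formulaᶜ 𝕗         = constᶜ 0
  formulaᶜ (φ ⩓ ψ)   = andᶜ (formulaᶜ φ) (formulaᶜ ψ)
  formulaᶜ (φ ⩔ ψ)   = notᶜ (andᶜ (notᶜ (formulaᶜ φ)) (notᶜ (formulaᶜ ψ)))
  formulaᶜ (φ ⇛ ψ)   = notᶜ (andᶜ (formulaᶜ φ) (notᶜ (formulaᶜ ψ)))
  formulaᶜ (∀< t φ)  = compᶜ (allᶜ (formulaᶜ φ)) (pairᶜ idᶜ (termᶜ t))
  formulaᶜ (∃< t φ)  = notᶜ (compᶜ (allᶜ (notᶜ (formulaᶜ φ))) (pairᶜ idᶜ (termᶜ t)))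

  decides-formula : ∀ {n} (φ : BF n) ρ → Decides (formulaᶜ φ) (encode ρ) (⟦ φ ⟧ᵇ ρ)
  decides-formula (R ∙ ts)  ρ = decides-comp (ev-terms ts ρ) (decides R _)
  decides-formula (t ≣ u)   ρ = decides-comp (ev-pair (ev-term t ρ) (ev-term u ρ)) (decides-eq _ _)
  decides-formula (t ⋖ u)   ρ = decides-comp (ev-pair (ev-term t ρ) (ev-term u ρ)) (decides-lt _ _)
  decides-formula 𝕗         ρ = (λ ()) , λ _ → return ev-const
  decides-formula (φ ⩓ ψ)   ρ = decides-and (decides-formula φ ρ) (decides-formula ψ ρ)
  decides-formula (φ ⩔ ψ)   ρ = decides-resp
    (λ h ¬s → h ((λ a → ¬s (inj₁ a)) , λ b → ¬s (inj₂ b)))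
    (λ { (inj₁ a) → return λ h → proj₁ h a ; (inj₂ b) → return λ h → proj₂ h b })
    (decides-not (decides-and (decides-not (decides-formula φ ρ)) (decides-not (decides-formula ψ ρ))))
  decides-formula (φ ⇛ ψ)   ρ = decides-resp
    (λ h ¬i → ¬i λ a → ⊥-elim (h (a , λ b → ¬i λ _ → b)))
    (λ i → return λ (a , ¬b) → ¬b (i a))
    (decides-not (decides-and (decides-formula φ ρ) (decides-not (decides-formula ψ ρ))))
  decides-formula (∀< t φ)  ρ = decides-comp (ev-pair ev-id (ev-term t ρ))
    (decides-all (λ z → decides-formula φ (z ∷ ρ)) (⟦ t ⟧ᵗ ρ))
  decides-formula (∃< t φ)  ρ = decides-resp
    (λ h ¬∃ → h λ z z<t p → ¬∃ (z , z<t , p))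
    (λ (z , z<t , p) → return λ h → h z z<t p)
    (decides-not (decides-comp (ev-pair ev-id (ev-term t ρ))
      (decides-all (λ z → decides-not (decides-formula φ (z ∷ ρ))) (⟦ t ⟧ᵗ ρ))))

  -- The equivalence of `φ` with the intended meaning `Q` is where the bounds on the quantifiers are
  -- justified.
  define : ∀ {k} (φ : BF k) (Q : Vec ℕ k → Set) →
           (∀ xs → ⟦ φ ⟧ᵇ xs → ¬¬ Q xs) → (∀ xs → Q xs → ¬¬ ⟦ φ ⟧ᵇ xs) → Rel k
  define φ Q f g = record
    { holds = Q ; code = formulaᶜ φ
    ; decides = λ xs → decides-resp (f xs) (g xs) (decides-formula φ xs) }

-- Computations as finite objects

triple : ℕ → ℕ → ℕ → ℕ
triple e x y = pair e (pair x y)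

triple-inj : ∀ {e x y e′ x′ y′} → triple e x y ≡ triple e′ x′ y′ → e ≡ e′ × x ≡ x′ × y ≡ y′
triple-inj eq with pair-inj eq
... | p , q with pair-inj q
... | q′ , r = p , q′ , r

Step : (P N : ℕ → Set) (E : ℕ → ℕ → ℕ → Set) → ℕ → ℕ → ℕ → Set
Step P N E e x y = Σ ℕ λ t → Σ ℕ λ a → e ≡ pair t a × Scheme P N E t a x y

module _ {P N : ℕ → Set} where

  private
    mapⁿ : ∀ {E E′ : ℕ → ℕ → ℕ → Set} → (∀ {e x y} → E e x y → E′ e x y) →
           ∀ {f x z} → Nonzero E f x z → Nonzero E′ f x z
    mapⁿ h (nonzero ev) = nonzero (h ev)

  mapˢ : ∀ {E E′ : ℕ → ℕ → ℕ → Set} → (∀ {e x y} → E e x y → E′ e x y) →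
         ∀ {t a x y} → Scheme P N E t a x y → Scheme P N E′ t a x y
  mapˢ h (constˢ p) = constˢ p
  mapˢ h (idˢ p q) = idˢ p q
  mapˢ h (sucˢ p q) = sucˢ p q
  mapˢ h (fstˢ p q) = fstˢ p q
  mapˢ h (sndˢ p q) = sndˢ p q
  mapˢ h (inˢ p q r) = inˢ p q r
  mapˢ h (outˢ p q r) = outˢ p q r
  mapˢ h (pairˢ eq p q r) = pairˢ eq (h p) (h q) r
  mapˢ h (compˢ eq p q) = compˢ eq (h p) (h q)
  mapˢ h (zeroˢ eq x p) = zeroˢ eq x (h p)
  mapˢ h (recˢ eq x p q) = recˢ eq x (h p) (h q)
  mapˢ h (μˢ p k) = μˢ (h p) (λ z z<y → mapⁿ h (k z z<y))

  mapᵗ : ∀ {E E′ : ℕ → ℕ → ℕ → Set} → (∀ {e x y} → E e x y → E′ e x y) →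
         ∀ {e x y} → Step P N E e x y → Step P N E′ e x y
  mapᵗ h (t , a , eq , s) = t , a , eq , mapˢ h s

  ¬¬-pullˢ : ∀ {E : ℕ → ℕ → ℕ → Set} {t a x y} →
             Scheme P N (λ e x y → ¬¬ E e x y) t a x y → ¬¬ Scheme P N E t a x y
  ¬¬-pullˢ (constˢ p) = return (constˢ p)
  ¬¬-pullˢ (idˢ p q) = return (idˢ p q)
  ¬¬-pullˢ (sucˢ p q) = return (sucˢ p q)
  ¬¬-pullˢ (fstˢ p q) = return (fstˢ p q)
  ¬¬-pullˢ (sndˢ p q) = return (sndˢ p q)
  ¬¬-pullˢ (inˢ p q r) = return (inˢ p q r)
  ¬¬-pullˢ (outˢ p q r) = return (outˢ p q r)
  ¬¬-pullˢ (pairˢ eq p q r) = p >>= λ p → q >>= λ q → return (pairˢ eq p q r)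
  ¬¬-pullˢ (compˢ eq p q) = p >>= λ p → q >>= λ q → return (compˢ eq p q)
  ¬¬-pullˢ (zeroˢ eq x p) = p >>= λ p → return (zeroˢ eq x p)
  ¬¬-pullˢ (recˢ eq x p q) = p >>= λ p → q >>= λ q → return (recˢ eq x p q)
  ¬¬-pullˢ {E = E} {a = a} {x} {y} (μˢ p k) =
    p >>= λ p → ¬¬-∀< y {Nonzero E a x} (λ z z<y → pull (k z z<y)) >>= λ k → return (μˢ p k)
    where
    pull : ∀ {z} → Nonzero (λ e x y → ¬¬ E e x y) a x z → ¬¬ Nonzero E a x z
    pull (nonzero ev) = ev >>= λ ev → return (nonzero ev)

  -- Induction on the step number, since a step appeals only to steps with smaller numbers.
  steps-sound : (Ent : ℕ → ℕ → Set) →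
    (∀ {i d} → Ent i d → ¬¬ ∃ λ e → ∃ λ x → ∃ λ y → d ≡ triple e x y ×
      Step P N (λ e x y → ∃ λ j → j < i × Ent j (triple e x y)) e x y) →
    ∀ i {e x y} → Ent i (triple e x y) → ¬¬ Eval P N e x y
  steps-sound Ent just = <-rec _ λ i rec {e} {x} {y} ent → do
    e′ , x′ , y′ , eq , t , a , eq′ , s ← just ent
    s ← ¬¬-pullˢ (mapˢ (λ (j , j<i , ent) → rec j<i ent) s)
    case triple-inj eq of λ where (refl , refl , refl) → return (by eq′ s)

  -- The last step comes first.
  data Steps : List ℕ → Set where
    []  : Steps []ᴸ
    _∷_ : ∀ {L e x y} → Step P N (λ e x y → triple e x y ∈ L) e x y → Steps L →
          Steps (triple e x y ∷ᴸ L)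

  Steps-++ : ∀ {L M} → Steps L → Steps M → Steps (L ++ᴸ M)
  Steps-++ []       t = t
  Steps-++ (x ∷ s) t = mapᵗ ∈-++⁺ˡ x ∷ Steps-++ s t

  private
    Computation : (List ℕ → Set) → Set
    Computation A = Σ (List ℕ) λ L → Steps L × A L

    both : ∀ {d d′} → Computation (d ∈_) → Computation (d′ ∈_) →
           Computation λ L → d ∈ L × d′ ∈ L
    both (L , s , p) (M , t , q) = L ++ᴸ M , Steps-++ s t , ∈-++⁺ˡ p , ∈-++⁺ʳ L q

    infer : ∀ {L t a x y} → Steps L → Scheme P N (λ e x y → triple e x y ∈ L) t a x y →
            Computation (triple (pair t a) x y ∈_)
    infer s sch = _ , (_ , _ , refl , sch) ∷ s , here refl

    collect : ∀ {f x} k → (∀ z → z < k → Computation λ L → Nonzero (λ e x y → triple e x y ∈ L) f x z) →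
              Computation λ L → ∀ z → z < k → Nonzero (λ e x y → triple e x y ∈ L) f x z
    collect zero    h = []ᴸ , [] , λ _ ()
    collect (suc k) h with h k ≤-refl | collect k (λ z z<k → h z (m<n⇒m<1+n z<k))
    ... | L , s , n | M , t , ns = L ++ᴸ M , Steps-++ s t , λ z z<1+k → case m<1+n⇒m<n∨m≡n z<1+k of λ where
      (inj₁ z<k)  → mapⁿ (∈-++⁺ʳ L) (ns z z<k)
      (inj₂ refl) → mapⁿ ∈-++⁺ˡ n

  steps-complete : ∀ {e x y} → Eval P N e x y → Σ (List ℕ) λ L → Steps L × triple e x y ∈ L
  completeˢ : ∀ {t a x y} → Scheme P N (Eval P N) t a x y → Σ (List ℕ) λ L → Steps L × triple (pair t a) x y ∈ L
  completeⁿ : ∀ {f x z} → Nonzero (Eval P N) f x z →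
              Σ (List ℕ) λ L → Steps L × Nonzero (λ e x y → triple e x y ∈ L) f x z
  steps-complete (by refl s) = completeˢ s
  completeⁿ (nonzero ev) with steps-complete ev
  ... | L , s , p = L , s , nonzero p
  completeˢ (constˢ p) = infer [] (constˢ p)
  completeˢ (idˢ p q) = infer [] (idˢ p q)
  completeˢ (sucˢ p q) = infer [] (sucˢ p q)
  completeˢ (fstˢ p q) = infer [] (fstˢ p q)
  completeˢ (sndˢ p q) = infer [] (sndˢ p q)
  completeˢ (inˢ p q r) = infer [] (inˢ p q r)
  completeˢ (outˢ p q r) = infer [] (outˢ p q r)
  completeˢ (pairˢ eq p q r) with both (steps-complete p) (steps-complete q)
  ... | L , s , p′ , q′ = infer s (pairˢ eq p′ q′ r)
  completeˢ (compˢ eq p q) with both (steps-complete p) (steps-complete q)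
  ... | L , s , p′ , q′ = infer s (compˢ eq p′ q′)
  completeˢ (zeroˢ eq x p) with steps-complete p
  ... | L , s , p′ = infer s (zeroˢ eq x p′)
  completeˢ (recˢ eq x p q) with both (steps-complete p) (steps-complete q)
  ... | L , s , p′ , q′ = infer s (recˢ eq x p′ q′)
  completeˢ {y = y} (μˢ p k) with steps-complete p | collect y (λ z z<y → completeⁿ (k z z<y))
  ... | L , s , p′ | M , t , ns = infer (Steps-++ s t)
    (μˢ (∈-++⁺ˡ p′) λ z z<y → mapⁿ (∈-++⁺ʳ L) (ns z z<y))

-- An entry is numbered by the length of the list after it, that is, by the number of steps that
-- precede it in the computation.
graph : List ℕ → List ℕ
graph []ᴸ      = []ᴸ
graph (d ∷ᴸ L) = pair (length L) d ∷ᴸ graph L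

graph-pair : ∀ {u} L → u ∈ graph L → ∃ λ i → ∃ λ d → u ≡ pair i d × i < length L
graph-pair (d ∷ᴸ L) (here refl) = length L , d , refl , ≤-refl
graph-pair (d ∷ᴸ L) (there p) with graph-pair L p
... | i , d′ , eq , i<l = i , d′ , eq , m<n⇒m<1+n i<l

graph-index : ∀ {i d} L → pair i d ∈ graph L → i < length L
graph-index L p with graph-pair L p
... | _ , _ , eq , i<l with pair-inj eq
... | refl , _ = i<l

graph-single : ∀ {i d d′} L → pair i d ∈ graph L → pair i d′ ∈ graph L → d ≡ d′
graph-single (x ∷ᴸ L) (here p) (here q) = proj₂ (pair-inj (trans p (sym q)))
graph-single (x ∷ᴸ L) (here p) (there q) with pair-inj p
... | refl , _ = ⊥-elim (<-irrefl refl (graph-index L q))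
graph-single (x ∷ᴸ L) (there p) (here q) with pair-inj q
... | refl , _ = ⊥-elim (<-irrefl refl (graph-index L p))
graph-single (x ∷ᴸ L) (there p) (there q) = graph-single L p q

graph-total : ∀ {i} L → i < length L → ∃ λ d → pair i d ∈ graph L
graph-total (d ∷ᴸ L) i<1+l with m<1+n⇒m<n∨m≡n i<1+l
... | inj₂ refl = d , here refl
... | inj₁ i<l with graph-total L i<l
... | d′ , p = d′ , there p

graph-∈ : ∀ {d L} → d ∈ L → ∃ λ i → i < length L × pair i d ∈ graph L
graph-∈ {L = _ ∷ᴸ L} (here refl) = length L , ≤-refl , here refl
graph-∈ {L = _ ∷ᴸ L} (there p) with graph-∈ p
... | i , i<l , q = i , m<n⇒m<1+n i<l , there q

module _ {P N : ℕ → Set} where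
  steps-graph : ∀ {L i d} → Steps {P} {N} L → pair i d ∈ graph L →
    ∃ λ e → ∃ λ x → ∃ λ y → d ≡ triple e x y ×
      Step P N (λ e x y → ∃ λ j → j < i × pair j (triple e x y) ∈ graph L) e x y
  steps-graph {_ ∷ᴸ L} (s ∷ _) (here eq) with pair-inj eq
  ... | refl , refl = _ , _ , _ , refl ,
    mapᵗ (λ p → let (j , j<l , q) = graph-∈ p in j , j<l , there q) s
  steps-graph (_ ∷ ss) (there p) with steps-graph ss p
  ... | e , x , y , eq , s = e , x , y , eq , mapᵗ (λ (j , j<i , q) → j , j<i , there q) s

-- c codes a finite set of pairs ⟨ i , ⟨ e , ⟨ x , y ⟩ ⟩ ⟩ (step number i).
record Trace (P N : ℕ → Set) (c e x y : ℕ) : Set where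
  constructor trace
  field
    justified : ∀ u → InF u c → ∃ λ i → ∃ λ e → ∃ λ x → ∃ λ y → u ≡ pair i (triple e x y) ×
                Step P N (λ e x y → ∃ λ j → j < i × InF (pair j (triple e x y)) c) e x y
    result    : ∃ λ i → InF (pair i (triple e x y)) c

trace-sound : ∀ {P N c e x y} → Trace P N c e x y → ¬¬ Eval P N e x y
trace-sound {P} {N} {c} (trace just (i , inc)) = steps-sound (λ i d → InF (pair i d) c) just′ i inc
  where
  just′ : ∀ {i d} → InF (pair i d) c → ¬¬ ∃ λ e → ∃ λ x → ∃ λ y → d ≡ triple e x y ×
          Step P N (λ e x y → ∃ λ j → j < i × InF (pair j (triple e x y)) c) e x y
  just′ inc with just _ inc
  ... | i′ , e , x , y , eq , s with pair-inj eq
  ... | refl , eq′ = return (e , x , y , eq′ , s)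

trace-complete : ∀ {P N e x y} → Eval P N e x y → ∃ λ c → Trace P N c e x y
trace-complete {P} {N} ev with steps-complete ev
... | L , ss , d∈L = str code , trace just (_ , ⇒in code (∈⇒<listBound d∈g) d∈g)
  where
  code = listCode (graph L)
  d∈g = proj₂ (proj₂ (graph-∈ d∈L))
  just : ∀ u → InF u (str code) → ∃ λ i → ∃ λ e → ∃ λ x → ∃ λ y → u ≡ pair i (triple e x y) ×
         Step P N (λ e x y → ∃ λ j → j < i × InF (pair j (triple e x y)) (str code)) e x y
  just u u∈c with graph-pair L (proj₂ (in⇒ code u∈c))
  ... | i , d , refl , _ with steps-graph ss (proj₂ (in⇒ code u∈c))
  ... | e , x , y , refl , s = i , e , x , y , refl ,
    mapᵗ (λ (j , j<i , q) → j , j<i , ⇒in code (∈⇒<listBound q) q) s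

-- Sequences

record IsSeq (s : ℕ) : Set where
  field
    least   : ∀ d → d < s → ¬ (∀ i → (InF i d → InF i s) × (InF i s → InF i d))
    pairs   : ∀ u → InF u s → ∃ λ i → ∃ λ a → u ≡ pair i a
    single  : ∀ i a b → InF (pair i a) s → InF (pair i b) s → a ≡ b
    initial : ∃ λ l → ∀ i → (i < l → ∃ λ a → InF (pair i a) s) ×
                            ((∃ λ a → InF (pair i a) s) → i < l)
open IsSeq public

fromList : (L : List ℕ) → ¬¬ ∃ λ s → IsSeq s × ∀ u → (InF u s → u ∈ graph L) × (u ∈ graph L → InF u s)
fromList L = do
  -- The formula `FiniteSet` admits only least representatives, so the code of the graph is
  -- minimised.
  s , same , min ← ¬¬-least {λ s → ∀ u → (InF u s → u ∈ graph L) × (u ∈ graph L → InF u s)}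
    (str code) λ u → (λ p → proj₂ (in⇒ code p)) , λ p → ⇒in code (∈⇒<listBound p) p
  let to = λ {u} → proj₁ (same u)
      from = λ {u} → proj₂ (same u)
  return (s , record
    { least   = λ d d<s h → min d d<s λ u → (λ p → to (proj₁ (h u) p)) , λ p → proj₂ (h u) (from p)
    ; pairs   = λ u p → let (i , a , eq , _) = graph-pair L (to p) in i , a , eq
    ; single  = λ i a b p q → graph-single L (to p) (to q)
    ; initial = length L , λ i →
        (λ i<l → let (a , p) = graph-total L i<l in a , from p) ,
        λ (a , p) → graph-index L (to p)
    } , same)
  where code = listCode (graph L)

buildSeq : ∀ l {R : ℕ → ℕ → Set} → (∀ i → i < l → ¬¬ ∃ (R i)) →
           ¬¬ ∃ λ s → IsSeq s × (∀ u → InF u s → ∃ λ i → ∃ λ a → u ≡ pair i a × i < l × R i a) ×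
                      (∀ i → i < l → ∃ λ a → InF (pair i a) s)
buildSeq l {R} h = do
  L , refl , vals ← values l h
  s , seq , same ← fromList L
  return (s , seq ,
    (λ u p → let (i , a , eq , i<l) = graph-pair L (proj₁ (same u) p) in
       i , a , eq , i<l , vals (subst (_∈ graph L) eq (proj₁ (same u) p))) ,
    λ i i<l → let (a , p) = graph-total L i<l in a , proj₂ (same _) p)
  where
  values : ∀ l → (∀ i → i < l → ¬¬ ∃ (R i)) →
           ¬¬ Σ (List ℕ) λ L → length L ≡ l × ∀ {i a} → pair i a ∈ graph L → R i a
  values zero    h = return ([]ᴸ , refl , λ ())
  values (suc l) h = do
    a , r ← h l ≤-refl
    L , refl , rs ← values l (λ i i<l → h i (m<n⇒m<1+n i<l))
    return (a ∷ᴸ L , refl , λ where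
      (here eq) → case pair-inj eq of λ where (refl , refl) → r
      (there p) → rs p)

-- Relations given by bounded formulas

Col : ℕ → ℕ → Set
Col n v = ∃ λ i → ∃ λ j → v ≡ pair i j × i < n

col? : ∀ n v → Dec (Col n v)
col? n v = map′
  (λ (i , i<n , j , _ , eq) → i , j , eq , i<n)
  (λ { (i , j , refl , i<n) → i , i<n , j , s≤s (≤pairʳ i j) , refl })
  (anyUpTo? (λ i → anyUpTo? (λ j → v ≟ pair i j) (suc v)) n)

x₀ : ∀ {n} → Tm (1 + n)
x₀ = ν zero
x₁ : ∀ {n} → Tm (2 + n)
x₁ = ν (suc zero)
x₂ : ∀ {n} → Tm (3 + n)
x₂ = ν (suc (suc zero))
x₃ : ∀ {n} → Tm (4 + n)
x₃ = ν (suc (suc (suc zero)))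
x₄ : ∀ {n} → Tm (5 + n)
x₄ = ν (suc (suc (suc (suc zero))))
x₅ : ∀ {n} → Tm (6 + n)
x₅ = ν (suc (suc (suc (suc (suc zero)))))
x₆ : ∀ {n} → Tm (7 + n)
x₆ = ν (suc (suc (suc (suc (suc (suc zero))))))
x₇ : ∀ {n} → Tm (8 + n)
x₇ = ν (suc (suc (suc (suc (suc (suc (suc zero)))))))
x₈ : ∀ {n} → Tm (9 + n)
x₈ = ν (suc (suc (suc (suc (suc (suc (suc (suc zero))))))))
x₉ : ∀ {n} → Tm (10 + n)
x₉ = ν (suc (suc (suc (suc (suc (suc (suc (suc (suc zero)))))))))
x₁₀ : ∀ {n} → Tm (11 + n)
x₁₀ = ν (suc (suc (suc (suc (suc (suc (suc (suc (suc (suc zero))))))))))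
x₁₁ : ∀ {n} → Tm (12 + n)
x₁₁ = ν (suc (suc (suc (suc (suc (suc (suc (suc (suc (suc (suc zero)))))))))))

+1 : ∀ {n} → Tm n → Tm n
+1 t = t ⊕ ♯ 1

≤⇒<+1 : ∀ {m n} → m ≤ n → m < n + 1
≤⇒<+1 {m} {n} m≤n = subst (m <_) (+-comm 1 n) (s≤s m≤n)

fst<+1 : ∀ {c} a b → c ≡ pair a b → a < c + 1
fst<+1 a b refl = ≤⇒<+1 (≤pairˡ a b)

snd<+1 : ∀ {c} a b → c ≡ pair a b → b < c + 1
snd<+1 a b refl = ≤⇒<+1 (≤pairʳ a b)

module Relations (P N : ℕ → Set) where
  open Computability P N public

  bitRel : Rel 3
  bitRel = define (∃< (+1 x₁) ((x₁ ⊗ (x₃ ⊕ ♯ 1) ⊕ ♯ 1) ⊗ x₀ ≣ x₂))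
    (λ { (a ∷ b ∷ v ∷ []) → Bit a b v })
    (λ { (a ∷ b ∷ v ∷ []) (c , _ , eq) → return (c , eq) })
    (λ { (a ∷ b ∷ v ∷ []) (c , eq) → return (c , ≤⇒<+1 (bound a v c eq) , eq) })
    where
    bound : ∀ a v c {b} → (a * (v + 1) + 1) * c ≡ b → c ≤ b
    bound a v c refl = m≤n*m c (a * (v + 1) + 1) {{>-nonZero (m≤n+m 1 (a * (v + 1)))}}

  inRel : Rel 2
  inRel = define
    (∃< (+1 x₁) (∃< (+1 x₂) (∃< (+1 x₃)
      (x₄ ≣ ⟪ x₂ , ⟪ x₁ , x₀ ⟫ ⟫ ⩓ x₃ ⋖ x₂ ⩓ bitRel ∙ (x₁ ∷ x₀ ∷ x₃ ∷ [])))))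
    (λ { (v ∷ c ∷ []) → InF v c })
    (λ { (v ∷ c ∷ []) (k , _ , a , _ , b , _ , h) → return (k , a , b , h) })
    (λ { (v ∷ c ∷ []) (k , a , b , refl , h) → return
      (k , ≤⇒<+1 (≤pairˡ k _) , a , ≤⇒<+1 (≤-trans (≤pairˡ a b) (≤pairʳ k _)) ,
       b , ≤⇒<+1 (≤-trans (≤pairʳ a b) (≤pairʳ k _)) , refl , h) })

  outRel : Rel 2
  outRel = define
    (∃< (+1 x₁) (∃< (+1 x₂) (∃< (+1 x₃)
      (x₄ ≣ ⟪ x₂ , ⟪ x₁ , x₀ ⟫ ⟫ ⩓ x₃ ⋖ x₂ ⩓ (bitRel ∙ (x₁ ∷ x₀ ∷ x₃ ∷ []) ⇛ 𝕗)))))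
    (λ { (v ∷ c ∷ []) → OutF v c })
    (λ { (v ∷ c ∷ []) (k , _ , a , _ , b , _ , h) → return (k , a , b , h) })
    (λ { (v ∷ c ∷ []) (k , a , b , refl , h) → return
      (k , ≤⇒<+1 (≤pairˡ k _) , a , ≤⇒<+1 (≤-trans (≤pairˡ a b) (≤pairʳ k _)) ,
       b , ≤⇒<+1 (≤-trans (≤pairʳ a b) (≤pairʳ k _)) , refl , h) })

  colRel : Rel 2
  colRel = define (∃< x₀ (∃< (+1 x₂) (x₃ ≣ ⟪ x₁ , x₀ ⟫)))
    (λ { (n ∷ v ∷ []) → Col n v })
    (λ { (n ∷ v ∷ []) (i , i<n , j , _ , eq) → return (i , j , eq , i<n) })
    (λ { (n ∷ v ∷ []) (i , j , eq , i<n) → return (i , i<n , j , snd<+1 i j eq , eq) })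

  seqRel : Rel 1
  seqRel = define
    ((∀< x₀ (∀< x₁ ((inRel ∙ (x₀ ∷ x₁ ∷ []) ⇛ inRel ∙ (x₀ ∷ x₂ ∷ [])) ⩓
                    (inRel ∙ (x₀ ∷ x₂ ∷ []) ⇛ inRel ∙ (x₀ ∷ x₁ ∷ []))) ⇛ 𝕗)) ⩓
     (∀< x₀ (inRel ∙ (x₀ ∷ x₁ ∷ []) ⇛ ∃< (+1 x₀) (∃< (+1 x₁) (x₂ ≣ ⟪ x₁ , x₀ ⟫)))) ⩓
     (∀< x₀ (∀< x₁ (∀< x₂ (inRel ∙ (⟪ x₂ , x₁ ⟫ ∷ x₃ ∷ []) ⇛ inRel ∙ (⟪ x₂ , x₀ ⟫ ∷ x₃ ∷ []) ⇛ x₁ ≣ x₀)))) ⩓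
     (∃< (+1 x₀) (∀< x₁ ((x₀ ⋖ x₁ ⇛ ∃< x₂ (inRel ∙ (⟪ x₁ , x₀ ⟫ ∷ x₃ ∷ []))) ⩓
                         (∃< x₂ (inRel ∙ (⟪ x₁ , x₀ ⟫ ∷ x₃ ∷ [])) ⇛ x₀ ⋖ x₁)))))
    (λ { (s ∷ []) → IsSeq s })
    (λ { (s ∷ []) (l , p , f , m , m≤s , d) → return (record
      { least   = λ e e<s h → l e e<s λ i _ → h i
      ; pairs   = λ u u∈s → let (i , _ , a , _ , eq) = p u (in<code u∈s) u∈s in i , a , eq
      ; single  = λ i a b p q → f i (fst< p) a (snd< p) b (snd< q) p q
      ; initial = m , λ i →
          (λ i<m → let (a , _ , p) = proj₁ (d i (<-≤-trans i<m (m<1+n⇒m≤n (subst (m <_) (+-comm s 1) m≤s)))) i<m in a , p) ,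
          λ (a , p) → proj₂ (d i (fst< p)) (a , snd< p , p) }) })
    (λ { (s ∷ []) q → let (l , d) = initial q in return
      ((λ e e<s h → least q e e<s λ i →
          (λ p → proj₁ (h i (<-trans (in<code p) e<s)) p) , λ p → proj₂ (h i (in<code p)) p) ,
       (λ u u<s p → let (i , a , eq) = pairs q u p in i , fst<+1 i a eq , a , snd<+1 i a eq , eq) ,
       (λ i _ a _ b _ → single q i a b) ,
       -- The code bounds the length: a longer sequence would have an entry at index `s`, whose pair
       -- is not below `s`.
       l , ≤⇒<+1 (≮⇒≥ λ s<l → let (a , p) = proj₁ (d s) s<l in <-irrefl refl (fst< p)) ,
       λ i _ → (λ i<l → let (a , p) = proj₁ (d i) i<l in a , snd< p , p) ,
               λ (a , _ , p) → proj₂ (d i) (a , p)) })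
    where
    fst< : ∀ {i a s} → InF (pair i a) s → i < s
    fst< {i} {a} p = ≤-<-trans (≤pairˡ i a) (in<code p)
    snd< : ∀ {i a s} → InF (pair i a) s → a < s
    snd< {i} {a} p = ≤-<-trans (≤pairʳ i a) (in<code p)

  -- Relations P and N of a number and a parameter, read as partial oracles.
  module OracleTrace (pos neg : Rel 2) where
    P⟨_⟩ N⟨_⟩ : ℕ → ℕ → Set
    P⟨ o ⟩ v = holds pos (v ∷ o ∷ [])
    N⟨ o ⟩ v = holds neg (v ∷ o ∷ [])

    earlierRel : Rel 5
    earlierRel = define (∃< x₁ (inRel ∙ (⟪ x₀ , ⟪ x₃ , ⟪ x₄ , x₅ ⟫ ⟫ ⟫ ∷ x₁ ∷ [])))
      (λ { (c ∷ i ∷ e ∷ x ∷ y ∷ []) → ∃ λ j → j < i × InF (pair j (triple e x y)) c })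
      (λ { (c ∷ i ∷ e ∷ x ∷ y ∷ []) h → return h })
      (λ { (c ∷ i ∷ e ∷ x ∷ y ∷ []) h → return h })

    schemeRel : Rel 7
    schemeRel = define φ
      (λ { (c ∷ o ∷ i ∷ t ∷ a ∷ x ∷ y ∷ []) →
           Scheme P⟨ o ⟩ N⟨ o ⟩ (λ e x y → ∃ λ j → j < i × InF (pair j (triple e x y)) c) t a x y })
      (λ { (c ∷ o ∷ i ∷ t ∷ a ∷ x ∷ y ∷ []) h → return (to c o i t a x y h) })
      (λ { (c ∷ o ∷ i ∷ t ∷ a ∷ x ∷ y ∷ []) h → return (from c o i t a x y h) })
      where
      φ₀ φ₁ φ₂ φ₃ φ₄ φ₅ φ₆ φ₇ φ₈ φ₉ φ : BF 7
      φ₀ = x₃ ≣ ♯ 0 ⩓ x₆ ≣ x₄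
      φ₁ = x₃ ≣ ♯ 1 ⩓ x₄ ≣ ♯ 0 ⩓ x₆ ≣ x₅
      φ₂ = x₃ ≣ ♯ 2 ⩓ x₄ ≣ ♯ 0 ⩓ x₆ ≣ ♯ 1 ⊕ x₅
      φ₃ = x₃ ≣ ♯ 3 ⩓ x₄ ≣ ♯ 0 ⩓ ∃< (+1 x₅) (x₆ ≣ ⟪ x₇ , x₀ ⟫)
      φ₄ = x₃ ≣ ♯ 4 ⩓ x₄ ≣ ♯ 0 ⩓ ∃< (+1 x₅) (x₆ ≣ ⟪ x₀ , x₇ ⟫)
      φ₅ = x₃ ≣ ♯ 5 ⩓ x₄ ≣ ♯ 0 ⩓ (pos ∙ (x₅ ∷ x₁ ∷ []) ⩓ x₆ ≣ ♯ 1 ⩔ neg ∙ (x₅ ∷ x₁ ∷ []) ⩓ x₆ ≣ ♯ 0)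
      -- Under four quantifiers: f, g, b, c are x₃, x₂, x₁, x₀.
      φ₆ = x₃ ≣ ♯ 6 ⩓ ∃< (+1 x₄) (∃< (+1 x₅) (∃< (+1 x₈) (∃< (+1 x₉)
             (x₈ ≣ ⟪ x₃ , x₂ ⟫ ⩓ earlierRel ∙ (x₄ ∷ x₆ ∷ x₃ ∷ x₉ ∷ x₁ ∷ []) ⩓
              earlierRel ∙ (x₄ ∷ x₆ ∷ x₂ ∷ x₉ ∷ x₀ ∷ []) ⩓ x₁₀ ≣ ⟪ x₁ , x₀ ⟫))))
      φ₇ = x₃ ≣ ♯ 7 ⩓ ∃< (+1 x₄) (∃< (+1 x₅) (∃< x₂
             (x₇ ≣ ⟪ x₂ , x₁ ⟫ ⩓ earlierRel ∙ (x₃ ∷ x₅ ∷ x₁ ∷ x₈ ∷ x₀ ∷ []) ⩓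
              earlierRel ∙ (x₃ ∷ x₅ ∷ x₂ ∷ x₀ ∷ x₉ ∷ []))))
      φ₈ = x₃ ≣ ♯ 8 ⩓ ∃< (+1 x₄) (∃< (+1 x₅) (x₆ ≣ ⟪ x₁ , x₀ ⟫ ⩓ ∃< (+1 x₇)
             ((x₈ ≣ ⟪ x₀ , ♯ 0 ⟫ ⩓ earlierRel ∙ (x₃ ∷ x₅ ∷ x₂ ∷ x₀ ∷ x₉ ∷ [])) ⩔
              (∃< (+1 x₈) (∃< x₄
                (x₁₀ ≣ ⟪ x₂ , ♯ 1 ⊕ x₁ ⟫ ⩓
                 earlierRel ∙ (x₅ ∷ x₇ ∷ ⟪ ♯ 8 , x₉ ⟫ ∷ ⟪ x₂ , x₁ ⟫ ∷ x₀ ∷ []) ⩓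
                 earlierRel ∙ (x₅ ∷ x₇ ∷ x₃ ∷ ⟪ x₂ , ⟪ x₁ , x₀ ⟫ ⟫ ∷ x₁₁ ∷ [])))))))
      φ₉ = x₃ ≣ ♯ 9 ⩓ earlierRel ∙ (x₀ ∷ x₂ ∷ x₄ ∷ ⟪ x₅ , x₆ ⟫ ∷ ♯ 0 ∷ []) ⩓
             ∀< x₆ (∃< x₁ (earlierRel ∙ (x₂ ∷ x₄ ∷ x₆ ∷ ⟪ x₇ , x₁ ⟫ ∷ ♯ 1 ⊕ x₀ ∷ [])))
      φ = φ₀ ⩔ φ₁ ⩔ φ₂ ⩔ φ₃ ⩔ φ₄ ⩔ φ₅ ⩔ φ₆ ⩔ φ₇ ⩔ φ₈ ⩔ φ₉

      module _ (c o i t a x y : ℕ) where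
        E : ℕ → ℕ → ℕ → Set
        E e x y = ∃ λ j → j < i × InF (pair j (triple e x y)) c
        S = Scheme P⟨ o ⟩ N⟨ o ⟩ E

        -- Elements of a coded set lie below its code; this bounds the intermediate values over
        -- which `Scheme` quantifies.
        output< : ∀ {e x y} → E e x y → y < c
        output< {e} {x} {y} (j , _ , p) =
          ≤-<-trans (≤-trans (≤pairʳ x y) (≤-trans (≤pairʳ e _) (≤pairʳ j _))) (in<code p)

        ρ : Vec ℕ 7
        ρ = c ∷ o ∷ i ∷ t ∷ a ∷ x ∷ y ∷ []

        to : ⟦ φ ⟧ᵇ ρ → S t a x y
        to (inj₁ (refl , p)) = constˢ p
        to (inj₂ (inj₁ (refl , p , q))) = idˢ p q
        to (inj₂ (inj₂ (inj₁ (refl , p , q)))) = sucˢ p q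
        to (inj₂ (inj₂ (inj₂ (inj₁ (refl , p , b , _ , q))))) = fstˢ p q
        to (inj₂ (inj₂ (inj₂ (inj₂ (inj₁ (refl , p , b , _ , q)))))) = sndˢ p q
        to (inj₂ (inj₂ (inj₂ (inj₂ (inj₂ (inj₁ (refl , p , inj₁ (q , r)))))))) = inˢ p q r
        to (inj₂ (inj₂ (inj₂ (inj₂ (inj₂ (inj₁ (refl , p , inj₂ (q , r)))))))) = outˢ p q r
        to (inj₂ (inj₂ (inj₂ (inj₂ (inj₂ (inj₂ (inj₁ (refl , f , _ , g , _ , b , _ , d , _ , eq , p , q , r)))))))) =
          pairˢ eq p q r
        to (inj₂ (inj₂ (inj₂ (inj₂ (inj₂ (inj₂ (inj₂ (inj₁ (refl , f , _ , g , _ , b , _ , eq , p , q))))))))) =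
          compˢ eq p q
        to (inj₂ (inj₂ (inj₂ (inj₂ (inj₂ (inj₂ (inj₂ (inj₂ (inj₁ (refl , f , _ , g , _ , eq , b , _ , inj₁ (eq′ , p))))))))))) =
          zeroˢ eq eq′ p
        to (inj₂ (inj₂ (inj₂ (inj₂ (inj₂ (inj₂ (inj₂ (inj₂ (inj₁ (refl , f , _ , g , _ , eq , b , _ , inj₂ (d , _ , h , _ , eq′ , p , q))))))))))) =
          recˢ eq eq′ p q
        to (inj₂ (inj₂ (inj₂ (inj₂ (inj₂ (inj₂ (inj₂ (inj₂ (inj₂ (refl , p , h)))))))))) =
          μˢ p λ z z<y → nonzero (proj₂ (proj₂ (h z z<y)))

        from : S t a x y → ⟦ φ ⟧ᵇ ρ
        from (constˢ p) = inj₁ (refl , p)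
        from (idˢ p q) = inj₂ (inj₁ (refl , p , q))
        from (sucˢ p q) = inj₂ (inj₂ (inj₁ (refl , p , q)))
        from (fstˢ p q) = inj₂ (inj₂ (inj₂ (inj₁ (refl , p , _ , snd<+1 _ _ q , q))))
        from (sndˢ p q) = inj₂ (inj₂ (inj₂ (inj₂ (inj₁ (refl , p , _ , fst<+1 _ _ q , q)))))
        from (inˢ p q r) = inj₂ (inj₂ (inj₂ (inj₂ (inj₂ (inj₁ (refl , p , inj₁ (q , r)))))))
        from (outˢ p q r) = inj₂ (inj₂ (inj₂ (inj₂ (inj₂ (inj₁ (refl , p , inj₂ (q , r)))))))
        from (pairˢ eq p q r) = inj₂ (inj₂ (inj₂ (inj₂ (inj₂ (inj₂ (inj₁
          (refl , _ , fst<+1 _ _ eq , _ , snd<+1 _ _ eq , _ , fst<+1 _ _ r , _ , snd<+1 _ _ r , eq , p , q , r)))))))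
        from (compˢ eq p q) = inj₂ (inj₂ (inj₂ (inj₂ (inj₂ (inj₂ (inj₂ (inj₁
          (refl , _ , fst<+1 _ _ eq , _ , snd<+1 _ _ eq , _ , output< p , eq , p , q))))))))
        from (zeroˢ eq eq′ p) = inj₂ (inj₂ (inj₂ (inj₂ (inj₂ (inj₂ (inj₂ (inj₂ (inj₁
          (refl , _ , fst<+1 _ _ eq , _ , snd<+1 _ _ eq , eq , _ , fst<+1 _ _ eq′ , inj₁ (eq′ , p))))))))))
        from (recˢ eq eq′ p q) = inj₂ (inj₂ (inj₂ (inj₂ (inj₂ (inj₂ (inj₂ (inj₂ (inj₁
          (refl , _ , fst<+1 _ _ eq , _ , snd<+1 _ _ eq , eq , _ , fst<+1 _ _ eq′ , inj₂
            (_ , <-trans (n<1+n _) (snd<+1 _ _ eq′) , _ , output< p , eq′ , p , q))))))))))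
        from (μˢ p h) = inj₂ (inj₂ (inj₂ (inj₂ (inj₂ (inj₂ (inj₂ (inj₂ (inj₂
          (refl , p , λ z z<y → w (h z z<y))))))))))
          where
          w : ∀ {z} → Nonzero E a x z → ∃ λ w → w < c × E a (pair x z) (suc w)
          w (nonzero ev) = _ , <-trans (n<1+n _) (output< ev) , ev

    traceRel : Rel 5
    traceRel = define
      ((∀< x₀ (inRel ∙ (x₀ ∷ x₁ ∷ []) ⇛
         ∃< (+1 x₀) (∃< (+1 x₁) (∃< (+1 x₂) (∃< (+1 x₃) (∃< (+1 x₂) (∃< (+1 x₃)
           (x₆ ≣ ⟪ x₅ , ⟪ x₄ , ⟪ x₃ , x₂ ⟫ ⟫ ⟫ ⩓ x₄ ≣ ⟪ x₁ , x₀ ⟫ ⩓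
            schemeRel ∙ (x₇ ∷ x₈ ∷ x₅ ∷ x₁ ∷ x₀ ∷ x₃ ∷ x₂ ∷ []))))))))) ⩓
       ∃< x₀ (inRel ∙ (⟪ x₀ , ⟪ x₃ , ⟪ x₄ , x₅ ⟫ ⟫ ⟫ ∷ x₁ ∷ [])))
      (λ { (c ∷ o ∷ e ∷ x ∷ y ∷ []) → Trace P⟨ o ⟩ N⟨ o ⟩ c e x y })
      (λ { (c ∷ o ∷ e ∷ x ∷ y ∷ []) (h , i , _ , p) → return (trace
        (λ u u∈c → let (i , _ , e , _ , x , _ , y , _ , t , _ , a , _ , eq , eq′ , s) = h u (in<code u∈c) u∈c in
                   i , e , x , y , eq , t , a , eq′ , s)
        (i , p)) })
      (λ { (c ∷ o ∷ e ∷ x ∷ y ∷ []) (trace h (i , p)) → return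
        ((λ u u<c u∈c → bounds (h u u∈c)) , i , ≤-<-trans (≤pairˡ i _) (in<code p) , p) })
      where
      bounds : ∀ {u} {A : ℕ → ℕ → ℕ → ℕ → ℕ → ℕ → Set} →
        (∃ λ i → ∃ λ e → ∃ λ x → ∃ λ y → u ≡ pair i (triple e x y) ×
          ∃ λ t → ∃ λ a → e ≡ pair t a × A i e x y t a) →
        ∃ λ i → i < u + 1 × ∃ λ e → e < u + 1 × ∃ λ x → x < u + 1 × ∃ λ y → y < u + 1 ×
          ∃ λ t → t < e + 1 × ∃ λ a → a < e + 1 × u ≡ pair i (triple e x y) × e ≡ pair t a × A i e x y t a
      bounds (i , e , x , y , refl , t , a , refl , h) =
        i , ≤⇒<+1 (≤pairˡ i _) ,
        e , ≤⇒<+1 (≤-trans (≤pairˡ e _) (≤pairʳ i _)) ,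
        x , ≤⇒<+1 (≤-trans (≤pairˡ x y) (≤-trans (≤pairʳ e _) (≤pairʳ i _))) ,
        y , ≤⇒<+1 (≤-trans (≤pairʳ x y) (≤-trans (≤pairʳ e _) (≤pairʳ i _))) ,
        t , ≤⇒<+1 (≤pairˡ t a) , a , ≤⇒<+1 (≤pairʳ t a) , refl , refl , h

-- Relative computability is transitive

module Transitivity (P N : ℕ → Set) where
  open Relations P N

  leastSolution : ∀ {k} (R : Rel (suc k)) xs → ¬¬ ∃ (λ z → holds R (z ∷ xs)) →
    ¬¬ ∃ λ z → holds R (z ∷ xs) × (∀ j → j < z → ¬ holds R (j ∷ xs)) ×
               Ev (searchᶜ (code R)) (encode xs) z
  leastSolution R xs h = do
    z , p ← h
    z , p , min ← ¬¬-least {λ z → holds R (z ∷ xs)} z p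
    ev ← decides-search {A = λ z → holds R (z ∷ xs)} (λ z → decides R (z ∷ xs)) p min
    return (z , p , min , ev)

  setRel : (X : ℕ → Set) (e : ℕ) → (∀ v → Decides e v (X v)) → Rel 1
  setRel X e d = record
    { holds = λ { (v ∷ []) → X v } ; code = compᶜ e fstᶜ
    ; decides = λ { (v ∷ []) → decides-comp ev-fst (d v) } }

  unaryᶜ : Rel 1 → ℕ
  unaryᶜ R = compᶜ (code R) (pairᶜ idᶜ (constᶜ 0))

  unary-decides : ∀ R v → Decides (unaryᶜ R) v (holds R (v ∷ []))
  unary-decides R v = decides-comp (ev-pair ev-id ev-const) (decides R (v ∷ []))

  module SetOracle (X : ℕ → Set) (e : ℕ) (dec : ∀ v → Decides e v (X v)) where
    private
      XRel = setRel X e dec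
      pos neg : Rel 2
      pos = define (XRel ∙ (x₀ ∷ [])) (λ { (v ∷ o ∷ []) → X v })
        (λ { (v ∷ o ∷ []) → return }) (λ { (v ∷ o ∷ []) → return })
      neg = define (XRel ∙ (x₀ ∷ []) ⇛ 𝕗) (λ { (v ∷ o ∷ []) → ¬ X v })
        (λ { (v ∷ o ∷ []) → return }) (λ { (v ∷ o ∷ []) → return })
      open OracleTrace pos neg

    setTraceRel : Rel 4
    setTraceRel = define (traceRel ∙ (x₀ ∷ ♯ 0 ∷ x₁ ∷ x₂ ∷ x₃ ∷ []))
      (λ { (c ∷ e ∷ x ∷ y ∷ []) → Trace X (¬_ ∘ X) c e x y })
      (λ { (c ∷ e ∷ x ∷ y ∷ []) → return }) (λ { (c ∷ e ∷ x ∷ y ∷ []) → return })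

    private
      answer : Rel 3
      answer = define (∃< (+1 x₀) (∃< (+1 x₁) (x₂ ≣ ⟪ x₁ , x₀ ⟫ ⩓ setTraceRel ∙ (x₀ ∷ x₃ ∷ x₄ ∷ x₁ ∷ []))))
        (λ { (z ∷ f ∷ x ∷ []) → ∃ λ y → ∃ λ c → z ≡ pair y c × Trace X (¬_ ∘ X) c f x y })
        (λ { (z ∷ f ∷ x ∷ []) (y , _ , c , _ , h) → return (y , c , h) })
        (λ { (z ∷ f ∷ x ∷ []) (y , c , eq , h) → return (y , fst<+1 y c eq , c , snd<+1 y c eq , eq , h) })

    simulateᶜ : ℕ → ℕ
    simulateᶜ f = compᶜ fstᶜ (compᶜ (searchᶜ (code answer)) (pairᶜ (constᶜ f) (pairᶜ idᶜ (constᶜ 0))))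

    -- Traces with oracle `X` are decidable because `X` is, so an output together with its trace can
    -- be searched for. The search may stop at another trace, but `functional` gives the same
    -- output.
    simulate : ∀ {f x y} → Eval X (¬_ ∘ X) f x y → ¬¬ Ev (simulateᶜ f) x y
    simulate {f} {x} {y} ev = do
      let c , tr = trace-complete ev
      z , (y′ , c′ , eq , tr′) , _ , ev₂ ← leastSolution answer (f ∷ x ∷ []) (return (pair y c , y , c , refl , tr))
      ev′ ← trace-sound tr′
      case (eq , functional (λ p ¬p → ¬p p) (λ ¬p p → ¬p p) ev ev′) of λ where
        (refl , refl) → return (ev-comp (ev-comp (ev-pair ev-const (ev-pair ev-id ev-const)) ev₂) ev-fst)

    simulate-decides : ∀ {f x A} → Computability.Decides X (¬_ ∘ X) f x A → Decides (simulateᶜ f) x A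
    simulate-decides (p , q) = (λ a → p a >>= simulate) , λ ¬a → q ¬a >>= simulate

  open SetOracle public using (simulateᶜ; simulate-decides)

-- Negative semantics

⟦_⟧ᴺ : ∀ {n} → Term n → Vec ℕ n → ℕ
⟦ var i ⟧ᴺ  ρ = lookup ρ i
⟦ 𝟎 ⟧ᴺ      ρ = 0
⟦ 𝟏 ⟧ᴺ      ρ = 1
⟦ t +′ u ⟧ᴺ ρ = ⟦ t ⟧ᴺ ρ + ⟦ u ⟧ᴺ ρ
⟦ t · u ⟧ᴺ  ρ = ⟦ t ⟧ᴺ ρ * ⟦ u ⟧ᴺ ρ

subTerm-⟦⟧ : ∀ {n n′} (σ : Fin n → Term n′) {ρ ρ′} → (∀ i → ⟦ σ i ⟧ᴺ ρ′ ≡ lookup ρ i) →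
             ∀ t → ⟦ subTerm σ t ⟧ᴺ ρ′ ≡ ⟦ t ⟧ᴺ ρ
subTerm-⟦⟧ σ h (var i)  = h i
subTerm-⟦⟧ σ h 𝟎        = refl
subTerm-⟦⟧ σ h 𝟏        = refl
subTerm-⟦⟧ σ h (t +′ u) = cong₂ _+_ (subTerm-⟦⟧ σ h t) (subTerm-⟦⟧ σ h u)
subTerm-⟦⟧ σ h (t · u)  = cong₂ _*_ (subTerm-⟦⟧ σ h t) (subTerm-⟦⟧ σ h u)

wkTerm-⟦⟧ : ∀ {n} (t : Term n) z ρ → ⟦ wkTerm t ⟧ᴺ (z ∷ ρ) ≡ ⟦ t ⟧ᴺ ρ
wkTerm-⟦⟧ t z ρ = subTerm-⟦⟧ (var ∘ suc) (λ _ → refl) t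

module Semantics (D : Set) (mem : D → ℕ → Set) (mem-stable : ∀ X v → ¬¬ mem X v → mem X v) where

  ⟦_⟧ : ∀ {n m} → Formula n m → Vec ℕ n → Vec D m → Set
  ⟦ t ≐ u ⟧  ρ δ = ⟦ t ⟧ᴺ ρ ≡ ⟦ u ⟧ᴺ ρ
  ⟦ t ≺ u ⟧  ρ δ = ⟦ t ⟧ᴺ ρ < ⟦ u ⟧ᴺ ρ
  ⟦ t ε X ⟧  ρ δ = mem (lookup δ X) (⟦ t ⟧ᴺ ρ)
  ⟦ ⊥′ ⟧     ρ δ = ⊥
  ⟦ φ ∧ ψ ⟧  ρ δ = ⟦ φ ⟧ ρ δ × ⟦ ψ ⟧ ρ δ
  ⟦ φ ∨ ψ ⟧  ρ δ = ¬ (¬ ⟦ φ ⟧ ρ δ × ¬ ⟦ ψ ⟧ ρ δ)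
  ⟦ φ ⇒ ψ ⟧  ρ δ = ⟦ φ ⟧ ρ δ → ⟦ ψ ⟧ ρ δ
  ⟦ all₁ φ ⟧ ρ δ = ∀ z → ⟦ φ ⟧ (z ∷ ρ) δ
  ⟦ ex₁ φ ⟧  ρ δ = ¬ (∀ z → ¬ ⟦ φ ⟧ (z ∷ ρ) δ)
  ⟦ all₂ φ ⟧ ρ δ = ∀ X → ⟦ φ ⟧ ρ (X ∷ δ)
  ⟦ ex₂ φ ⟧  ρ δ = ¬ (∀ X → ¬ ⟦ φ ⟧ ρ (X ∷ δ))

  stable : ∀ {n m} (φ : Formula n m) ρ δ → ¬¬ ⟦ φ ⟧ ρ δ → ⟦ φ ⟧ ρ δ
  stable (t ≐ u)  ρ δ h = decidable-stable (_ ≟ _) h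
  stable (t ≺ u)  ρ δ h = decidable-stable (_ <? _) h
  stable (t ε X)  ρ δ h = mem-stable _ _ h
  stable ⊥′       ρ δ h = run h
  stable (φ ∧ ψ)  ρ δ h = stable φ ρ δ (λ k → h (k ∘ proj₁)) , stable ψ ρ δ (λ k → h (k ∘ proj₂))
  stable (φ ∨ ψ)  ρ δ h k = h (λ f → f k)
  stable (φ ⇒ ψ)  ρ δ h a = stable ψ ρ δ (λ k → h (λ f → k (f a)))
  stable (all₁ φ) ρ δ h z = stable φ _ δ (λ k → h (λ f → k (f z)))
  stable (ex₁ φ)  ρ δ h k = h (λ f → f k)
  stable (all₂ φ) ρ δ h X = stable φ ρ _ (λ k → h (λ f → k (f X)))
  stable (ex₂ φ)  ρ δ h k = h (λ f → f k)

  module _ {n n′ : ℕ} where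
    lift₁ : (σ : Fin n → Term n′) {ρ : Vec ℕ n} {ρ′ : Vec ℕ n′} → (∀ i → ⟦ σ i ⟧ᴺ ρ′ ≡ lookup ρ i) →
            ∀ z i → ⟦ (var zero ▹ wkTerm ∘ σ) i ⟧ᴺ (z ∷ ρ′) ≡ lookup (z ∷ ρ) i
    lift₁ σ h z zero    = refl
    lift₁ σ h z (suc i) = trans (wkTerm-⟦⟧ (σ i) z _) (h i)

  lift₂ : ∀ {m m′} {τ : Fin m → Fin m′} {δ : Vec D m} {δ′ : Vec D m′} →
          (∀ j → lookup δ′ (τ j) ≡ lookup δ j) →
          ∀ X j → lookup (X ∷ δ′) ((zero ▹ suc ∘ τ) j) ≡ lookup (X ∷ δ) j
  lift₂ h X zero    = refl
  lift₂ h X (suc j) = h j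

  substitution : ∀ {n n′ m m′} (φ : Formula n m) {σ : Fin n → Term n′} {τ : Fin m → Fin m′} {ρ ρ′ δ δ′} →
    (∀ i → ⟦ σ i ⟧ᴺ ρ′ ≡ lookup ρ i) → (∀ j → lookup δ′ (τ j) ≡ lookup δ j) →
    (⟦ sub σ τ φ ⟧ ρ′ δ′ → ⟦ φ ⟧ ρ δ) × (⟦ φ ⟧ ρ δ → ⟦ sub σ τ φ ⟧ ρ′ δ′)
  substitution (t ≐ u) {σ} g h =
    subst₂ _≡_ (subTerm-⟦⟧ σ g t) (subTerm-⟦⟧ σ g u) ,
    subst₂ _≡_ (sym (subTerm-⟦⟧ σ g t)) (sym (subTerm-⟦⟧ σ g u))
  substitution (t ≺ u) {σ} g h =
    subst₂ _<_ (subTerm-⟦⟧ σ g t) (subTerm-⟦⟧ σ g u) ,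
    subst₂ _<_ (sym (subTerm-⟦⟧ σ g t)) (sym (subTerm-⟦⟧ σ g u))
  substitution (t ε X) {σ} g h =
    subst₂ mem (h X) (subTerm-⟦⟧ σ g t) ,
    subst₂ mem (sym (h X)) (sym (subTerm-⟦⟧ σ g t))
  substitution ⊥′ g h = id , id
  substitution (φ ∧ ψ) g h with substitution φ g h | substitution ψ g h
  ... | f , f′ | k , k′ = (λ (a , b) → f a , k b) , λ (a , b) → f′ a , k′ b
  substitution (φ ∨ ψ) g h with substitution φ g h | substitution ψ g h
  ... | f , f′ | k , k′ = (λ p (a , b) → p (a ∘ f , b ∘ k)) , λ p (a , b) → p (a ∘ f′ , b ∘ k′)
  substitution (φ ⇒ ψ) g h with substitution φ g h | substitution ψ g h
  ... | f , f′ | k , k′ = (λ p a → k (p (f′ a))) , λ p a → k′ (p (f a))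
  substitution (all₁ φ) {σ} g h =
    (λ p z → proj₁ (substitution φ (lift₁ σ g z) h) (p z)) ,
    (λ p z → proj₂ (substitution φ (lift₁ σ g z) h) (p z))
  substitution (ex₁ φ) {σ} g h =
    (λ p q → p λ z a → q z (proj₁ (substitution φ (lift₁ σ g z) h) a)) ,
    (λ p q → p λ z a → q z (proj₂ (substitution φ (lift₁ σ g z) h) a))
  substitution (all₂ φ) g h =
    (λ p X → proj₁ (substitution φ g (lift₂ h X)) (p X)) ,
    (λ p X → proj₂ (substitution φ g (lift₂ h X)) (p X))
  substitution (ex₂ φ) g h =
    (λ p q → p λ X a → q X (proj₁ (substitution φ g (lift₂ h X)) a)) ,
    (λ p q → p λ X a → q X (proj₂ (substitution φ g (lift₂ h X)) a))

  module _ {n m : ℕ} (φ : Formula n m) (ρ : Vec ℕ n) (δ : Vec D m) where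
    sem-wk₁ : ∀ z → (⟦ wk₁ φ ⟧ (z ∷ ρ) δ → ⟦ φ ⟧ ρ δ) × (⟦ φ ⟧ ρ δ → ⟦ wk₁ φ ⟧ (z ∷ ρ) δ)
    sem-wk₁ z = substitution φ (λ _ → refl) (λ _ → refl)

    sem-wk₂ : ∀ X → (⟦ wk₂ φ ⟧ ρ (X ∷ δ) → ⟦ φ ⟧ ρ δ) × (⟦ φ ⟧ ρ δ → ⟦ wk₂ φ ⟧ ρ (X ∷ δ))
    sem-wk₂ X = substitution φ (λ _ → refl) (λ _ → refl)

  sem-[]₁ : ∀ {n m} (φ : Formula (suc n) m) t ρ δ →
    (⟦ φ [ t ]₁ ⟧ ρ δ → ⟦ φ ⟧ (⟦ t ⟧ᴺ ρ ∷ ρ) δ) × (⟦ φ ⟧ (⟦ t ⟧ᴺ ρ ∷ ρ) δ → ⟦ φ [ t ]₁ ⟧ ρ δ)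
  sem-[]₁ φ t ρ δ = substitution φ (λ { zero → refl ; (suc i) → refl }) (λ _ → refl)

  sem-[]₂ : ∀ {n m} (φ : Formula n (suc m)) X ρ δ →
    (⟦ φ [ X ]₂ ⟧ ρ δ → ⟦ φ ⟧ ρ (lookup δ X ∷ δ)) × (⟦ φ ⟧ ρ (lookup δ X ∷ δ) → ⟦ φ [ X ]₂ ⟧ ρ δ)
  sem-[]₂ φ X ρ δ = substitution φ (λ _ → refl) (λ { zero → refl ; (suc i) → refl })

  sem-close : ∀ {n m} (φ : Formula n m) → (∀ ρ δ → ⟦ φ ⟧ ρ δ) → ⟦ close φ ⟧ [] []
  sem-close {zero}  {zero}  φ h = h [] []
  sem-close {zero}  {suc m} φ h = sem-close (all₂ φ) λ ρ δ X → h ρ (X ∷ δ)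
  sem-close {suc n} {m}     φ h = sem-close (all₁ φ) λ ρ δ z → h (z ∷ ρ) δ

  module _ {T : Theory} (true : ∀ {σ} → T σ → ⟦ σ ⟧ [] []) where
    -- Stability of translated formulas validates `RAA` and the eliminations of disjunction and
    -- existence.
    soundness : ∀ {n m} {Γ : List (Formula n m)} {φ} → _∣_⊢_ T Γ φ →
                ∀ ρ δ → All (λ ψ → ⟦ ψ ⟧ ρ δ) Γ → ⟦ φ ⟧ ρ δ
    soundness (axiom {σ} p) ρ δ γ = proj₂ (substitution σ (λ ()) (λ ())) (true p)
    soundness (hyp p)    ρ δ γ = All.lookup γ p
    soundness (⇒I d)     ρ δ γ = λ a → soundness d ρ δ (a All.∷ γ)
    soundness (⇒E d d′)  ρ δ γ = soundness d ρ δ γ (soundness d′ ρ δ γ)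
    soundness (∧I d d′)  ρ δ γ = soundness d ρ δ γ , soundness d′ ρ δ γ
    soundness (∧E₁ d)    ρ δ γ = proj₁ (soundness d ρ δ γ)
    soundness (∧E₂ d)    ρ δ γ = proj₂ (soundness d ρ δ γ)
    soundness (∨I₁ d)    ρ δ γ = λ (¬a , _) → ¬a (soundness d ρ δ γ)
    soundness (∨I₂ d)    ρ δ γ = λ (_ , ¬b) → ¬b (soundness d ρ δ γ)
    soundness (∨E {χ = χ} d d₁ d₂) ρ δ γ = stable χ ρ δ λ ¬c → soundness d ρ δ γ
      ((λ a → ¬c (soundness d₁ ρ δ (a All.∷ γ))) , λ b → ¬c (soundness d₂ ρ δ (b All.∷ γ)))
    soundness (RAA {φ} d) ρ δ γ = stable φ ρ δ λ ¬a → soundness d ρ δ (¬a All.∷ γ)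
    soundness (∀₁I d)    ρ δ γ = λ z → soundness d (z ∷ ρ) δ
      (Allₚ.map⁺ (All.map (λ {ψ} → proj₂ (sem-wk₁ ψ ρ δ z)) γ))
    soundness (∀₁E {φ} d t) ρ δ γ = proj₂ (sem-[]₁ φ t ρ δ) (soundness d ρ δ γ (⟦ t ⟧ᴺ ρ))
    soundness (∃₁I {φ} t d) ρ δ γ = λ k → k (⟦ t ⟧ᴺ ρ) (proj₁ (sem-[]₁ φ t ρ δ) (soundness d ρ δ γ))
    soundness (∃₁E {φ} {ψ} d d′) ρ δ γ = stable ψ ρ δ λ ¬b → soundness d ρ δ γ λ z a →
      ¬b (proj₁ (sem-wk₁ ψ ρ δ z) (soundness d′ (z ∷ ρ) δ
        (a All.∷ Allₚ.map⁺ (All.map (λ {χ} → proj₂ (sem-wk₁ χ ρ δ z)) γ))))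
    soundness (∀₂I d)    ρ δ γ = λ X → soundness d ρ (X ∷ δ)
      (Allₚ.map⁺ (All.map (λ {ψ} → proj₂ (sem-wk₂ ψ ρ δ X)) γ))
    soundness (∀₂E {φ} d X) ρ δ γ = proj₂ (sem-[]₂ φ X ρ δ) (soundness d ρ δ γ (lookup δ X))
    soundness (∃₂I {φ} X d) ρ δ γ = λ k → k (lookup δ X) (proj₁ (sem-[]₂ φ X ρ δ) (soundness d ρ δ γ))
    soundness (∃₂E {φ} {ψ} d d′) ρ δ γ = stable ψ ρ δ λ ¬b → soundness d ρ δ γ λ X a →
      ¬b (proj₁ (sem-wk₂ ψ ρ δ X) (soundness d′ ρ (X ∷ δ)
        (a All.∷ Allₚ.map⁺ (All.map (λ {χ} → proj₂ (sem-wk₂ χ ρ δ X)) γ))))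
    soundness ≐I         ρ δ γ = refl
    soundness (≐E {t} {u} φ d d′) ρ δ γ = proj₂ (sem-[]₁ φ u ρ δ)
      (subst (λ z → ⟦ φ ⟧ (z ∷ ρ) δ) (soundness d ρ δ γ) (proj₁ (sem-[]₁ φ t ρ δ) (soundness d′ ρ δ γ)))

-- The model of sets computable from finitely many columns of G

col-mono : ∀ {m n v} → m ≤ n → Col m v → Col n v
col-mono m≤n (i , j , eq , i<m) = i , j , eq , <-≤-trans i<m m≤n

module Model (G : ℕ → Set) where

  Gₙ Gₙᶜ : ℕ → ℕ → Set
  Gₙ n v = Col n v × G v
  Gₙᶜ n v = ¬ Gₙ n v

  module At (n : ℕ) where
    open Relations (Gₙ n) (Gₙᶜ n) public
    open Transitivity (Gₙ n) (Gₙᶜ n) public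

  record Real : Set where
    field
      level : ℕ
      index : ℕ
      total : ∀ v → ¬¬ (At.Ev level index v 1 ⊎ At.Ev level index v 0)
  open Real public

  mem : Real → ℕ → Set
  mem X v = ¬¬ At.Ev (level X) (index X) v 1

  decides-mem : ∀ X v → At.Decides (level X) (index X) v (mem X v)
  decides-mem X v = id , λ ¬m → total X v >>= λ where
    (inj₁ ev) → ⊥-elim (¬m (return ev))
    (inj₂ ev) → return ev

  module _ {n e : ℕ} {A : ℕ → Set} (d : ∀ v → At.Decides n e v (A v)) where
    real : Real
    real = record { level = n ; index = e ; total = λ v → em (A v) >>= λ where
      (yes a) → proj₁ (d v) a >>= λ ev → return (inj₁ ev)
      (no ¬a) → proj₂ (d v) ¬a >>= λ ev → return (inj₂ ev) }

    real⇒ : ∀ v → mem real v → ¬¬ A v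
    real⇒ v m ¬a = run do
      ev ← m
      ev′ ← proj₂ (d v) ¬a
      case functional (λ p ¬p → ¬p p) (λ ¬p p → ¬p p) ev ev′ of λ ()

    ⇒real : ∀ v → A v → mem real v
    ⇒real v = proj₁ (d v)

  decides-oracle : ∀ n v → At.Decides n oracleᶜ v (Gₙ n v)
  decides-oracle n v = (λ p → return (by refl (inˢ refl p refl))) , λ ¬p → return (by refl (outˢ refl ¬p refl))

  module _ {n N : ℕ} (n≤N : n ≤ N) where
    open At N

    columnsRel : Rel 1
    columnsRel = define (colRel ∙ (♯ n ∷ x₀ ∷ []) ⩓ setRel (Gₙ N) oracleᶜ (decides-oracle N) ∙ (x₀ ∷ []))
      (λ { (v ∷ []) → Gₙ n v })
      (λ { (v ∷ []) (c , _ , g) → return (c , g) })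
      (λ { (v ∷ []) (c , g) → return (c , col-mono n≤N c , g) })

  -- Fewer columns are computable from more columns, so finitely many reals can be handled at one
  -- common level by simulation.
  memRel : ∀ {N} X → level X ≤ N → At.Rel N 1
  memRel {N} X l≤N = At.setRel N (mem X)
    (At.simulateᶜ N (Gₙ (level X)) _ (At.unary-decides N (columnsRel l≤N)) (index X))
    λ v → At.simulate-decides N _ _ (At.unary-decides N (columnsRel l≤N)) (decides-mem X v)

  open Semantics Real mem (λ X v h k → h λ m → m k) public

  ⌊_⌋ : ∀ {n} → Term n → Tm n
  ⌊ var i ⌋  = ν i
  ⌊ 𝟎 ⌋      = ♯ 0
  ⌊ 𝟏 ⌋      = ♯ 1
  ⌊ t +′ u ⌋ = ⌊ t ⌋ ⊕ ⌊ u ⌋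
  ⌊ t · u ⌋  = ⌊ t ⌋ ⊗ ⌊ u ⌋

  ⌊⌋-sem : ∀ {n} (t : Term n) ρ → ⟦ ⌊ t ⌋ ⟧ᵗ ρ ≡ ⟦ t ⟧ᴺ ρ
  ⌊⌋-sem (var i)  ρ = refl
  ⌊⌋-sem 𝟎        ρ = refl
  ⌊⌋-sem 𝟏        ρ = refl
  ⌊⌋-sem (t +′ u) ρ = cong₂ _+_ (⌊⌋-sem t ρ) (⌊⌋-sem u ρ)
  ⌊⌋-sem (t · u)  ρ = cong₂ _*_ (⌊⌋-sem t ρ) (⌊⌋-sem u ρ)

  module Bounded {m} (N : ℕ) (δ : Vec Real m) (below : ∀ j → level (lookup δ j) ≤ N) where
    open At N

    bounded : ∀ {n} {φ : Formula n m} → Δ₀ φ → BF n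
    bounded (Δ-≐ {t} {u}) = ⌊ t ⌋ ≣ ⌊ u ⌋
    bounded (Δ-≺ {t} {u}) = ⌊ t ⌋ ⋖ ⌊ u ⌋
    bounded (Δ-ε {t} {X}) = memRel (lookup δ X) (below X) ∙ (⌊ t ⌋ ∷ [])
    bounded Δ-⊥           = 𝕗
    bounded (Δ-∧ d d′)    = bounded d ⩓ bounded d′
    bounded (Δ-∨ d d′)    = bounded d ⩔ bounded d′
    bounded (Δ-⇒ d d′)    = bounded d ⇛ bounded d′
    bounded (Δ-∀ {t} d)   = ∀< ⌊ t ⌋ (bounded d)
    bounded (Δ-∃ {t} d)   = ∃< ⌊ t ⌋ (bounded d)

    bounded-sem : ∀ {n} {φ : Formula n m} (d : Δ₀ φ) ρ →
                  (⟦ φ ⟧ ρ δ → ¬¬ ⟦ bounded d ⟧ᵇ ρ) × (⟦ bounded d ⟧ᵇ ρ → ⟦ φ ⟧ ρ δ)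
    bounded-sem (Δ-≐ {t} {u}) ρ rewrite ⌊⌋-sem t ρ | ⌊⌋-sem u ρ = return , id
    bounded-sem (Δ-≺ {t} {u}) ρ rewrite ⌊⌋-sem t ρ | ⌊⌋-sem u ρ = return , id
    bounded-sem (Δ-ε {t} {X}) ρ rewrite ⌊⌋-sem t ρ = return , id
    bounded-sem Δ-⊥ ρ = return , id
    bounded-sem (Δ-∧ d d′) ρ with bounded-sem d ρ | bounded-sem d′ ρ
    ... | f , f′ | g , g′ = (λ (a , b) → f a >>= λ a → g b >>= λ b → return (a , b)) , λ (a , b) → f′ a , g′ b
    bounded-sem (Δ-∨ d d′) ρ with bounded-sem d ρ | bounded-sem d′ ρ
    ... | f , f′ | g , g′ =
      (λ h k → h ((λ a → f a (k ∘ inj₁)) , λ b → g b (k ∘ inj₂))) ,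
      λ { (inj₁ a) (¬a , _) → ¬a (f′ a) ; (inj₂ b) (_ , ¬b) → ¬b (g′ b) }
    bounded-sem (Δ-⇒ {φ} {ψ} d d′) ρ with bounded-sem d ρ | bounded-sem d′ ρ
    ... | f , f′ | g , g′ =
      (λ h k → k λ a → ⊥-elim (g (h (f′ a)) λ b → k λ _ → b)) ,
      λ h a → stable ψ ρ δ λ ¬b → f a λ a → ¬b (g′ (h a))
    bounded-sem (Δ-∀ {t} {φ} d) ρ rewrite ⌊⌋-sem t ρ =
      (λ h → ¬¬-∀< (⟦ t ⟧ᴺ ρ) λ z z<t →
         proj₁ (bounded-sem d (z ∷ ρ)) (h z (subst (z <_) (sym (wkTerm-⟦⟧ t z ρ)) z<t))) ,
      λ h z z<t → proj₂ (bounded-sem d (z ∷ ρ)) (h z (subst (z <_) (wkTerm-⟦⟧ t z ρ) z<t))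
    bounded-sem (Δ-∃ {t} {φ} d) ρ rewrite ⌊⌋-sem t ρ =
      (λ h k → h λ z (z<t , a) → proj₁ (bounded-sem d (z ∷ ρ)) a λ a →
         k (z , subst (z <_) (wkTerm-⟦⟧ t z ρ) z<t , a)) ,
      λ (z , z<t , a) k → k z (subst (z <_) (sym (wkTerm-⟦⟧ t z ρ)) z<t , proj₂ (bounded-sem d (z ∷ ρ)) a)

  commonLevel : ∀ {m} (δ : Vec Real m) → ∃ λ N → ∀ j → level (lookup δ j) ≤ N
  commonLevel []      = 0 , λ ()
  commonLevel (X ∷ δ) with commonLevel δ
  ... | N , h = level X ⊔ N , λ { zero → m≤m⊔n (level X) N ; (suc j) → ≤-trans (h j) (m≤n⊔m (level X) N) }

  -- Comprehension and the axioms of the base theory in the model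

  module Comprehension {n m} {φ ψ : Formula (suc (suc n)) m} (dφ : Δ₀ φ) (dψ : Δ₀ ψ)
           (ρ : Vec ℕ n) (δ : Vec Real m)
           (equiv : ∀ x → (⟦ ex₁ φ ⟧ (x ∷ ρ) δ → ⟦ all₁ ψ ⟧ (x ∷ ρ) δ) ×
                          (⟦ all₁ ψ ⟧ (x ∷ ρ) δ → ⟦ ex₁ φ ⟧ (x ∷ ρ) δ)) where
    N = proj₁ (commonLevel δ)
    open At N
    open Bounded N δ (proj₂ (commonLevel δ))

    -- Evidence is a witness for `φ` or a counterexample to `ψ`. The assumed equivalence provides
    -- one for every x, as in the proof that a set is computable if it and its complement are
    -- enumerable.
    evidence : Rel (suc (suc n))
    evidence = define (bounded dφ ⩔ (bounded dψ ⇛ 𝕗)) (⟦ bounded dφ ⩔ (bounded dψ ⇛ 𝕗) ⟧ᵇ)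
      (λ _ → return) (λ _ → return)

    comprehensionᶜ : ℕ
    comprehensionᶜ = compᶜ (compᶜ (formulaᶜ (bounded dφ)) (pairᶜ (searchᶜ (code evidence)) idᶜ))
                           (pairᶜ idᶜ (constᶜ (encode ρ)))

    evidence-exists : ∀ x → ¬¬ ∃ λ z → holds evidence (z ∷ x ∷ ρ)
    evidence-exists x k = (λ a → proj₂ (equiv x) a λ z a → proj₁ (bounded-sem dφ _) a λ a → k (z , inj₁ a))
      λ z → stable ψ _ δ λ ¬b → k (z , inj₂ λ b → ¬b (proj₂ (bounded-sem dψ _) b))

    comprehension-decides : ∀ x → Decides comprehensionᶜ x (⟦ ex₁ φ ⟧ (x ∷ ρ) δ)
    comprehension-decides x = decides-comp (ev-pair ev-id ev-const)
      ((λ a → do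
          z , p , _ , ev ← leastSolution evidence (x ∷ ρ) (evidence-exists x)
          b ← case p of λ where
            (inj₁ b) → return b
            -- The Σ₁ form holds, hence the Π₁ form, and a counterexample to `ψ` is impossible.
            (inj₂ ¬b) → λ _ → proj₁ (bounded-sem dψ _) (proj₁ (equiv x) a z) ¬b
          ev′ ← proj₁ (decides-formula (bounded dφ) (z ∷ x ∷ ρ)) b
          return (ev-comp (ev-pair ev ev-id) ev′)) ,
       (λ ¬a → do
          z , _ , _ , ev ← leastSolution evidence (x ∷ ρ) (evidence-exists x)
          ev′ ← proj₂ (decides-formula (bounded dφ) (z ∷ x ∷ ρ))
                  λ b → ¬a λ k → k z (proj₂ (bounded-sem dφ _) b)
          return (ev-comp (ev-pair ev ev-id) ev′)))

  RCA₀-true : ∀ {σ} → RCA₀ σ → ⟦ σ ⟧ [] []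
  RCA₀-true suc≢0   a eq = case trans (+-comm 1 a) eq of λ ()
  RCA₀-true suc-inj a b eq = +-cancelʳ-≡ 1 a b eq
  RCA₀-true +-zero  a = +-identityʳ a
  RCA₀-true +-suc′  a b = sym (+-assoc a b 1)
  RCA₀-true ·-zero  a = *-zeroʳ a
  RCA₀-true ·-suc   a b = trans (*-distribˡ-+ a b 1) (cong (a * b +_) (*-identityʳ a))
  RCA₀-true ≺-zero  a ()
  RCA₀-true ≺-suc   a b =
    (λ a<b+1 (a≮b , a≢b) → case m<1+n⇒m<n∨m≡n (subst (a <_) (+-comm b 1) a<b+1) of λ where
      (inj₁ a<b) → a≮b a<b
      (inj₂ a≡b) → a≢b a≡b) ,
    λ h → decidable-stable (_ <? _) λ a≮b+1 → h
      ((λ a<b → a≮b+1 (<-≤-trans a<b (m≤m+n b 1))) , λ { refl → a≮b+1 (≤⇒<+1 ≤-refl) })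
  -- The numbers of the model are standard, so induction is that of the metatheory.
  RCA₀-true (Σ₁-IND {φ = φ} _) = sem-close (φ [ 𝟎 ]₁ ∧ all₁ (φ ⇒ next φ) ⇒ all₁ φ) λ ρ δ (base , step) →
    inductionStep ρ δ base step
    where
    inductionStep : ∀ ρ δ → ⟦ φ [ 𝟎 ]₁ ⟧ ρ δ → ⟦ all₁ (φ ⇒ next φ) ⟧ ρ δ → ⟦ all₁ φ ⟧ ρ δ
    inductionStep ρ δ base step zero    = proj₁ (sem-[]₁ φ 𝟎 ρ δ) base
    inductionStep ρ δ base step (suc z) = subst (λ k → ⟦ φ ⟧ (k ∷ ρ) δ) (+-comm z 1)
      (proj₁ (substitution φ {ρ = z + 1 ∷ ρ} (λ { zero → refl ; (suc i) → refl }) (λ _ → refl))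
        (step z (inductionStep ρ δ base step z)))
  RCA₀-true (Δ₁-CA {φ = ex₁ φ} {ψ = all₁ ψ} (Σ-∃ dφ) (Π-∀ dψ)) =
    sem-close (all₁ (ex₁ φ ⇔ all₁ ψ) ⇒ ∃₂ λ X → ∀₁ λ x → (x ε X) ⇔ wk₂ (ex₁ φ)) λ ρ δ equiv k →
      let open Comprehension dφ dψ ρ δ equiv
          X = real comprehension-decides
      in k X λ x →
        (λ x∈X → proj₂ (sem-wk₂ (ex₁ φ) (x ∷ ρ) δ X)
                   (stable (ex₁ φ) (x ∷ ρ) δ (real⇒ comprehension-decides x x∈X))) ,
        (λ h → ⇒real comprehension-decides x (proj₁ (sem-wk₂ (ex₁ φ) (x ∷ ρ) δ X) h))

-- The formulas about sequences and computations in the model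

-- Translated formulas yield membership only up to double negation; decidability removes it.
inF? : ∀ v c → Dec (InF v c)
inF? v c = map′
  (λ (k , _ , a , _ , b , _ , h) → k , a , b , h)
  (λ { (k , a , b , refl , h) → k , s≤s (≤pairˡ k _) ,
       a , s≤s (≤-trans (≤pairˡ a b) (≤pairʳ k _)) , b , s≤s (≤-trans (≤pairʳ a b) (≤pairʳ k _)) , refl , h })
  (anyUpTo? (λ k → anyUpTo? (λ a → anyUpTo? (λ b →
    (c ≟ pair k (pair a b)) ×-dec (v <? k) ×-dec bit? a b v) (suc c)) (suc c)) (suc c))

∃-elim : ∀ {X : Set} {A : X → Set} {C : Set} → ¬ (∀ z → ¬ A z) → (∀ z → A z → ¬¬ C) → ¬¬ C
∃-elim h f k = h λ z a → f z a k

∃-intro : ∀ {X : Set} {A : X → Set} z → A z → ¬ (∀ z → ¬ A z)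
∃-intro z a k = k z a

∃-intro¬¬ : ∀ {X : Set} {A : X → Set} → ¬¬ ∃ A → ¬ (∀ z → ¬ A z)
∃-intro¬¬ h k = h λ (z , a) → k z a

∨-elim : ∀ {A B C : Set} → ¬ (¬ A × ¬ B) → (A → ¬¬ C) → (B → ¬¬ C) → ¬¬ C
∨-elim h f g k = h ((λ a → f a k) , λ b → g b k)

v₀ : ∀ {n} → Term (1 + n)
v₀ = var zero
v₁ : ∀ {n} → Term (2 + n)
v₁ = var (suc zero)
v₂ : ∀ {n} → Term (3 + n)
v₂ = var (suc (suc zero))
v₃ : ∀ {n} → Term (4 + n)
v₃ = var (suc (suc (suc zero)))
v₄ : ∀ {n} → Term (5 + n)
v₄ = var (suc (suc (suc (suc zero))))
v₅ : ∀ {n} → Term (6 + n)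
v₅ = var (suc (suc (suc (suc (suc zero)))))

module Internal (G : ℕ → Set) where
  open Model G public

  module _ {n m : ℕ} (ρ : Vec ℕ n) (δ : Vec Real m) where
    wk³ : ∀ (t : Term n) x y z → ⟦ t ↑ 3 ⟧ᴺ (z ∷ y ∷ x ∷ ρ) ≡ ⟦ t ⟧ᴺ ρ
    wk³ t x y z = trans (wkTerm-⟦⟧ (t ↑ 2) z _) (trans (wkTerm-⟦⟧ (t ↑ 1) y _) (wkTerm-⟦⟧ t x _))

    wk⁴ : ∀ (t : Term n) w x y z → ⟦ t ↑ 4 ⟧ᴺ (z ∷ y ∷ x ∷ w ∷ ρ) ≡ ⟦ t ⟧ᴺ ρ
    wk⁴ t w x y z = trans (wkTerm-⟦⟧ (t ↑ 3) z _) (wk³ t w x y)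

    opaque
      unfolding pair

      inF⇒ : ∀ i c → ⟦ InFinite i c ⟧ ρ δ → InF (⟦ i ⟧ᴺ ρ) (⟦ c ⟧ᴺ ρ)
      inF⇒ i c h = decidable-stable (inF? _ _) (
        ∃-elim h λ k h → ∃-elim h λ a h → ∃-elim h λ b (eq , i<k , h) → ∃-elim h λ q eq′ →
        return (k , a , b , trans (sym (wk³ c k a b)) eq , subst (_< k) (wk³ i k a b) i<k ,
                q , trans (cong (λ v → (a * (v + 1) + 1) * q) (sym (wk⁴ i k a b q))) eq′))

      ⇒inF : ∀ i c → InF (⟦ i ⟧ᴺ ρ) (⟦ c ⟧ᴺ ρ) → ⟦ InFinite i c ⟧ ρ δ
      ⇒inF i c (k , a , b , eq , i<k , q , eq′) = ∃-intro k (∃-intro a (∃-intro b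
        (trans (wk³ c k a b) eq , subst (_< k) (sym (wk³ i k a b)) i<k ,
         ∃-intro q (trans (cong (λ v → (a * (v + 1) + 1) * q) (wk⁴ i k a b q)) eq′))))

      entry⇒ : ∀ s i a → ⟦ Entry s i a ⟧ ρ δ → InF (pair (⟦ i ⟧ᴺ ρ) (⟦ a ⟧ᴺ ρ)) (⟦ s ⟧ᴺ ρ)
      entry⇒ s i a = inF⇒ ⟨ i , a ⟩ s

      ⇒entry : ∀ s i a → InF (pair (⟦ i ⟧ᴺ ρ) (⟦ a ⟧ᴺ ρ)) (⟦ s ⟧ᴺ ρ) → ⟦ Entry s i a ⟧ ρ δ
      ⇒entry s i a = ⇒inF ⟨ i , a ⟩ s

  module _ {n m : ℕ} (ρ : Vec ℕ n) (δ : Vec Real m) where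
    opaque
      unfolding pair

      seq⇒ : ∀ s → ⟦ Seq v₀ ⟧ (s ∷ ρ) δ → ¬¬ IsSeq s
      seq⇒ s (l , p , f , d) = ∃-elim d λ len d → return (record
        { least   = λ e e<s h → l e e<s λ i →
            (λ q → ⇒inF (i ∷ e ∷ s ∷ ρ) δ v₀ v₂ (proj₁ (h i) (inF⇒ (i ∷ e ∷ s ∷ ρ) δ v₀ v₁ q))) ,
            (λ q → ⇒inF (i ∷ e ∷ s ∷ ρ) δ v₀ v₁ (proj₂ (h i) (inF⇒ (i ∷ e ∷ s ∷ ρ) δ v₀ v₂ q)))
        ; pairs   = λ u q → let
            P? = anyUpTo? (λ i → anyUpTo? (λ a → u ≟ pair i a) (suc u)) (suc u)
            (i , _ , a , _ , eq) = decidable-stable P?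
              (∃-elim (p u (⇒inF (u ∷ s ∷ ρ) δ v₀ v₁ q)) λ i h → ∃-elim h λ a eq →
               return (i , s≤s (subst (i ≤_) (sym eq) (≤pairˡ i a)) , a , s≤s (subst (a ≤_) (sym eq) (≤pairʳ i a)) , eq))
            in i , a , eq
        ; single  = λ i a b q r → f i a b
            (⇒entry (b ∷ a ∷ i ∷ s ∷ ρ) δ v₃ v₂ v₁ q ,
             ⇒entry (b ∷ a ∷ i ∷ s ∷ ρ) δ v₃ v₂ v₀ r)
        ; initial = len , λ i →
            (λ i<l → let (a , _ , q) = decidable-stable (anyUpTo? (λ a → inF? (pair i a) s) s)
                           (∃-elim (proj₁ (d i) i<l) λ a q →
                             let q′ = entry⇒ (a ∷ i ∷ len ∷ s ∷ ρ) δ v₃ v₁ v₀ q in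
                             return (a , ≤-<-trans (≤pairʳ i a) (in<code q′) , q′))
                     in a , q) ,
            λ (a , q) → proj₂ (d i) (∃-intro a (⇒entry (a ∷ i ∷ len ∷ s ∷ ρ) δ v₃ v₁ v₀ q))
        })

      ⇒seq : ∀ s → IsSeq s → ⟦ Seq v₀ ⟧ (s ∷ ρ) δ
      ⇒seq s q =
        (λ e e<s h → least q e e<s λ i →
          (λ q → inF⇒ (i ∷ e ∷ s ∷ ρ) δ v₀ v₂ (proj₁ (h i) (⇒inF (i ∷ e ∷ s ∷ ρ) δ v₀ v₁ q))) ,
          (λ q → inF⇒ (i ∷ e ∷ s ∷ ρ) δ v₀ v₁ (proj₂ (h i) (⇒inF (i ∷ e ∷ s ∷ ρ) δ v₀ v₂ q)))) ,
        (λ u p → let (i , a , eq) = pairs q u (inF⇒ (u ∷ s ∷ ρ) δ v₀ v₁ p) in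
          ∃-intro i (∃-intro a eq)) ,
        (λ i a b (p , r) → single q i a b
          (entry⇒ (b ∷ a ∷ i ∷ s ∷ ρ) δ v₃ v₂ v₁ p)
          (entry⇒ (b ∷ a ∷ i ∷ s ∷ ρ) δ v₃ v₂ v₀ r)) ,
        let (l , d) = initial q in ∃-intro l λ i →
          (λ i<l → let (a , p) = proj₁ (d i) i<l in
            ∃-intro a (⇒entry (a ∷ i ∷ l ∷ s ∷ ρ) δ v₃ v₁ v₀ p)) ,
          λ h → decidable-stable (_ <? _) (∃-elim h λ a p →
            return (proj₂ (d i) (a , entry⇒ (a ∷ i ∷ l ∷ s ∷ ρ) δ v₃ v₁ v₀ p)))

module Computations (G : ℕ → Set) where
  open Internal G public

  Earlierᴺ : (s i e x y : ℕ) → Set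
  Earlierᴺ s i e x y = ∃ λ j → j < i × InF (pair j (triple e x y)) s

  module _ {n m : ℕ} (ρ : Vec ℕ n) (δ : Vec Real m) where
    private
      triple≡ : ∀ {e e′ x x′ y y′} → e ≡ e′ → x ≡ x′ → y ≡ y′ → triple e x y ≡ triple e′ x′ y′
      triple≡ refl refl refl = refl

    opaque
      unfolding pair

      earlier⇒ : ∀ s i e x y → ⟦ Earlier s i e x y ⟧ ρ δ →
                 ¬¬ Earlierᴺ (⟦ s ⟧ᴺ ρ) (⟦ i ⟧ᴺ ρ) (⟦ e ⟧ᴺ ρ) (⟦ x ⟧ᴺ ρ) (⟦ y ⟧ᴺ ρ)
      earlier⇒ s i e x y h = ∃-elim h λ j (j<i , p) →
        return (j , subst (j <_) (wkTerm-⟦⟧ i j ρ) j<i ,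
          subst₂ (λ d c → InF (pair j d) c)
            (triple≡ (wkTerm-⟦⟧ e j ρ) (wkTerm-⟦⟧ x j ρ) (wkTerm-⟦⟧ y j ρ)) (wkTerm-⟦⟧ s j ρ)
            (entry⇒ (j ∷ ρ) δ (s ↑ 1) v₀ ⟨ e ↑ 1 , ⟨ x ↑ 1 , y ↑ 1 ⟩ ⟩ p))

      ⇒earlier : ∀ s i e x y → Earlierᴺ (⟦ s ⟧ᴺ ρ) (⟦ i ⟧ᴺ ρ) (⟦ e ⟧ᴺ ρ) (⟦ x ⟧ᴺ ρ) (⟦ y ⟧ᴺ ρ) →
                 ⟦ Earlier s i e x y ⟧ ρ δ
      ⇒earlier s i e x y (j , j<i , p) = ∃-intro j
        (subst (j <_) (sym (wkTerm-⟦⟧ i j ρ)) j<i ,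
         ⇒entry (j ∷ ρ) δ (s ↑ 1) v₀ ⟨ e ↑ 1 , ⟨ x ↑ 1 , y ↑ 1 ⟩ ⟩
           (subst₂ (λ d c → InF (pair j d) c)
             (sym (triple≡ (wkTerm-⟦⟧ e j ρ) (wkTerm-⟦⟧ x j ρ) (wkTerm-⟦⟧ y j ρ)))
             (sym (wkTerm-⟦⟧ s j ρ)) p))

  module _ {n m : ℕ} (ρ₀ : Vec ℕ n) (δ : Vec Real m) (Y : Fin m) (s i d e x y : ℕ) where
    private
      ρ = y ∷ x ∷ e ∷ d ∷ i ∷ s ∷ ρ₀
      O = mem (lookup δ Y)

    opaque
      unfolding pair

      justified⇒ : ⟦ Justified Y v₅ v₄ v₂ v₁ v₀ ⟧ ρ δ → ¬¬ Step O (¬_ ∘ O) (Earlierᴺ s i) e x y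
      justified⇒ h =
        ∨-elim h (λ eq → return (0 , y , eq , constˢ refl)) λ h →
        ∨-elim h (λ (eq , p) → return (1 , 0 , eq , idˢ refl p)) λ h →
        ∨-elim h (λ (eq , p) → return (2 , 0 , eq , sucˢ refl (trans p (+-comm x 1)))) λ h →
        ∨-elim h (λ (eq , p) → ∃-elim p λ b p → return (3 , 0 , eq , fstˢ {b = b} refl p)) λ h →
        ∨-elim h (λ (eq , p) → ∃-elim p λ b p → return (4 , 0 , eq , sndˢ {b = b} refl p)) λ h →
        ∨-elim h (λ (eq , p) → ∨-elim p
          (λ (q , r) → return (5 , 0 , eq , inˢ refl q r))
          (λ (q , r) → return (5 , 0 , eq , outˢ refl q r))) λ h →
        ∨-elim h (λ p → ∃-elim p λ f p → ∃-elim p λ g (eq , p) → ∃-elim p λ b p → ∃-elim p λ c (p , q , r) → do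
          p ← earlier⇒ (c ∷ b ∷ g ∷ f ∷ ρ) δ (v₅ ↑ 4) (v₄ ↑ 4) v₃ (v₁ ↑ 4) v₁ p
          q ← earlier⇒ (c ∷ b ∷ g ∷ f ∷ ρ) δ (v₅ ↑ 4) (v₄ ↑ 4) v₂ (v₁ ↑ 4) v₀ q
          return (6 , pair f g , eq , pairˢ {f = f} {g} {b} {c} refl p q r)) λ h →
        ∨-elim h (λ p → ∃-elim p λ f p → ∃-elim p λ g (eq , p) → ∃-elim p λ b (p , q) → do
          p ← earlier⇒ (b ∷ g ∷ f ∷ ρ) δ (v₅ ↑ 3) (v₄ ↑ 3) v₁ (v₁ ↑ 3) v₀ p
          q ← earlier⇒ (b ∷ g ∷ f ∷ ρ) δ (v₅ ↑ 3) (v₄ ↑ 3) v₂ v₀ (v₀ ↑ 3) q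
          return (7 , pair f g , eq , compˢ {f = f} {g} {b} refl p q)) λ h →
        ∨-elim h (λ p → ∃-elim p λ f p → ∃-elim p λ g (eq , p) → ∃-elim p λ b p → ∨-elim p
          (λ (q , p) → do
            p ← earlier⇒ (b ∷ g ∷ f ∷ ρ) δ (v₅ ↑ 3) (v₄ ↑ 3) v₂ v₀ (v₀ ↑ 3) p
            return (8 , pair f g , eq , zeroˢ {f = f} {g} {b} refl q p))
          (λ p → ∃-elim p λ c p → ∃-elim p λ k (r , p , q) → do
            p ← earlier⇒ (k ∷ c ∷ b ∷ g ∷ f ∷ ρ) δ (v₅ ↑ 5) (v₄ ↑ 5) (v₂ ↑ 5) ⟨ v₂ , v₁ ⟩ v₀ p
            q ← earlier⇒ (k ∷ c ∷ b ∷ g ∷ f ∷ ρ) δ (v₅ ↑ 5) (v₄ ↑ 5) v₃ ⟨ v₂ , ⟨ v₁ , v₀ ⟩ ⟩ (v₀ ↑ 5) q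
            return (8 , pair f g , eq ,
              recˢ {f = f} {g} {b} {c} {k} refl (trans r (cong (pair b) (+-comm c 1))) (subst (λ e → Earlierᴺ s i e (pair b c) k) eq p) q))) λ h →
        ∃-elim h λ f (eq , p , h) → do
          p ← earlier⇒ (f ∷ ρ) δ (v₅ ↑ 1) (v₄ ↑ 1) v₀ ⟨ v₁ ↑ 1 , v₀ ↑ 1 ⟩ 𝟎 p
          h ← ¬¬-∀< y {Nonzero (Earlierᴺ s i) f x} λ z z<y → ∃-elim (h z z<y) λ w p → do
            j , j<i , p ← earlier⇒ (w ∷ z ∷ f ∷ ρ) δ (v₅ ↑ 3) (v₄ ↑ 3) v₂ ⟨ v₁ ↑ 3 , v₁ ⟩ (v₀ +′ 𝟏) p
            return (nonzero {w = w} (j , j<i , subst (λ w → InF (pair j (triple f (pair x z) w)) s) (+-comm w 1) p))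
          return (9 , f , eq , μˢ p h)

      ⇒justified : Step O (¬_ ∘ O) (Earlierᴺ s i) e x y → ⟦ Justified Y v₅ v₄ v₂ v₁ v₀ ⟧ ρ δ
      ⇒justified (_ , _ , eq , constˢ refl) (k , _) = k eq
      ⇒justified (_ , _ , eq , idˢ refl p) (_ , k) = k λ (k , _) → k (eq , p)
      ⇒justified (_ , _ , eq , sucˢ refl p) (_ , k) = k λ (_ , k) → k λ (k , _) →
        k (eq , trans p (+-comm 1 x))
      ⇒justified (_ , _ , eq , fstˢ {b = b} refl p) (_ , k) = k λ (_ , k) → k λ (_ , k) → k λ (k , _) →
        k (eq , ∃-intro b p)
      ⇒justified (_ , _ , eq , sndˢ {b = b} refl p) (_ , k) = k λ (_ , k) → k λ (_ , k) → k λ (_ , k) → k λ (k , _) →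
        k (eq , ∃-intro b p)
      ⇒justified (_ , _ , eq , inˢ refl p q) (_ , k) = k λ (_ , k) → k λ (_ , k) → k λ (_ , k) → k λ (_ , k) → k λ (k , _) →
        k (eq , λ (k , _) → k (p , q))
      ⇒justified (_ , _ , eq , outˢ refl p q) (_ , k) = k λ (_ , k) → k λ (_ , k) → k λ (_ , k) → k λ (_ , k) → k λ (k , _) →
        k (eq , λ (_ , k) → k (p , q))
      ⇒justified (_ , _ , eq , pairˢ {f = f} {g} {b} {c} refl p q r) (_ , k) =
        k λ (_ , k) → k λ (_ , k) → k λ (_ , k) → k λ (_ , k) → k λ (_ , k) → k λ (k , _) →
        k (∃-intro f (∃-intro g (eq , ∃-intro b (∃-intro c
          (⇒earlier (c ∷ b ∷ g ∷ f ∷ ρ) δ (v₅ ↑ 4) (v₄ ↑ 4) v₃ (v₁ ↑ 4) v₁ p ,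
           ⇒earlier (c ∷ b ∷ g ∷ f ∷ ρ) δ (v₅ ↑ 4) (v₄ ↑ 4) v₂ (v₁ ↑ 4) v₀ q , r)))))
      ⇒justified (_ , _ , eq , compˢ {f = f} {g} {b} refl p q) (_ , k) =
        k λ (_ , k) → k λ (_ , k) → k λ (_ , k) → k λ (_ , k) → k λ (_ , k) → k λ (_ , k) → k λ (k , _) →
        k (∃-intro f (∃-intro g (eq , ∃-intro b
          (⇒earlier (b ∷ g ∷ f ∷ ρ) δ (v₅ ↑ 3) (v₄ ↑ 3) v₁ (v₁ ↑ 3) v₀ p ,
           ⇒earlier (b ∷ g ∷ f ∷ ρ) δ (v₅ ↑ 3) (v₄ ↑ 3) v₂ v₀ (v₀ ↑ 3) q))))
      ⇒justified (_ , _ , eq , zeroˢ {f = f} {g} {b} refl r p) (_ , k) =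
        k λ (_ , k) → k λ (_ , k) → k λ (_ , k) → k λ (_ , k) → k λ (_ , k) → k λ (_ , k) → k λ (_ , k) → k λ (k , _) →
        k (∃-intro f (∃-intro g (eq , ∃-intro b λ (k , _) →
          k (r , ⇒earlier (b ∷ g ∷ f ∷ ρ) δ (v₅ ↑ 3) (v₄ ↑ 3) v₂ v₀ (v₀ ↑ 3) p))))
      ⇒justified (_ , _ , eq , recˢ {f = f} {g} {b} {c} {h} refl r p q) (_ , k) =
        k λ (_ , k) → k λ (_ , k) → k λ (_ , k) → k λ (_ , k) → k λ (_ , k) → k λ (_ , k) → k λ (_ , k) → k λ (k , _) →
        k (∃-intro f (∃-intro g (eq , ∃-intro b λ (_ , k) → k (∃-intro c (∃-intro h
          (trans r (cong (pair b) (+-comm 1 c)) ,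
           ⇒earlier (h ∷ c ∷ b ∷ g ∷ f ∷ ρ) δ (v₅ ↑ 5) (v₄ ↑ 5) (v₂ ↑ 5) ⟨ v₂ , v₁ ⟩ v₀
             (subst (λ e → Earlierᴺ s i e (pair b c) h) (sym eq) p) ,
           ⇒earlier (h ∷ c ∷ b ∷ g ∷ f ∷ ρ) δ (v₅ ↑ 5) (v₄ ↑ 5) v₃ ⟨ v₂ , ⟨ v₁ , v₀ ⟩ ⟩ (v₀ ↑ 5) q))))))
      ⇒justified (_ , f , eq , μˢ p h) (_ , k) =
        k λ (_ , k) → k λ (_ , k) → k λ (_ , k) → k λ (_ , k) → k λ (_ , k) → k λ (_ , k) → k λ (_ , k) → k λ (_ , k) →
        k (∃-intro f (eq , ⇒earlier (f ∷ ρ) δ (v₅ ↑ 1) (v₄ ↑ 1) v₀ ⟨ v₁ ↑ 1 , v₀ ↑ 1 ⟩ 𝟎 p ,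
          λ z z<y → case h z z<y of λ where
            (nonzero {w} (j , j<i , p)) → ∃-intro w
              (⇒earlier (w ∷ z ∷ f ∷ ρ) δ (v₅ ↑ 3) (v₄ ↑ 3) v₂ ⟨ v₁ ↑ 3 , v₁ ⟩ (v₀ +′ 𝟏)
                (j , j<i , subst (λ w → InF (pair j (triple f (pair x z) w)) s) (+-comm 1 w) p))))

  module _ {n m : ℕ} (ρ : Vec ℕ n) (δ : Vec Real m) (Y : Fin m) (e x : ℕ) where
    private
      O = mem (lookup δ Y)
    opaque
      unfolding pair

      computes⇒ : ∀ y t → ⟦ t ⟧ᴺ (x ∷ e ∷ ρ) ≡ y → ⟦ Computes Y v₁ v₀ t ⟧ (x ∷ e ∷ ρ) δ → ¬¬ Eval O (¬_ ∘ O) e x y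
      computes⇒ y t refl h = ∃-elim h λ s (_ , just , r) → ∃-elim r λ i p →
        steps-sound (λ i d → InF (pair i d) s)
          (λ {i} {d} ent → ∃-elim (just i d (⇒entry (d ∷ i ∷ s ∷ x ∷ e ∷ ρ) δ v₂ v₁ v₀ ent)) λ e′ h →
             ∃-elim h λ x′ h → ∃-elim h λ y′ (eq , h) →
             justified⇒ (x ∷ e ∷ ρ) δ Y s i d e′ x′ y′ h >>= λ st → return (e′ , x′ , y′ , eq , st))
          i (subst (λ w → InF (pair i (triple e x w)) s)
              (trans (wkTerm-⟦⟧ (t ↑ 1) i (s ∷ x ∷ e ∷ ρ)) (wkTerm-⟦⟧ t s (x ∷ e ∷ ρ)))
              (entry⇒ (i ∷ s ∷ x ∷ e ∷ ρ) δ v₁ v₀ ⟨ v₁ ↑ 2 , ⟨ v₀ ↑ 2 , t ↑ 2 ⟩ ⟩ p))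

      ⇒computes : ∀ y t → ⟦ t ⟧ᴺ (x ∷ e ∷ ρ) ≡ y → ¬¬ Eval O (¬_ ∘ O) e x y → ⟦ Computes Y v₁ v₀ t ⟧ (x ∷ e ∷ ρ) δ
      ⇒computes y t refl ev = ∃-intro¬¬ (ev >>= λ ev → let (L , ss , d∈L) = steps-complete ev in
        fromList L >>= λ (s , seq , same) → return (s ,
          ⇒seq (x ∷ e ∷ ρ) δ s seq ,
          (λ i d ent → let
             (e′ , x′ , y′ , eq , st) = steps-graph ss (proj₁ (same _) (entry⇒ (d ∷ i ∷ s ∷ x ∷ e ∷ ρ) δ v₂ v₁ v₀ ent))
             in ∃-intro e′ (∃-intro x′ (∃-intro y′ (eq ,
               ⇒justified (x ∷ e ∷ ρ) δ Y s i d e′ x′ y′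
                 (mapᵗ (λ (j , j<i , q) → j , j<i , proj₂ (same _) q) st))))) ,
          let (i , _ , q) = graph-∈ d∈L in
          ∃-intro i (⇒entry (i ∷ s ∷ x ∷ e ∷ ρ) δ v₁ v₀ ⟨ v₁ ↑ 2 , ⟨ v₀ ↑ 2 , t ↑ 2 ⟩ ⟩
            (subst (λ w → InF (pair i (triple e x w)) s)
              (sym (trans (wkTerm-⟦⟧ (t ↑ 1) i (s ∷ x ∷ e ∷ ρ)) (wkTerm-⟦⟧ t s (x ∷ e ∷ ρ))))
              (proj₂ (same _) q)))))

  Reduces : ℕ → (ℕ → Set) → (ℕ → Set) → Set
  Reduces e X Y = ∀ x → Computability.Decides Y (¬_ ∘ Y) e x (X x)

  module _ {n m : ℕ} (ρ : Vec ℕ n) (δ : Vec Real m) (X Y : Fin m) where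
    ≤T⇒ : ⟦ X ≤T Y ⟧ ρ δ → ¬¬ ∃ λ e → Reduces e (mem (lookup δ X)) (mem (lookup δ Y))
    ≤T⇒ h = ∃-elim h λ e h → return (e , λ x →
      (λ p → computes⇒ ρ δ Y e x 1 𝟏 refl (proj₁ (h x) p)) ,
      (λ ¬p → computes⇒ ρ δ Y e x 0 𝟎 refl (proj₂ (h x) ¬p)))

    ⇒≤T : ∀ e → Reduces e (mem (lookup δ X)) (mem (lookup δ Y)) → ⟦ X ≤T Y ⟧ ρ δ
    ⇒≤T e h = ∃-intro e λ x →
      (λ p → ⇒computes ρ δ Y e x 1 𝟏 refl (proj₁ (h x) p)) ,
      (λ ¬p → ⇒computes ρ δ Y e x 0 𝟎 refl (proj₂ (h x) ¬p))

-- Generic sets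

-- Numbers serve as forcing conditions: q forces v ∈ G if InF v q and
-- v ∉ G if OutF v q.  The numbers decided by q form an initial segment.
infix 4 _≼_
record _≼_ (r q : ℕ) : Set where
  constructor _,≼_
  field
    in≼  : ∀ {v} → InF v q → InF v r
    out≼ : ∀ {v} → OutF v q → OutF v r
open _≼_ public

≼-refl : ∀ {q} → q ≼ q
≼-refl = id ,≼ id

≼-trans : ∀ {s r q} → s ≼ r → r ≼ q → s ≼ q
≼-trans h k = (in≼ h ∘ in≼ k) ,≼ (out≼ h ∘ out≼ k)

infix 4 _⊏_
record _⊏_ (q : ℕ) (X : ℕ → Set) : Set where
  constructor _,⊏_
  field
    in⊏  : ∀ {v} → InF v q → X v
    out⊏ : ∀ {v} → OutF v q → ¬ X v
open _⊏_ public

string-⊏ : ∀ {L X} (c : String L X) → str c ⊏ X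
string-⊏ c = (proj₂ ∘ in⇒ c) ,⊏ (proj₂ ∘ out⇒ c)

string-≼ : ∀ {L X q} → q ⊏ X → q ≤ L → (c : String L X) → str c ≼ q
string-≼ q⊏X q≤L c =
  (λ p → ⇒in c (<-≤-trans (in<code p) q≤L) (in⊏ q⊏X p)) ,≼
  (λ p → ⇒out c (<-≤-trans (out<code p) q≤L) (out⊏ q⊏X p))

string-decides : ∀ {L X} (c : String L X) v → v < L → InF v (str c) ⊎ OutF v (str c)
string-decides c v v<L with inF? v (str c)
... | yes p = inj₁ p
... | no ¬p = inj₂ (⇒out c v<L λ x → ¬p (⇒in c v<L x))

¬in-0 : ∀ {v} → ¬ InF v 0
¬in-0 p with () ← in<code p

¬out-0 : ∀ {v} → ¬ OutF v 0
¬out-0 p with () ← out<code p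

module Generic (𝒟 : ℕ → ℕ → Set) where

  -- The condition reached after i requirements. It is a relation, since the existence of an
  -- extension in `𝒟 i` cannot be decided; taking the least one makes it single-valued.
  data Stage : ℕ → ℕ → Set where
    start : Stage 0 0
    meet  : ∀ {i q r} → Stage i q → r ≼ q → 𝒟 i r → (∀ s → s < r → ¬ (s ≼ q × 𝒟 i s)) → Stage (suc i) r
    miss  : ∀ {i q} → Stage i q → (∀ r → r ≼ q → ¬ 𝒟 i r) → Stage (suc i) q

  stage-unique : ∀ {i q r} → Stage i q → Stage i r → q ≡ r
  stage-unique start start = refl
  stage-unique (meet {r = q} s h d m) (meet {r = r} s′ h′ d′ m′) with stage-unique s s′ | <-cmp q r
  ... | refl | tri< l _ _ = ⊥-elim (m′ q l (h , d))
  ... | refl | tri≈ _ e _ = e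
  ... | refl | tri> _ _ g = ⊥-elim (m r g (h′ , d′))
  stage-unique (meet s h d _) (miss s′ n) with stage-unique s s′
  ... | refl = ⊥-elim (n _ h d)
  stage-unique (miss s n) (meet s′ h d _) with stage-unique s s′
  ... | refl = ⊥-elim (n _ h d)
  stage-unique (miss s _) (miss s′ _) = stage-unique s s′

  stage-pred : ∀ {i r} → Stage (suc i) r → ∃ λ q → Stage i q × r ≼ q
  stage-pred (meet s h _ _) = _ , s , h
  stage-pred (miss s _)     = _ , s , ≼-refl

  stage-≼ : ∀ i j {q r} → Stage i q → Stage (j + i) r → r ≼ q
  stage-≼ i zero    s s′ with stage-unique s s′
  ... | refl = ≼-refl
  stage-≼ i (suc j) s s′ with stage-pred s′
  ... | _ , s″ , h = ≼-trans h (stage-≼ i j s s″)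

  stage-exists : ∀ i → ¬¬ ∃ (Stage i)
  stage-exists zero    = return (0 , start)
  stage-exists (suc i) = do
    q , s ← stage-exists i
    yes (r , h , d) ← em (∃ λ r → r ≼ q × 𝒟 i r)
      where no n → return (q , miss s λ r h d → n (r , h , d))
    r , (h , d) , m ← ¬¬-least {λ r → r ≼ q × 𝒟 i r} r (h , d)
    return (r , meet s h d m)

  G : ℕ → Set
  G v = ∃ λ i → ∃ λ q → Stage i q × InF v q

  stage-⊏ : ∀ {i q} → Stage i q → q ⊏ G
  stage-⊏ {i} {q} s = (λ p → i , q , s , p) ,⊏ λ { p (j , r , s′ , p′) → clash p s′ p′ }
    where
    clash : ∀ {v j r} → OutF v q → Stage j r → ¬ InF v r
    clash {v} {j} {r} p s′ p′ with ≤-total i j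
    ... | inj₁ i≤j = in-out p′ (out≼ (stage-≼ i (j ∸ i) s (subst (λ j → Stage j r) (sym (m∸n+n≡m i≤j)) s′)) p)
    ... | inj₂ j≤i = in-out (in≼ (stage-≼ j (i ∸ j) s′ (subst (λ i → Stage i q) (sym (m∸n+n≡m j≤i)) s)) p′) p

  generic : ∀ i → ¬¬ ∃ λ q → q ⊏ G × (𝒟 i q ⊎ (∀ r → r ≼ q → ¬ 𝒟 i r))
  generic i = stage-exists (suc i) >>= λ where
    (q , s@(meet _ _ d _)) → return (q , stage-⊏ s , inj₁ d)
    (q , s@(miss _ n))     → return (q , stage-⊏ s , inj₂ n)

-- The dense sets

-- F is computed by d from the columns below m, T by t from the columns
-- below n, and e reduces the columns below n′ to F.
record Par : Set where
  constructor par
  field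
    d e t n n′ m : ℕ

parCode : Par → ℕ
parCode (par d e t n n′ m) = pair d (pair e (pair t (pair n (pair n′ m))))

parCode-inj : ∀ {π π′} → parCode π ≡ parCode π′ → π ≡ π′
parCode-inj eq with pair-inj eq
... | refl , eq with pair-inj eq
... | refl , eq with pair-inj eq
... | refl , eq with pair-inj eq
... | refl , eq with pair-inj eq
... | refl , refl = refl

-- The columns below `m` as an oracle, as far as condition `r` decides it: decided numbers in other
-- columns are answered by 0.
Inᶜ Outᶜ : ℕ → ℕ → ℕ → Set
Inᶜ  m r v = InF v r × Col m v
Outᶜ m r v = OutF v r ⊎ (InF v r × ¬ Col m v)

Evalᶜ : ℕ → ℕ → ℕ → ℕ → ℕ → Set
Evalᶜ m r = Eval (Inᶜ m r) (Outᶜ m r)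

Evalˢ : ℕ → ℕ → ℕ → ℕ → Set
Evalˢ w = Eval (λ v → InF v w) (λ v → OutF v w)

evalᶜ-≼ : ∀ {m r q e x y} → r ≼ q → Evalᶜ m q e x y → Evalᶜ m r e x y
evalᶜ-≼ h = monotone (λ (p , c) → in≼ h p , c) λ { (inj₁ p) → inj₁ (out≼ h p) ; (inj₂ (p , c)) → inj₂ (in≼ h p , c) }

module Family (π : Par) where
  open Par π

  Approx : ℕ → ℕ → Set
  Approx w r = ∀ v → (InF v w → Evalᶜ m r d v 1) × (OutF v w → Evalᶜ m r d v 0)

  -- `r` forces a piece `w` of F that settles l bits, gives l values and lets `e` halt on l inputs.
  -- That these answers are right is left to `Ok`.
  record Good (l r w : ℕ) : Set where
    field
      approx  : Approx w r
      decided : ∀ v → v < l → InF v w ⊎ OutF v w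
      defined : ∀ i → i < l → ∃ λ a → InF (pair i a) w
      reduces : ∀ v → v < l → ∃ λ b → Evalˢ w e v b

  -- What must hold of an approximation if F is a path through T from which `e` recovers the columns
  -- below `n′`. Membership in T appears only as the absence of a rejection seen by `q`.
  record Ok (q w : ℕ) : Set where
    field
      pairsᵒ  : ∀ {v} → InF v w → ∃ λ i → ∃ λ a → v ≡ pair i a
      singleᵒ : ∀ {i a b} → InF (pair i a) w → InF (pair i b) w → a ≡ b
      treeᵒ   : ∀ s → IsSeq s → (∀ u → InF u s → InF u w) → ¬ Evalᶜ n q t s 0
      reduceᵒ : ∀ {v b} → Col n′ v → Evalˢ w e v b → (InF v q → b ≡ 1) × (OutF v q → b ≡ 0)

  -- By `good-generic` and `ok-generic` no initial segment of G lies in either set when F is as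
  -- described, so genericity gives initial segments without extensions in them.
  Diverges Bad : ℕ → Set
  Diverges q = ∃ λ l → ∀ r → r ≼ q → ∀ w → ¬ Good l r w
  Bad q = ∃ λ w → Approx w q × ¬ Ok q w

  -- If G meets this set, then q₀ has a good extension that agrees with G on
  -- the columns below n.
  Projection : (q₀ l q : ℕ) → Set
  Projection q₀ l q = ∃ λ r → r ≼ q₀ × (∀ v → Col n v → (InF v r → InF v q) × (OutF v r → OutF v q)) ×
                      ∃ (Good l r)

open Family
open Good public
open Ok public

-- The index carries a tag and all parameters, so one G serves every choice of programs.
data 𝒟 (i q : ℕ) : Set where
  diverges   : ∀ π → i ≡ pair 0 (parCode π) → Diverges π q → 𝒟 i q
  bad        : ∀ π → i ≡ pair 1 (parCode π) → Bad π q → 𝒟 i q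
  projection : ∀ π q₀ l → i ≡ pair 2 (pair (parCode π) (pair q₀ l)) → Projection π q₀ l q → 𝒟 i q

open Generic 𝒟 using (G; generic) public

module _ (π : Par) where
  private
    Generically : (ℕ → Set) → Set
    Generically A = ¬¬ ∃ λ q → q ⊏ G × (A q ⊎ (∀ r → r ≼ q → ¬ A r))

    invert : ∀ {A : ℕ → Set} i → (∀ {q} → 𝒟 i q → A q) → (∀ {q} → A q → 𝒟 i q) → Generically A
    invert i f g = generic i >>= λ where
      (q , h , inj₁ d) → return (q , h , inj₁ (f d))
      (q , h , inj₂ n) → return (q , h , inj₂ λ r r≼q a → n r r≼q (g a))

    tag≢ : ∀ {i j a b} {A : Set} → i ≢ j → pair i a ≡ pair j b → A
    tag≢ i≢j eq = ⊥-elim (i≢j (proj₁ (pair-inj eq)))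

  diverges-generic : Generically (Diverges π)
  diverges-generic = invert _ inv (diverges π refl)
    where
    inv : ∀ {q} → 𝒟 (pair 0 (parCode π)) q → Diverges π q
    inv (diverges π′ eq h) with parCode-inj {π} {π′} (proj₂ (pair-inj eq))
    ... | refl = h
    inv (bad _ eq _) = tag≢ (λ ()) eq
    inv (projection _ _ _ eq _) = tag≢ (λ ()) eq

  bad-generic : Generically (Bad π)
  bad-generic = invert _ inv (bad π refl)
    where
    inv : ∀ {q} → 𝒟 (pair 1 (parCode π)) q → Bad π q
    inv (bad π′ eq h) with parCode-inj {π} {π′} (proj₂ (pair-inj eq))
    ... | refl = h
    inv (diverges _ eq _) = tag≢ (λ ()) eq
    inv (projection _ _ _ eq _) = tag≢ (λ ()) eq

  projection-generic : ∀ q₀ l → Generically (Projection π q₀ l)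
  projection-generic q₀ l = invert _ inv (projection π q₀ l refl)
    where
    inv : ∀ {q} → 𝒟 (pair 2 (pair (parCode π) (pair q₀ l))) q → Projection π q₀ l q
    inv (projection π′ q₁ l₁ eq h) with pair-inj (proj₂ (pair-inj eq))
    ... | eq₁ , eq₂ with parCode-inj {π} {π′} eq₁ | pair-inj eq₂
    ... | refl | refl , refl = h
    inv (diverges _ eq _) = tag≢ (λ ()) eq
    inv (bad _ eq _) = tag≢ (λ ()) eq

-- What genericity gives for a path in the model

open Computations G
open Family

contradictory : ∀ {X : ℕ → Set} {e x} {A : Set} → Eval X (¬_ ∘ X) e x 0 → Eval X (¬_ ∘ X) e x 1 → A
contradictory ev ev′ = case functional (λ p ¬p → ¬p p) (λ ¬p p → ¬p p) ev ev′ of λ ()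

evalᶜ⇒ : ∀ {m q e x y} → q ⊏ G → Evalᶜ m q e x y → At.Ev m e x y
evalᶜ⇒ h = monotone (λ (p , c) → c , in⊏ h p)
  λ { (inj₁ p) (_ , g) → out⊏ h p g ; (inj₂ (_ , ¬c)) (c , _) → ¬c c }

⇒evalᶜ : ∀ {m e x y L} (ev : At.Ev m e x y) → use ev ≤ L → (c : String L G) → Evalᶜ m (str c) e x y
⇒evalᶜ {m} ev u≤L c = transfer ev λ v v<u →
  (λ (col , g) → ⇒in c (<-≤-trans v<u u≤L) g , col) ,
  λ ¬g → case string-decides c v (<-≤-trans v<u u≤L) of λ where
    (inj₁ i) → inj₂ (i , λ col → ¬g (col , in⊏ (string-⊏ c) i))
    (inj₂ o) → inj₁ o

record Situation (π : Par) (T F : ℕ → Set) : Set where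
  open Par π
  field
    F-decided : ∀ v → At.Decides m d v (F v)
    T-decided : ∀ s → At.Decides n t s (T s)
    F-stable  : ∀ {v} → ¬¬ F v → F v
    T-stable  : ∀ {s} → ¬¬ T s → T s
    F-pairs   : ∀ {v} → F v → ∃ λ i → ∃ λ a → v ≡ pair i a
    F-total   : ∀ i → ¬¬ ∃ λ a → F (pair i a)
    F-single  : ∀ {i a b} → F (pair i a) → F (pair i b) → a ≡ b
    F-path    : ∀ {s} → IsSeq s → (∀ u → InF u s → F u) → T s
    reduction : Reduces e (Gₙ n′) F

module Forcing {π : Par} {T F : ℕ → Set} (sit : Situation π T F) where
  open Par π
  open Situation sit

  approx-⊏ : ∀ {q w} → q ⊏ G → Approx π w q → w ⊏ F
  approx-⊏ h ap =
    (λ {v} p → F-stable λ ¬f → run (proj₂ (F-decided v) ¬f >>= λ ev →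
       return (contradictory ev (evalᶜ⇒ h (proj₁ (ap v) p))))) ,⊏
    (λ {v} p f → run (proj₁ (F-decided v) f >>= λ ev →
       return (contradictory (evalᶜ⇒ h (proj₂ (ap v) p)) ev)))

  ok-generic : ∀ {q w} → q ⊏ G → Approx π w q → Ok π q w
  ok-generic {q} {w} h ap = record
    { pairsᵒ  = F-pairs ∘ in⊏ w⊏F
    ; singleᵒ = λ p p′ → F-single (in⊏ w⊏F p) (in⊏ w⊏F p′)
    ; treeᵒ   = λ s seq s⊆w ev → run (proj₁ (T-decided s) (F-path seq (λ u → in⊏ w⊏F ∘ s⊆w u)) >>= λ ev′ →
                  return (contradictory (evalᶜ⇒ h ev) ev′))
    ; reduceᵒ = λ {v} {b} c ev →
        (λ p → decidable-stable (b ≟ 1) (proj₁ (reduction v) (c , in⊏ h p) >>= λ ev′ →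
           return (functional (λ p ¬p → ¬p p) (λ ¬p p → ¬p p) (lift ev) ev′))) ,
        (λ p → decidable-stable (b ≟ 0) (proj₂ (reduction v) (λ (_ , g) → out⊏ h p g) >>= λ ev′ →
           return (functional (λ p ¬p → ¬p p) (λ ¬p p → ¬p p) (lift ev) ev′)))
    }
    where
    w⊏F = approx-⊏ h ap
    lift : ∀ {x y} → Evalˢ w e x y → Eval F (¬_ ∘ F) e x y
    lift = monotone (in⊏ w⊏F) (out⊏ w⊏F)

  good-generic : ∀ l {q} → q ⊏ G → ¬¬ ∃ λ r → r ≼ q × ∃ (Good π l r)
  good-generic l {q} h = do
    L₁ , red ← ¬¬-bound l {λ v b → ∃ λ y → Σ (Eval F (¬_ ∘ F) e v y) λ ev → use ev ≤ b}
      (λ { v b≤c (y , ev , u≤b) → y , ev , ≤-trans u≤b b≤c })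
      λ v _ → em (Gₙ n′ v) >>= λ where
        (yes g) → proj₁ (reduction v) g >>= λ ev → return (use ev , 1 , ev , ≤-refl)
        (no ¬g) → proj₂ (reduction v) ¬g >>= λ ev → return (use ev , 0 , ev , ≤-refl)
    L₂ , tot ← ¬¬-bound l {λ i b → ∃ λ a → F (pair i a) × pair i a < b}
      (λ { i b≤c (a , f , u<b) → a , f , <-≤-trans u<b b≤c })
      λ i _ → F-total i >>= λ (a , f) → return (suc (pair i a) , a , f , ≤-refl)
    let Lw = l ⊔ (L₁ ⊔ L₂)
        L₁≤ = ≤-trans (m≤m⊔n L₁ L₂) (m≤n⊔m l (L₁ ⊔ L₂))
        L₂≤ = ≤-trans (m≤n⊔m L₁ L₂) (m≤n⊔m l (L₁ ⊔ L₂))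
    w ← ¬¬-string Lw F
    L₃ , app ← ¬¬-bound Lw
      {λ v b → (F v × Σ (At.Ev m d v 1) λ ev → use ev ≤ b) ⊎ (¬ F v × Σ (At.Ev m d v 0) λ ev → use ev ≤ b)}
      (λ { v b≤c (inj₁ (f , ev , u≤b)) → inj₁ (f , ev , ≤-trans u≤b b≤c)
         ; v b≤c (inj₂ (f , ev , u≤b)) → inj₂ (f , ev , ≤-trans u≤b b≤c) })
      λ v _ → em (F v) >>= λ where
        (yes f) → proj₁ (F-decided v) f >>= λ ev → return (use ev , inj₁ (f , ev , ≤-refl))
        (no ¬f) → proj₂ (F-decided v) ¬f >>= λ ev → return (use ev , inj₂ (¬f , ev , ≤-refl))
    r ← ¬¬-string (q ⊔ L₃) G
    return (str r , string-≼ h (m≤m⊔n q L₃) r , str w , record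
      { approx  = λ v →
          (λ p → let (v<L , f) = in⇒ w p in case app v v<L of λ where
            (inj₁ (_ , ev , u≤)) → ⇒evalᶜ ev (≤-trans u≤ (m≤n⊔m q L₃)) r
            (inj₂ (¬f , _)) → ⊥-elim (¬f f)) ,
          (λ p → let (v<L , ¬f) = out⇒ w p in case app v v<L of λ where
            (inj₁ (f , _)) → ⊥-elim (¬f f)
            (inj₂ (_ , ev , u≤)) → ⇒evalᶜ ev (≤-trans u≤ (m≤n⊔m q L₃)) r)
      ; decided = λ v v<l → string-decides w v (<-≤-trans v<l (m≤m⊔n l _))
      ; defined = λ i i<l → let (a , f , u<) = tot i i<l in a , ⇒in w (<-≤-trans u< L₂≤) f
      ; reduces = λ v v<l → let (y , ev , u≤) = red v v<l in y , transfer ev λ x x<u →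
          let x<L = <-≤-trans x<u (≤-trans u≤ L₁≤) in ⇒in w x<L , ⇒out w x<L
      })

  Consistent : ℕ → Set
  Consistent q = ∀ v → Col n v → (InF v q → G v) × (OutF v q → ¬ G v)

  Forced : ℕ → ℕ → ℕ → Set
  Forced b u r = (b ≡ 1 → InF u r) × (b ≢ 1 → OutF u r)

  forced-≼ : ∀ {b u r q} → r ≼ q → Forced b u q → Forced b u r
  forced-≼ h (f , g) = in≼ h ∘ f , out≼ h ∘ g

  approx-≼ : ∀ {r q w} → r ≼ q → Approx π w q → Approx π w r
  approx-≼ r≼q ap v = evalᶜ-≼ r≼q ∘ proj₁ (ap v) , evalᶜ-≼ r≼q ∘ proj₂ (ap v)

  -- Both strings consist of values of `d` below `r′`, and `d` is single-valued there.
  coherent : ∀ {w w′ r r′} → r′ ≼ r → Approx π w r → Approx π w′ r′ →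
             (∀ v → v < w → InF v w′ ⊎ OutF v w′) → w′ ≼ w
  coherent {w} {w′} {r} {r′} r′≼r ap ap′ dec =
    (λ {v} p → case dec v (in<code p) of λ where
       (inj₁ i) → i
       (inj₂ o) → case clash (proj₁ (approx-≼ r′≼r ap v) p) (proj₂ (ap′ v) o) of λ ()) ,≼
    (λ {v} p → case dec v (out<code p) of λ where
       (inj₁ i) → case clash (proj₁ (ap′ v) i) (proj₂ (approx-≼ r′≼r ap v) p) of λ ()
       (inj₂ o) → o)
    where
    clash : ∀ {v y y′} → Evalᶜ m r′ d v y → Evalᶜ m r′ d v y′ → y ≡ y′
    clash = functional
      (λ { (p , c) (inj₁ o) → in-out p o ; (_ , c) (inj₂ (_ , ¬c)) → ¬c c })
      (λ { (inj₁ o) (p , _) → in-out p o ; (inj₂ (_ , ¬c)) (_ , c) → ¬c c })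

  record Root (p : ℕ) : Set where
    field
      generic-⊏ : p ⊏ G
      converges : ∀ {q} → q ≼ p → ¬ Diverges π q
      not-bad   : ∀ {q} → q ≼ p → ¬ Bad π q

  root : ¬¬ ∃ Root
  root = do
    p₁ , h₁ , c₁ ← diverges-generic π
    p₂ , h₂ , c₂ ← bad-generic π
    p ← ¬¬-string (p₁ ⊔ p₂) G
    return (str p , record
      { generic-⊏ = string-⊏ p
      ; converges = λ q≼p → case c₁ of λ where
          (inj₁ (l , n)) → λ _ → run (good-generic l h₁ >>= λ (r , r≼ , w , g) → return (n r r≼ w g))
          (inj₂ n) → n _ (≼-trans q≼p (string-≼ h₁ (m≤m⊔n p₁ p₂) p))
      ; not-bad = λ q≼p → case c₂ of λ where
          (inj₁ (w , ap , ¬ok)) → λ _ → ¬ok (ok-generic h₂ ap)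
          (inj₂ n) → n _ (≼-trans q≼p (string-≼ h₂ (m≤n⊔m p₁ p₂) p))
      })

  -- Extensions below the root that agree with G in the first columns

  module Below {p : ℕ} (rt : Root p) where
    open Root rt

    root-consistent : Consistent p
    root-consistent v _ = in⊏ generic-⊏ , out⊏ generic-⊏

    -- q, made to agree with G on the columns below n.
    Mixed : ℕ → ℕ → Set
    Mixed q v = (Col n v × G v) ⊎ (¬ Col n v × InF v q)

    mixed-≼ : ∀ {q L} → Consistent q → q ≤ L → (c : String L (Mixed q)) → str c ≼ q
    mixed-≼ {q} A q≤L c =
      (λ {v} p → ⇒in c (<-≤-trans (in<code p) q≤L) (case col? n v of λ where
        (yes col) → inj₁ (col , proj₁ (A v col) p)
        (no ¬col) → inj₂ (¬col , p))) ,≼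
      (λ {v} p → ⇒out c (<-≤-trans (out<code p) q≤L) λ where
        (inj₁ (col , g)) → proj₂ (A v col) p g
        (inj₂ (_ , p′))  → in-out p′ p)

    -- If G meets the projection of the good extensions of `q`, one of these agrees with G.
    -- Otherwise some segment `p′` of G has no extension in the projection. But `q` mixed with G has
    -- a good extension `r`, and `r` below column n, joined to `p′` elsewhere, extends `p′` and lies
    -- in the projection.
    dense : ∀ {q} l → q ≼ p → Consistent q → ¬¬ ∃ λ r → r ≼ q × Consistent r × ∃ (Good π l r)
    dense {q} l q≼p A = projection-generic π q l >>= λ where
      (p′ , p′⊏G , inj₁ (r , r≼q , agree , w , g)) → return
        (r , r≼q , (λ v col → in⊏ p′⊏G ∘ proj₁ (agree v col) , out⊏ p′⊏G ∘ proj₂ (agree v col)) , w , g)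
      (p′ , p′⊏G , inj₂ none) → do
        c ← ¬¬-string (q ⊔ p′) (Mixed q)
        r , r≼c , w , g ← λ k → converges (≼-trans (mixed-≼ A (m≤m⊔n q p′) c) q≼p)
                                  (l , λ r r≼ w g → k (r , r≼ , w , g))
        -- Columns below n come from `r`, the others from `p′`. This extends `p′`, because `r`
        -- follows G on these columns up to `p′`.
        let c′ = string (r ⊔ p′) {λ v → (Col n v × InF v r) ⊎ (¬ Col n v × InF v p′)} λ v _ →
                   (col? n v ×-dec inF? v r) ⊎-dec (¬? (col? n v) ×-dec inF? v p′)
            r< = λ {v} (v<r : v < r) → <-≤-trans v<r (m≤m⊔n r p′)
            p′< = λ {v} (v<p′ : v < p′) → <-≤-trans v<p′ (m≤n⊔m r p′)
            q< = λ {v} (v<p′ : v < p′) → <-≤-trans v<p′ (m≤n⊔m q p′)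
        ⊥-elim (none (str c′)
          ((λ {v} p → ⇒in c′ (p′< (in<code p)) (case col? n v of λ where
             (yes col) → inj₁ (col , in≼ r≼c (⇒in c (q< (in<code p)) (inj₁ (col , in⊏ p′⊏G p))))
             (no ¬col) → inj₂ (¬col , p))) ,≼
           (λ {v} p → ⇒out c′ (p′< (out<code p)) λ where
             (inj₁ (col , i)) → in-out i (out≼ r≼c (⇒out c (q< (out<code p)) λ where
               (inj₁ (_ , g)) → out⊏ p′⊏G p g
               (inj₂ (¬col , _)) → ¬col col))
             (inj₂ (_ , i)) → in-out i p))
          (r , ≼-trans r≼c (mixed-≼ A (m≤m⊔n q p′) c) ,
           (λ v col → (λ p → ⇒in c′ (r< (in<code p)) (inj₁ (col , p))) ,
                      (λ p → ⇒out c′ (r< (out<code p)) λ where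
                        (inj₁ (_ , i)) → in-out i p
                        (inj₂ (¬col , _)) → ¬col col)) ,
           w , g))

    ok-below : ∀ {q w} → q ≼ p → Approx π w q → ¬¬ Ok π q w
    ok-below q≼p ap ¬ok = not-bad q≼p (_ , ap , ¬ok)

    -- A rejection of `s` by `t` would use a finite part of the columns below n. Adding that part of
    -- G to `q` would give an extension of the root at which `w` violates `treeᵒ`.
    inTree : ∀ {q w s} → q ≼ p → Consistent q → Approx π w q →
             IsSeq s → (∀ u → InF u s → InF u w) → T s
    inTree {q} {w} {s} q≼p A ap seq s⊆w = T-stable λ ¬t → run do
      ev ← proj₂ (T-decided s) ¬t
      c ← ¬¬-string (q ⊔ use ev) (Mixed q)
      let c≼q = mixed-≼ A (m≤m⊔n q (use ev)) c
      ok ← ok-below (≼-trans c≼q q≼p) (approx-≼ c≼q ap)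
      return (treeᵒ ok s seq s⊆w (transfer ev λ v v<u →
        let v<L = <-≤-trans v<u (m≤n⊔m q (use ev)) in
        (λ (col , g) → ⇒in c v<L (inj₁ (col , g)) , col) ,
        λ ¬g → case col? n v of λ where
          (yes col) → inj₁ (⇒out c v<L λ { (inj₁ g) → ¬g g ; (inj₂ (¬col , _)) → ¬col col })
          (no ¬col) → case string-decides c v v<L of λ where
            (inj₁ i) → inj₂ (i , ¬col)
            (inj₂ o) → inj₁ o))

    -- The bit at `u` is free: `q` ≤ `u` leaves it undecided by `q`, and `u` lies outside the
    -- columns that must agree with G.
    dense-forced : ∀ {q u} b → q ≼ p → Consistent q → q ≤ u → ¬ Col n u →
      ¬¬ ∃ λ r → r ≼ q × Consistent r × Forced b u r × ∃ (Good π (suc u) r)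
    dense-forced {q} {u} b q≼p A q≤u ¬colᵤ = do
      c ← ¬¬-string (suc u) λ v → (Col n v × G v) ⊎ (¬ Col n v × (InF v q ⊎ (v ≡ u × b ≡ 1)))
      let c≼q : str c ≼ q
          c≼q = (λ {v} p → ⇒in c (<-≤-trans (in<code p) (m≤n⇒m≤1+n q≤u)) (case col? n v of λ where
                   (yes col) → inj₁ (col , proj₁ (A v col) p)
                   (no ¬col) → inj₂ (¬col , inj₁ p))) ,≼
                (λ {v} p → ⇒out c (<-≤-trans (out<code p) (m≤n⇒m≤1+n q≤u)) λ where
                   (inj₁ (col , g)) → proj₂ (A v col) p g
                   (inj₂ (_ , inj₁ i)) → in-out i p
                   (inj₂ (_ , inj₂ (refl , _))) → <⇒≱ (out<code p) q≤u)
          c-consistent : Consistent (str c)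
          c-consistent v col =
            (λ p → case proj₂ (in⇒ c p) of λ where
              (inj₁ (_ , g)) → g
              (inj₂ (¬col , _)) → ⊥-elim (¬col col)) ,
            (λ p g → proj₂ (out⇒ c p) (inj₁ (col , g)))
          c-forced : Forced b u (str c)
          c-forced = (λ b≡1 → ⇒in c ≤-refl (inj₂ (¬colᵤ , inj₂ (refl , b≡1)))) ,
            λ b≢1 → ⇒out c ≤-refl λ where
              (inj₁ (col , _)) → ¬colᵤ col
              (inj₂ (_ , inj₁ i)) → <⇒≱ (in<code i) q≤u
              (inj₂ (_ , inj₂ (_ , b≡1))) → b≢1 b≡1
      r , r≼c , B , w , g ← dense (suc u) (≼-trans c≼q q≼p) c-consistent
      return (r , ≼-trans r≼c c≼q , B , forced-≼ r≼c c-forced , w , g)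

    extract : ∀ {l r w} → r ≼ p → Consistent r → Good π l r w →
      ¬¬ ∃ λ s → IsSeq s × T s × (∀ u → InF u s → InF u w) × (∀ i → i < l → ∃ λ a → InF (pair i a) s)
    extract {l} {r} {w} r≼p A g = do
      s , seq , s⊆ , tot ← buildSeq l {λ i a → InF (pair i a) w} λ i i<l → return (defined g i i<l)
      let s⊆w : ∀ u → InF u s → InF u w
          s⊆w u p = case s⊆ u p of λ { (_ , _ , refl , _ , i) → i }
      return (s , seq , inTree r≼p A (approx g) seq s⊆w , s⊆w , tot)

-- The search for good extensions, computable from the columns below n

module Search {π : Par} {T F : ℕ → Set} (sit : Situation π T F) where
  open Par π
  open Forcing sit public
  open At n

  oracleRel : Rel 1
  oracleRel = setRel (Gₙ n) oracleᶜ (decides-oracle n)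

  extendsRel : Rel 2
  extendsRel = define
    (∀< x₁ ((inRel ∙ (x₀ ∷ x₂ ∷ []) ⇛ inRel ∙ (x₀ ∷ x₁ ∷ [])) ⩓
            (outRel ∙ (x₀ ∷ x₂ ∷ []) ⇛ outRel ∙ (x₀ ∷ x₁ ∷ []))))
    (λ { (r ∷ q ∷ []) → r ≼ q })
    (λ { (r ∷ q ∷ []) h → return
      ((λ {v} p → proj₁ (h v (in<code p)) p) ,≼ (λ {v} p → proj₂ (h v (out<code p)) p)) })
    (λ { (r ∷ q ∷ []) h → return λ v _ → in≼ h , out≼ h })

  consistentRel : Rel 1
  consistentRel = define
    (∀< x₀ (colRel ∙ (♯ n ∷ x₀ ∷ []) ⇛ (inRel ∙ (x₀ ∷ x₁ ∷ []) ⇛ oracleRel ∙ (x₀ ∷ [])) ⩓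
                                       (outRel ∙ (x₀ ∷ x₁ ∷ []) ⇛ oracleRel ∙ (x₀ ∷ []) ⇛ 𝕗)))
    (λ { (r ∷ []) → Consistent r })
    (λ { (r ∷ []) h → return λ v col →
      (λ p → proj₂ (proj₁ (h v (in<code p) col) p)) , λ p g → proj₂ (h v (out<code p) col) p (col , g) })
    (λ { (r ∷ []) h → return λ v _ col →
      (λ p → col , proj₁ (h v col) p) , λ p (_ , g) → proj₂ (h v col) p g })

  private
    inᶜRel outᶜRel : Rel 2
    inᶜRel = define (inRel ∙ (x₀ ∷ x₁ ∷ []) ⩓ colRel ∙ (♯ m ∷ x₀ ∷ []))
      (λ { (v ∷ r ∷ []) → Inᶜ m r v }) (λ { (v ∷ r ∷ []) → return }) (λ { (v ∷ r ∷ []) → return })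
    outᶜRel = define (outRel ∙ (x₀ ∷ x₁ ∷ []) ⩔ inRel ∙ (x₀ ∷ x₁ ∷ []) ⩓ (colRel ∙ (♯ m ∷ x₀ ∷ []) ⇛ 𝕗))
      (λ { (v ∷ r ∷ []) → Outᶜ m r v }) (λ { (v ∷ r ∷ []) → return }) (λ { (v ∷ r ∷ []) → return })
    module Cond = OracleTrace inᶜRel outᶜRel
    module Str  = OracleTrace inRel outRel

  -- `Good` asserts that computations exist; bounding their traces and outputs by `B` makes it
  -- decidable.
  GoodBelow : (B l r w : ℕ) → Set
  GoodBelow B l r w =
    (∀ v → v < w → (InF v w → ∃ λ c → c < B × Trace (Inᶜ m r) (Outᶜ m r) c d v 1) ×
                   (OutF v w → ∃ λ c → c < B × Trace (Inᶜ m r) (Outᶜ m r) c d v 0)) ×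
    (∀ v → v < l → InF v w ⊎ OutF v w) ×
    (∀ i → i < l → ∃ λ a → a < w × InF (pair i a) w) ×
    (∀ v → v < l → ∃ λ b → b < B × ∃ λ c → c < B × Trace (λ v → InF v w) (λ v → OutF v w) c e v b)

  goodRel : Rel 4
  goodRel = define
    ((∀< x₃ ((inRel ∙ (x₀ ∷ x₄ ∷ []) ⇛ ∃< x₁ (Cond.traceRel ∙ (x₀ ∷ x₄ ∷ ♯ d ∷ x₁ ∷ ♯ 1 ∷ []))) ⩓
             (outRel ∙ (x₀ ∷ x₄ ∷ []) ⇛ ∃< x₁ (Cond.traceRel ∙ (x₀ ∷ x₄ ∷ ♯ d ∷ x₁ ∷ ♯ 0 ∷ []))))) ⩓
     (∀< x₁ (inRel ∙ (x₀ ∷ x₄ ∷ []) ⩔ outRel ∙ (x₀ ∷ x₄ ∷ []))) ⩓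
     (∀< x₁ (∃< x₄ (inRel ∙ (⟪ x₁ , x₀ ⟫ ∷ x₅ ∷ [])))) ⩓
     (∀< x₁ (∃< x₁ (∃< x₂ (Str.traceRel ∙ (x₀ ∷ x₆ ∷ ♯ e ∷ x₂ ∷ x₁ ∷ []))))))
    (λ { (B ∷ l ∷ r ∷ w ∷ []) → GoodBelow B l r w })
    (λ { (B ∷ l ∷ r ∷ w ∷ []) → return }) (λ { (B ∷ l ∷ r ∷ w ∷ []) → return })

  goodBelow⇒ : ∀ {B l r w} → GoodBelow B l r w → ¬¬ Good π l r w
  goodBelow⇒ {B} {l} {r} {w} (ap , dec , def , red) = do
    ap′ ← ¬¬-∀< w {λ v → (InF v w → Evalᶜ m r d v 1) × (OutF v w → Evalᶜ m r d v 0)} λ v v<w →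
      case inF? v w of λ where
        (yes p) → trace-sound (proj₂ (proj₂ (proj₁ (ap v v<w) p))) >>= λ ev →
                  return ((λ _ → ev) , λ o → ⊥-elim (in-out p o))
        (no ¬p) → em (OutF v w) >>= λ where
          (yes o) → trace-sound (proj₂ (proj₂ (proj₂ (ap v v<w) o))) >>= λ ev →
                    return ((λ p → ⊥-elim (¬p p)) , λ _ → ev)
          (no ¬o) → return ((λ p → ⊥-elim (¬p p)) , λ o → ⊥-elim (¬o o))
    red′ ← ¬¬-∀< l {λ v → ∃ λ b → Evalˢ w e v b} λ v v<l →
      let (b , _ , _ , _ , tr) = red v v<l in trace-sound tr >>= λ ev → return (b , ev)
    return (record
      { approx  = λ v → (λ p → proj₁ (ap′ v (in<code p)) p) , λ p → proj₂ (ap′ v (out<code p)) p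
      ; decided = dec
      ; defined = λ i i<l → let (a , _ , p) = def i i<l in a , p
      ; reduces = red′ })

  ⇒goodBelow : ∀ {l r w} → Good π l r w → ¬¬ ∃ λ B → GoodBelow B l r w
  ⇒goodBelow {l} {r} {w} g = do
    B₁ , ap ← ¬¬-bound w {λ v b →
        (InF v w → ∃ λ c → c < b × Trace (Inᶜ m r) (Outᶜ m r) c d v 1) ×
        (OutF v w → ∃ λ c → c < b × Trace (Inᶜ m r) (Outᶜ m r) c d v 0)}
      (λ v b≤c (f , f′) → (λ p → up b≤c (f p)) , λ p → up b≤c (f′ p))
      λ v _ → case inF? v w of λ where
        (yes p) → let (c , tr) = trace-complete (proj₁ (approx g v) p) in
                  return (suc c , (λ _ → c , ≤-refl , tr) , λ o → ⊥-elim (in-out p o))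
        (no ¬p) → em (OutF v w) >>= λ where
          (yes o) → let (c , tr) = trace-complete (proj₂ (approx g v) o) in
                    return (suc c , (λ p → ⊥-elim (¬p p)) , λ _ → c , ≤-refl , tr)
          (no ¬o) → return (0 , (λ p → ⊥-elim (¬p p)) , λ o → ⊥-elim (¬o o))
    B₂ , red ← ¬¬-bound l {λ v B → ∃ λ b → b < B × ∃ λ c → c < B × Trace (λ v → InF v w) (λ v → OutF v w) c e v b}
      (λ v b≤c (b , b< , c , c< , tr) → b , <-≤-trans b< b≤c , c , <-≤-trans c< b≤c , tr)
      λ v v<l → let (b , ev) = reduces g v v<l
                    (c , tr) = trace-complete ev in
        return (suc (b ⊔ c) , b , s≤s (m≤m⊔n b c) , c , s≤s (m≤n⊔m b c) , tr)
    return (B₁ ⊔ B₂ ,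
      (λ v v<w → let (f , f′) = ap v v<w in (λ p → up (m≤m⊔n B₁ B₂) (f p)) , λ p → up (m≤m⊔n B₁ B₂) (f′ p)) ,
      decided g ,
      (λ i i<l → let (a , p) = defined g i i<l in a , ≤-<-trans (≤pairʳ i a) (in<code p) , p) ,
      λ v v<l → let (b , b< , c , c< , tr) = red v v<l
                    B₂≤ = m≤n⊔m B₁ B₂ in b , <-≤-trans b< B₂≤ , c , <-≤-trans c< B₂≤ , tr)
    where
    up : ∀ {b c} {A : ℕ → Set} → b ≤ c → (∃ λ x → x < b × A x) → ∃ λ x → x < c × A x
    up b≤c (x , x<b , a) = x , <-≤-trans x<b b≤c , a

  -- z codes a good extension ⟨ r , ⟨ w , B ⟩ ⟩ of q.
  Found : (z q u b : ℕ) → Set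
  Found z q u b = ∃ λ r → ∃ λ w → ∃ λ B → z ≡ pair r (pair w B) ×
                  r ≼ q × Consistent r × Forced b u r × GoodBelow B (suc u) r w

  w<+1 : ∀ {z} r w B → z ≡ pair r (pair w B) → w < z + 1
  w<+1 r w B refl = ≤⇒<+1 (≤-trans (≤pairˡ w B) (≤pairʳ r _))

  B<+1 : ∀ {z} r w B → z ≡ pair r (pair w B) → B < z + 1
  B<+1 r w B refl = ≤⇒<+1 (≤-trans (≤pairʳ w B) (≤pairʳ r _))

  foundRel : Rel 4
  foundRel = define
    (∃< (+1 x₀) (∃< (+1 x₁) (∃< (+1 x₂)
      (x₃ ≣ ⟪ x₂ , ⟪ x₁ , x₀ ⟫ ⟫ ⩓
       extendsRel ∙ (x₂ ∷ x₄ ∷ []) ⩓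
       consistentRel ∙ (x₂ ∷ []) ⩓
       ((x₆ ≣ ♯ 1 ⇛ inRel ∙ (x₅ ∷ x₂ ∷ [])) ⩓ ((x₆ ≣ ♯ 1 ⇛ 𝕗) ⇛ outRel ∙ (x₅ ∷ x₂ ∷ []))) ⩓
       goodRel ∙ (x₀ ∷ ♯ 1 ⊕ x₅ ∷ x₂ ∷ x₁ ∷ [])))))
    (λ { (z ∷ q ∷ u ∷ b ∷ []) → Found z q u b })
    (λ { (z ∷ q ∷ u ∷ b ∷ []) (r , _ , w , _ , B , _ , h) → return (r , w , B , h) })
    (λ { (z ∷ q ∷ u ∷ b ∷ []) (r , w , B , eq , h) → return
      (r , fst<+1 r _ eq , w , w<+1 r w B eq , B , B<+1 r w B eq , eq , h) })

  module _ {p : ℕ} (rt : Root p) where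
    open Below rt
    found-exists : ∀ {q u} b → q ≼ p → Consistent q → q ≤ u → ¬ Col n u → ¬¬ ∃ λ z → Found z q u b
    found-exists b q≼p A q≤u ¬c = do
      r , r≼q , A′ , f , w , g ← dense-forced b q≼p A q≤u ¬c
      B , g′ ← ⇒goodBelow g
      return (pair r (pair w B) , r , w , B , refl , r≼q , A′ , f , g′)

  guessRel : Rel 2
  guessRel = define
    (∃< (+1 x₀) (∃< (+1 x₁) (∃< (+1 x₂) (x₃ ≣ ⟪ x₂ , ⟪ x₁ , x₀ ⟫ ⟫ ⩓ inRel ∙ (⟪ x₄ , ♯ 1 ⟫ ∷ x₁ ∷ [])))))
    (λ { (z ∷ k ∷ []) → ∃ λ r → ∃ λ w → ∃ λ B → z ≡ pair r (pair w B) × InF (pair k 1) w })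
    (λ { (z ∷ k ∷ []) (r , _ , w , _ , B , _ , h) → return (r , w , B , h) })
    (λ { (z ∷ k ∷ []) (r , w , B , eq , h) → return
      (r , fst<+1 r _ eq , w , w<+1 r w B eq , B , B<+1 r w B eq , eq , h) })

  module Guess {p : ℕ} (rt : Root p) (empty : ∀ u → ¬ Col n u) where
    open Below rt

    private
      query : Vec (Tm 1) 3
      -- The position is at least `p`, so `p` leaves it undecided, and at least `pair k 1`, so a
      -- good extension settles whether F takes the value 1 at k. The forced bit 0 is an arbitrary
      -- choice.
      query = ♯ p ∷ ⟪ x₀ , ♯ 1 ⟫ ⊕ ♯ p ∷ ♯ 0 ∷ []

    -- On k: the guess at the k-th bit of F made by the first good extension of p.
    guessᶜ : ℕ
    guessᶜ = compᶜ (compᶜ (code guessRel) (pairᶜ (compᶜ (searchᶜ (code foundRel)) (termsᶜ query)) idᶜ))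
                   (pairᶜ idᶜ (constᶜ 0))

    guess : ∀ k → ¬¬ ∃ λ z → Found z p (pair k 1 + p) 0 ×
      Decides guessᶜ k (∃ λ r → ∃ λ w → ∃ λ B → z ≡ pair r (pair w B) × InF (pair k 1) w)
    guess k = do
      z , f , _ , ev ← At.leastSolution n foundRel (p ∷ (pair k 1 + p) ∷ 0 ∷ [])
        (found-exists rt 0 ≼-refl root-consistent (m≤n+m p (pair k 1)) (empty _))
      return (z , f , decides-comp (ev-pair ev-id ev-const) (decides-comp
        (ev-pair (ev-comp (ev-terms query (k ∷ [])) ev) ev-id)
        (decides guessRel (z ∷ k ∷ []))))

-- Trees and paths in the model

isPair? : ∀ u → Dec (∃ λ i → ∃ λ a → u ≡ pair i a)
isPair? u = map′
  (λ (i , _ , a , _ , eq) → i , a , eq)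
  (λ { (i , a , refl) → i , s≤s (≤pairˡ i a) , a , s≤s (≤pairʳ i a) , refl })
  (anyUpTo? (λ i → anyUpTo? (λ a → u ≟ pair i a) (suc u)) (suc u))

record IsTree (T : ℕ → Set) : Set where
  field
    seq  : ∀ {s} → T s → ¬¬ IsSeq s
    down : ∀ {s t} → T s → IsSeq t → (∀ u → InF u t → InF u s) → T t

record IsPath (T F : ℕ → Set) : Set where
  field
    pairsᵖ  : ∀ {u} → F u → ∃ λ i → ∃ λ a → u ≡ pair i a
    totalᵖ  : ∀ i → ¬¬ ∃ λ a → F (pair i a)
    singleᵖ : ∀ {i a b} → F (pair i a) → F (pair i b) → a ≡ b
    followᵖ : ∀ {s} → IsSeq s → (∀ u → InF u s → F u) → T s
open IsTree
open IsPath

module _ {n m : ℕ} (ρ : Vec ℕ n) (δ : Vec Real m) where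
  private
    wk² : ∀ (t : Term n) x y → ⟦ t ↑ 2 ⟧ᴺ (y ∷ x ∷ ρ) ≡ ⟦ t ⟧ᴺ ρ
    wk² t x y = trans (wkTerm-⟦⟧ (t ↑ 1) y (x ∷ ρ)) (wkTerm-⟦⟧ t x ρ)

  opaque
    unfolding pair

    ⇒initial : ∀ s t → (∀ u → InF u (⟦ s ⟧ᴺ ρ) → InF u (⟦ t ⟧ᴺ ρ)) → ⟦ Initial s t ⟧ ρ δ
    ⇒initial s t h i a p = ⇒entry (a ∷ i ∷ ρ) δ (t ↑ 2) v₁ v₀ (subst (InF (pair i a)) (sym (wk² t i a))
      (h _ (subst (InF (pair i a)) (wk² s i a) (entry⇒ (a ∷ i ∷ ρ) δ (s ↑ 2) v₁ v₀ p))))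

    initial⇒ : ∀ s t → IsSeq (⟦ s ⟧ᴺ ρ) → ⟦ Initial s t ⟧ ρ δ → ∀ u → InF u (⟦ s ⟧ᴺ ρ) → InF u (⟦ t ⟧ᴺ ρ)
    initial⇒ s t q h u p = case pairs q u p of λ where
      (i , a , refl) → subst (InF (pair i a)) (wk² t i a) (entry⇒ (a ∷ i ∷ ρ) δ (t ↑ 2) v₁ v₀
        (h i a (⇒entry (a ∷ i ∷ ρ) δ (s ↑ 2) v₁ v₀ (subst (InF (pair i a)) (sym (wk² s i a)) p))))

module _ {n m : ℕ} (ρ : Vec ℕ n) (δ : Vec Real m) where
  opaque
    unfolding pair

    tree⇒ : ∀ T → ⟦ Tree T ⟧ ρ δ → IsTree (mem (lookup δ T))
    tree⇒ T h = record
      { seq  = λ {s} p → seq⇒ ρ δ s (proj₁ (h s p))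
      ; down = λ {s} {t} p q sub → proj₂ (h s p) t (⇒seq (s ∷ ρ) δ t q , ⇒initial (t ∷ s ∷ ρ) δ v₀ v₁ sub) }

    ⇒tree : ∀ T → IsTree (mem (lookup δ T)) → ⟦ Tree T ⟧ ρ δ
    ⇒tree T h s p =
      stable (Seq v₀) (s ∷ ρ) δ (seq h p >>= λ q → return (⇒seq ρ δ s q)) ,
      λ t (q , sub) → stable (v₀ ε T) (t ∷ s ∷ ρ) δ (seq⇒ (s ∷ ρ) δ t q >>= λ q →
        return (down h p q (initial⇒ (t ∷ s ∷ ρ) δ v₀ v₁ q sub)))

    path⇒ : ∀ T F → ⟦ Path T F ⟧ ρ δ → IsPath (mem (lookup δ T)) (mem (lookup δ F))
    path⇒ T F ((p , t , f) , h) = record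
      { pairsᵖ  = λ {u} u∈F → decidable-stable (isPair? u)
          (∃-elim (p u u∈F) λ i k → ∃-elim k λ a eq → return (i , a , eq))
      ; totalᵖ  = λ i → ∃-elim (t i) λ a k → return (a , k)
      ; singleᵖ = λ {i} {a} {b} k k′ → f i a b (k , k′)
      ; followᵖ = λ {s} q sub → h s (⇒seq ρ δ s q , λ i a k → sub _ (entry⇒ (a ∷ i ∷ s ∷ ρ) δ v₂ v₁ v₀ k)) }

    ⇒binary : ∀ T → (∀ {s} → mem (lookup δ T) s → ¬¬ (∀ i a → InF (pair i a) s → a ≡ 0 ⊎ a ≡ 1)) →
              ⟦ Binary T ⟧ ρ δ
    ⇒binary T h s s∈T i a p (≢0 , ≢1) = h s∈T λ bin →
      case bin i a (entry⇒ (a ∷ i ∷ s ∷ ρ) δ v₂ v₁ v₀ p) of λ where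
        (inj₁ eq) → ≢0 eq
        (inj₂ eq) → ≢1 eq

situation : ∀ {T F : Real} {e n′} → IsPath (mem T) (mem F) → Reduces e (Gₙ n′) (mem F) →
            Situation (par (index F) e (index T) (level T) n′ (level F)) (mem T) (mem F)
situation {T} {F} h r = record
  { F-decided = decides-mem F
  ; T-decided = decides-mem T
  ; F-stable  = λ k ¬ev → k λ m → m ¬ev
  ; T-stable  = λ k ¬ev → k λ m → m ¬ev
  ; F-pairs   = pairsᵖ h
  ; F-total   = totalᵖ h
  ; F-single  = singleᵖ h
  ; F-path    = followᵖ h
  ; reduction = r }

-- Weak König's lemma fails

module Kleene (n : ℕ) where
  open At n

  Ev₀ : ℕ → ℕ → ℕ → Set
  Ev₀ = Eval (Gₙ n) (Gₙᶜ n)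

  Trace₀ : ℕ → ℕ → ℕ → ℕ → Set
  Trace₀ = Trace (Gₙ n) (Gₙᶜ n)

  -- Binary sequences which differ from i ↦ {i}(i) as far as computations
  -- below their length show.
  record Diagonal (s : ℕ) : Set where
    field
      sequence : IsSeq s
      binary   : ∀ {i a} → InF (pair i a) s → a ≡ 0 ⊎ a ≡ 1
      differs  : ∀ {i a j b c} → InF (pair i a) s → InF (pair j b) s → c < j → ¬ Trace₀ c i i a
  open Diagonal

  diagonalRel : Rel 1
  diagonalRel = define
    (seqRel ∙ (x₀ ∷ []) ⩓
     (∀< x₀ (∀< x₁ (inRel ∙ (⟪ x₁ , x₀ ⟫ ∷ x₂ ∷ []) ⇛
       (x₀ ≣ ♯ 0 ⩔ x₀ ≣ ♯ 1) ⩓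
       (∀< x₂ (∀< x₃ (inRel ∙ (⟪ x₁ , x₀ ⟫ ∷ x₄ ∷ []) ⇛
         ∀< x₁ (traceRel₀ ∙ (x₀ ∷ x₄ ∷ x₄ ∷ x₃ ∷ []) ⇛ 𝕗))))))))
    (λ { (s ∷ []) → Diagonal s })
    (λ { (s ∷ []) (q , h) → return (record
      { sequence = q
      ; binary   = λ {i} {a} p → proj₁ (h i (fst< p) a (snd< p) p)
      ; differs  = λ {i} {a} {j} {b} {c} p p′ c<j → proj₂ (h i (fst< p) a (snd< p) p) j (fst< p′) b (snd< p′) p′ c c<j }) })
    (λ { (s ∷ []) D → return
      (sequence D , λ i _ a _ p → binary D p , λ j _ b _ p′ c c<j → differs D p p′ c<j) })
    where
    traceRel₀ = SetOracle.setTraceRel (Gₙ n) oracleᶜ (decides-oracle n)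
    fst< : ∀ {i a s} → InF (pair i a) s → i < s
    fst< {i} {a} p = ≤-<-trans (≤pairˡ i a) (in<code p)
    snd< : ∀ {i a s} → InF (pair i a) s → a < s
    snd< {i} {a} p = ≤-<-trans (≤pairʳ i a) (in<code p)

  T₀ : Real
  T₀ = real {n} (unary-decides diagonalRel)

  T₀⇒ : ∀ {s} → mem T₀ s → ¬¬ Diagonal s
  T₀⇒ = real⇒ (unary-decides diagonalRel) _

  ⇒T₀ : ∀ {s} → Diagonal s → mem T₀ s
  ⇒T₀ = ⇒real (unary-decides diagonalRel) _

  T₀-tree : IsTree (mem T₀)
  T₀-tree = record
    { seq  = λ p → T₀⇒ p >>= λ D → return (sequence D)
    ; down = λ p q sub → λ k → T₀⇒ p λ D → ⇒T₀ (record
        { sequence = q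
        ; binary   = λ p → binary D (sub _ p)
        ; differs  = λ p p′ → differs D (sub _ p) (sub _ p′) }) k }

  T₀-infinite : ∀ l → ¬¬ ∃ λ s → Diagonal s × l ≤ s
  T₀-infinite l = do
    -- Length `suc l` provides an entry at l, which makes the code at least l.
    s , q , vals , tot ← buildSeq (suc l) {λ i a → (a ≡ 0 ⊎ a ≡ 1) × ¬ Ev₀ i i a} λ i _ →
      em (Ev₀ i i 0) >>= λ where
        (yes ev) → return (1 , inj₂ refl , λ ev′ → contradictory ev ev′)
        (no ¬ev) → return (0 , inj₁ refl , ¬ev)
    let val : ∀ {i a} → InF (pair i a) s → (a ≡ 0 ⊎ a ≡ 1) × ¬ Ev₀ i i a
        val = λ {i} {a} p → let (i′ , a′ , eq , _ , r) = vals _ p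
                                (ei , ea) = pair-inj eq in
              subst₂ (λ i a → (a ≡ 0 ⊎ a ≡ 1) × ¬ Ev₀ i i a) (sym ei) (sym ea) r
        (a , p) = tot l ≤-refl
    return (s , record
      { sequence = q
      ; binary   = λ p → proj₁ (val p)
      ; differs  = λ p _ _ tr → trace-sound tr (proj₂ (val p)) } ,
      ≤-trans (≤pairˡ l a) (<⇒≤ (in<code p)))

-- Diagonalisation against a path through the Kleene tree

module NoPath {π : Par} {T F : ℕ → Set} (sit : Situation π T F) (no-column : ∀ u → ¬ Col (Par.n π) u)
            (diagonal : ∀ {s} → T s → ¬¬ Kleene.Diagonal (Par.n π) s) where
  open Par π
  open Kleene n
  open Diagonal
  open At n
  open Search sit

  module _ {p : ℕ} (rt : Root p) where
    open Below rt

    module _ (k : ℕ) {r w : ℕ} (r≼p : r ≼ p) (A : Consistent r) (g : Good π (suc (pair k 1 + p)) r w) where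
      -- A further good extension keeps the guess b and yields a node of T with value b at k, long
      -- enough for `Diagonal` to have seen the computation of `{k}(k)` = b.
      refute : ∀ {b} → Ev k k b → (InF (pair k 1) w × b ≡ 1) ⊎ (¬ InF (pair k 1) w × b ≡ 0) → ¬¬ ⊥
      refute {b} ev guessed = do
        let c , tr = trace-complete ev
            -- The summands serve coherence with `w`, an entry at `suc c` that exceeds the trace
            -- `c`, and an entry at `k`.
            L = w + (suc c + suc k)
        r′ , r′≼r , A′ , w′ , g′ ← dense L r≼p A
        let r′≼p = ≼-trans r′≼r r≼p
            w′≼w = coherent r′≼r (approx g) (approx g′) λ v v<w → decided g′ v (<-≤-trans v<w (m≤m+n w _))
        ok ← ok-below r′≼p (approx g′)
        s , _ , s∈T , s⊆w′ , tot ← extract r′≼p A′ g′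
        D ← diagonal s∈T
        let a , at-k = tot k (≤-trans (m≤n+m (suc k) (suc c)) (m≤n+m _ w))
            _ , at-c = tot (suc c) (≤-trans (≤-trans (≤-reflexive (+-comm 1 (suc c))) (+-monoʳ-≤ (suc c) (s≤s z≤n))) (m≤n+m _ w))
            agree : a ≡ b
            agree = case guessed of λ where
              (inj₁ (i , refl)) → singleᵒ ok (s⊆w′ _ at-k) (in≼ w′≼w i)
              (inj₂ (¬i , refl)) → case binary D at-k of λ where
                (inj₁ eq) → eq
                (inj₂ eq) → case decided g (pair k 1) (s≤s (m≤m+n (pair k 1) p)) of λ where
                  (inj₁ i) → ⊥-elim (¬i i)
                  (inj₂ o) → ⊥-elim (in-out (subst (λ a → InF (pair k a) w′) eq (s⊆w′ _ at-k)) (out≼ w′≼w o))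
        return (differs D at-k at-c ≤-refl (subst (Trace₀ c k k) (sym agree) tr))

    -- At k = `c` the guess is `{c}(c)` itself, the very value that a path must avoid.
    refute-all : ∀ c → (∀ k → ¬¬ ∃ λ z → Found z p (pair k 1 + p) 0 ×
      Decides c k (∃ λ r → ∃ λ w → ∃ λ B → z ≡ pair r (pair w B) × InF (pair k 1) w)) → ⊥
    refute-all c guesses = run do
      z , (r , w , B , eq , r≼p , A , _ , gb) , dec ← guesses c
      g ← goodBelow⇒ gb
      case inF? (pair c 1) w of λ where
        (yes i) → proj₁ dec (r , w , B , eq , i) >>= λ ev → refute c r≼p A g ev (inj₁ (i , refl))
        (no ¬i) → proj₂ dec (λ (r′ , w′ , B′ , eq′ , i) → ¬i (same (trans (sym eq′) eq) i)) >>= λ ev →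
          refute c r≼p A g ev (inj₂ (¬i , refl))
      where
      same : ∀ {r w B r′ w′ B′ v} → pair r′ (pair w′ B′) ≡ pair r (pair w B) → InF v w′ → InF v w
      same eq i with pair-inj (proj₂ (pair-inj eq))
      ... | refl , _ = i

  no-path : ⊥
  no-path = run (root >>= λ (p , rt) → return (refute-all rt (Guess.guessᶜ rt no-column) (Guess.guess rt no-column)))

WKL-false : ¬ ⟦ WKL ⟧ [] []
WKL-false h = h T₀
  (⇒tree [] (T₀ ∷ []) zero T₀-tree ,
   ⇒binary [] (T₀ ∷ []) zero (λ s∈T → T₀⇒ s∈T >>= λ D → return λ i a → Diagonal.binary D) ,
   λ b → ∃-intro¬¬ (T₀-infinite b >>= λ (s , D , b≤s) → return (s , ⇒T₀ D , ≤⇒≯ b≤s)))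
  λ F path → NoPath.no-path
    -- With no columns to recover, the constant 0 is a reduction to any F.
    (situation {T₀} {F} {e = constᶜ 0} {n′ = 0} (path⇒ [] (F ∷ T₀ ∷ []) (suc zero) zero path) λ v →
      (λ (col , _) → ⊥-elim (no-column v col)) , λ _ → return (by refl (constˢ refl)))
    no-column T₀⇒
  where
  open Kleene 0
  no-column : ∀ u → ¬ Col 0 u
  no-column u (_ , _ , _ , ())

-- The pointed subtree

module Subtree {π : Par} {T F : ℕ → Set} (sit : Situation π T F) (n<n′ : Par.n π < Par.n′ π)
               {p : ℕ} (rt : Forcing.Root sit p) where
  open Par π
  open Situation sit using (T-decided)
  open Search sit
  open Below rt
  open At n

  -- The position in the n-th column at which the children of z branch.
  fork : ℕ → ℕ
  fork z = pair n z

  fork-fresh : ∀ z → ¬ Col n (fork z)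
  fork-fresh z (i , j , eq , i<n) = <-irrefl (sym (proj₁ (pair-inj eq))) i<n

  -- The binary tree of good extensions

  Next : (z′ z b : ℕ) → Set
  Next z′ z b = ∃ λ r → ∃ λ w → ∃ λ B → z ≡ pair r (pair w B) × Found z′ r (fork z) b

  nextRel : Rel 3
  nextRel = define
    (∃< (+1 x₁) (∃< (+1 x₂) (∃< (+1 x₃)
      (x₄ ≣ ⟪ x₂ , ⟪ x₁ , x₀ ⟫ ⟫ ⩓ foundRel ∙ (x₃ ∷ x₂ ∷ ⟪ ♯ n , x₄ ⟫ ∷ x₅ ∷ [])))))
    (λ { (z′ ∷ z ∷ b ∷ []) → Next z′ z b })
    (λ { (z′ ∷ z ∷ b ∷ []) (r , _ , w , _ , B , _ , h) → return (r , w , B , h) })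
    (λ { (z′ ∷ z ∷ b ∷ []) (r , w , B , eq , h) → return
      (r , fst<+1 r _ eq , w , w<+1 r w B eq , B , B<+1 r w B eq , eq , h) })

  -- Minimality leaves one child in each direction, so the levels are finite.
  Child : (z′ z b : ℕ) → Set
  Child z′ z b = Next z′ z b × (∀ y → y < z′ → ¬ Next y z b)

  childRel : Rel 3
  childRel = define (nextRel ∙ (x₀ ∷ x₁ ∷ x₂ ∷ []) ⩓ ∀< x₀ (nextRel ∙ (x₀ ∷ x₂ ∷ x₃ ∷ []) ⇛ 𝕗))
    (λ { (z′ ∷ z ∷ b ∷ []) → Child z′ z b })
    (λ { (z′ ∷ z ∷ b ∷ []) → return }) (λ { (z′ ∷ z ∷ b ∷ []) → return })

  child-unique : ∀ {y z x b} → Child y x b → Child z x b → y ≡ z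
  child-unique {y} {z} (h , m) (h′ , m′) =
    ≤-antisym (≮⇒≥ λ z<y → m z z<y h′) (≮⇒≥ λ y<z → m′ y y<z h)

  record State (z r w : ℕ) : Set where
    field
      stateCode : ∃ λ B → z ≡ pair r (pair w B)
      below     : r ≼ p
      agrees    : Consistent r
      approxˢ   : Approx π w r
  open State

  state-inj : ∀ {z r w r′ w′} → State z r w → State z r′ w′ → r ≡ r′ × w ≡ w′
  state-inj s s′ with stateCode s | stateCode s′
  ... | _ , eq | _ , eq′ with pair-inj (trans (sym eq) eq′)
  ... | r≡ , eq″ = r≡ , proj₁ (pair-inj eq″)

  state-r≤ : ∀ {z r w} → State z r w → r ≤ z
  state-r≤ {r = r} s with stateCode s
  ... | _ , refl = ≤pairˡ r _

  state-w≤ : ∀ {z r w} → State z r w → w ≤ z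
  state-w≤ {r = r} {w} s with stateCode s
  ... | B , refl = ≤-trans (≤pairˡ w B) (≤pairʳ r _)

  child-exists : ∀ {z r w} b → State z r w → ¬¬ ∃ λ z′ → Child z′ z b
  child-exists {z} {r} {w} b s = do
    z′ , f ← found-exists rt b (below s) (agrees s) (≤-trans (state-r≤ s) (≤pairʳ n z)) (fork-fresh z)
    ¬¬-least z′ (r , w , proj₁ (stateCode s) , proj₂ (stateCode s) , f)

  record Extension (z b r w z′ r′ w′ : ℕ) : Set where
    field
      state   : State z′ r′ w′
      r-ext   : r′ ≼ r
      w-ext   : w′ ≼ w
      forced  : Forced b (fork z) r′
      good    : Good π (suc (fork z)) r′ w′
  open Extension

  child-extension : ∀ {z r w z′ b} → State z r w → Child z′ z b → ¬¬ ∃ λ r′ → ∃ λ w′ → Extension z b r w z′ r′ w′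
  child-extension {z} s ((r , w , B , eq , r′ , w′ , B′ , eq′ , r′≼ , A , f , gb) , _) = do
    g ← goodBelow⇒ gb
    case pair-inj (trans (sym (proj₂ (stateCode s))) eq) of λ where
      (refl , eq₂) → case pair-inj eq₂ of λ where
        (refl , _) → return (r′ , w′ , record
          { state  = record { stateCode = B′ , eq′ ; below = ≼-trans r′≼ (below s) ; agrees = A ; approxˢ = approx g }
          ; r-ext  = r′≼
          ; w-ext  = coherent r′≼ (approxˢ s) (approx g)
              λ v v<w → decided g v (m≤n⇒m≤1+n (<-≤-trans v<w (≤-trans (state-w≤ s) (≤pairʳ n z))))
          ; forced = f
          ; good   = g })

  -- `w′` decides `fork z`, which is at least z, and a code exceeds every number that it decides.
  extension-< : ∀ {z b r w z′ r′ w′} → Extension z b r w z′ r′ w′ → z < z′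
  extension-< {z} x = ≤-<-trans (≤pairʳ n z) (<-≤-trans (decided< (decided (good x) (fork z) ≤-refl)) (state-w≤ (state x)))
    where
    decided< : ∀ {v w} → InF v w ⊎ OutF v w → v < w
    decided< (inj₁ i) = in<code i
    decided< (inj₂ o) = out<code o

  data Descendant (z : ℕ) : ℕ → ℕ → Set where
    here : Descendant z 0 z
    grow : ∀ {j y y′ b} → Descendant z j y → b < 2 → Child y′ y b → Descendant z (suc j) y′

  descendant-trans : ∀ {x y z i j} → Descendant x i y → Descendant y j z → Descendant x (j + i) z
  descendant-trans h here = h
  descendant-trans h (grow k b c) = grow (descendant-trans h k) b c

  descendant-split : ∀ j {x z i} → Descendant x (j + i) z → ∃ λ y → Descendant x i y × Descendant y j z
  descendant-split zero    h = _ , h , here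
  descendant-split (suc j) (grow h b c) with descendant-split j h
  ... | y , h₁ , h₂ = y , h₁ , grow h₂ b c

  descendant-state : ∀ {z r w j z′} → State z r w → Descendant z j z′ →
                     ¬¬ ∃ λ r′ → ∃ λ w′ → State z′ r′ w′ × r′ ≼ r × w′ ≼ w × z + j ≤ z′
  descendant-state {z} s here = return (_ , _ , s , ≼-refl , ≼-refl , ≤-reflexive (+-identityʳ z))
  descendant-state {z} s (grow {j} {y′ = z′} h _ c) = do
    _ , _ , s₁ , r₁≼ , w₁≼ , z≤ ← descendant-state s h
    r′ , w′ , x ← child-extension s₁ c
    return (r′ , w′ , state x , ≼-trans (r-ext x) r₁≼ , ≼-trans (w-ext x) w₁≼ ,
      subst (_≤ z′) (sym (+-suc z j)) (≤-<-trans z≤ (extension-< x)))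

  descendant-exists : ∀ {z r w} j → State z r w → ¬¬ ∃ (Descendant z j)
  descendant-exists zero    s = return (_ , here)
  descendant-exists (suc j) s = do
    y , h ← descendant-exists j s
    _ , _ , s′ , _ ← descendant-state s h
    y′ , c ← child-exists 0 s′
    return (y′ , grow h (s≤s z≤n) c)

  z₀ : ℕ
  z₀ = pair p (pair 0 0)

  state₀ : State z₀ p 0
  state₀ = record
    { stateCode = 0 , refl ; below = ≼-refl ; agrees = root-consistent
    ; approxˢ = λ v → (λ i → ⊥-elim (¬in-0 i)) , λ o → ⊥-elim (¬out-0 o) }

  good-≤ : ∀ {l l′ r w} → l ≤ l′ → Good π l′ r w → Good π l r w
  good-≤ l≤l′ g = record
    { approx  = approx g
    ; decided = λ v v<l → decided g v (<-≤-trans v<l l≤l′)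
    ; defined = λ i i<l → defined g i (<-≤-trans i<l l≤l′)
    ; reduces = λ v v<l → reduces g v (<-≤-trans v<l l≤l′) }

  -- Codes grow with every generation, so goodness up to the fork of the parent covers the level
  -- number.
  node-good : ∀ {l z} → Descendant z₀ l z → ¬¬ ∃ λ r → ∃ λ w → State z r w × Good π l r w
  node-good here = return (p , 0 , state₀ , record
    { approx = approxˢ state₀ ; decided = λ _ () ; defined = λ _ () ; reduces = λ _ () })
  node-good (grow {j} {y} h _ c) = do
    _ , _ , s , _ , _ , z₀≤ ← descendant-state state₀ h
    r , w , x ← child-extension s c
    return (r , w , state x , good-≤ (s≤s (≤-trans (≤-trans (m≤n+m j z₀) z₀≤) (≤pairʳ n y))) (good x))

  -- Levels of the tree of states

  -- The two clauses are the two inclusions between `c′` and the set of children of `c`, so a search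
  -- finds the next level exactly.
  levelRel : Rel 2
  levelRel = define
    ((∀< x₁ (inRel ∙ (x₀ ∷ x₂ ∷ []) ⇛ ∀< (♯ 2) (∃< x₂ (inRel ∙ (x₀ ∷ x₃ ∷ []) ⩓ childRel ∙ (x₀ ∷ x₂ ∷ x₁ ∷ []))))) ⩓
     (∀< x₀ (inRel ∙ (x₀ ∷ x₁ ∷ []) ⇛ ∃< x₂ (inRel ∙ (x₀ ∷ x₃ ∷ []) ⩓ ∃< (♯ 2) (childRel ∙ (x₂ ∷ x₁ ∷ x₀ ∷ []))))))
    (λ { (c′ ∷ c ∷ []) →
      (∀ z → InF z c → ∀ b → b < 2 → ∃ λ z′ → InF z′ c′ × Child z′ z b) ×
      (∀ z′ → InF z′ c′ → ∃ λ z → InF z c × ∃ λ b → b < 2 × Child z′ z b) })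
    (λ { (c′ ∷ c ∷ []) (f , g) → return
      ((λ z i b b<2 → let (z′ , _ , h) = f z (in<code i) i b b<2 in z′ , h) ,
       λ z′ i → let (z , _ , h) = g z′ (in<code i) i in z , h) })
    (λ { (c′ ∷ c ∷ []) (f , g) → return
      ((λ z _ i b b<2 → let (z′ , i′ , h) = f z i b b<2 in z′ , in<code i′ , i′ , h) ,
       λ z′ _ i → let (z , i′ , h) = g z′ i in z , in<code i′ , i′ , h) })

  private
    singleton : String (suc z₀) (_≡ z₀)
    singleton = string (suc z₀) λ v _ → v ≟ z₀

  levelᶜ : ℕ
  levelᶜ = recᶜ (constᶜ (str singleton)) (compᶜ (searchᶜ (code levelRel)) (pairᶜ (compᶜ sndᶜ sndᶜ) (constᶜ 0)))

  IsLevel : ℕ → ℕ → Set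
  IsLevel l c = ∀ z → (InF z c → Descendant z₀ l z) × (Descendant z₀ l z → InF z c)

  level-exists : ∀ l → ¬¬ ∃ λ c → Ev levelᶜ (pair 0 l) c × IsLevel l c
  level-exists zero = return (str singleton , ev-zero ev-const , λ z →
    (λ i → case proj₂ (in⇒ singleton i) of λ { refl → here }) , λ { here → ⇒in singleton ≤-refl refl })
  level-exists (suc l) = do
    c , ev , lev ← level-exists l
    B , children ← ¬¬-bound c {λ z b → InF z c → ∀ a → a < 2 → ∃ λ z′ → z′ < b × Child z′ z a}
      (λ z b≤ h i a a<2 → let (z′ , z′< , ch) = h i a a<2 in z′ , <-≤-trans z′< b≤ , ch)
      λ z z<c → case inF? z c of λ where
        (no ¬i) → return (0 , λ i → ⊥-elim (¬i i))
        (yes i) → do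
          _ , _ , s , _ ← node-good (proj₁ (lev z) i)
          b , h ← ¬¬-bound 2 {λ a b → ∃ λ z′ → z′ < b × Child z′ z a}
            (λ a b≤ (z′ , z′< , ch) → z′ , <-≤-trans z′< b≤ , ch)
            λ a _ → child-exists a s >>= λ (z′ , ch) → return (suc z′ , z′ , ≤-refl , ch)
          return (b , λ _ → h)
    code′ ← ¬¬-string B λ z′ → ∃ λ z → InF z c × ∃ λ b → b < 2 × Child z′ z b
    c′ , (f , g) , _ , ev′ ← At.leastSolution n levelRel (c ∷ []) (return (str code′ ,
      (λ z i b b<2 → let (z′ , z′< , ch) = children z (in<code i) i b b<2 in
        z′ , ⇒in code′ z′< (z , i , b , b<2 , ch) , ch) ,
      λ z′ i → proj₂ (in⇒ code′ i)))
    return (c′ , ev-rec ev (ev-comp (ev-pair (ev-comp ev-snd ev-snd) ev-const) ev′) , λ z′ →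
      (λ i → let (z , i′ , b , b<2 , ch) = g z′ i in grow (proj₁ (lev z) i′) b<2 ch) ,
      λ { (grow {y = z} {b = b} h b<2 ch) → let (z″ , i , ch′) = f z (proj₂ (lev z) h) b b<2 in
            subst (λ y → InF y c′) (child-unique ch′ ch) i })

  -- The subtree

  Within : ℕ → ℕ → Set
  Within s z = ∃ λ r → ∃ λ w → ∃ λ B → z ≡ pair r (pair w B) × (∀ u → InF u s → InF u w)

  -- The level is the code `s` itself: its nodes decide all numbers below `s`, thus all entries of
  -- `s`. One finite level therefore settles membership.
  InS : ℕ → Set
  InS s = T s × ∃ λ z → Descendant z₀ s z × Within s z

  withinRel : Rel 2
  withinRel = define
    (∃< (+1 x₁) (∃< (+1 x₂) (∃< (+1 x₃)
      (x₄ ≣ ⟪ x₂ , ⟪ x₁ , x₀ ⟫ ⟫ ⩓ ∀< x₃ (inRel ∙ (x₀ ∷ x₄ ∷ []) ⇛ inRel ∙ (x₀ ∷ x₂ ∷ []))))))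
    (λ { (s ∷ z ∷ []) → Within s z })
    (λ { (s ∷ z ∷ []) (r , _ , w , _ , B , _ , eq , h) → return (r , w , B , eq , λ u i → h u (in<code i) i) })
    (λ { (s ∷ z ∷ []) (r , w , B , eq , h) → return
      (r , fst<+1 r _ eq , w , w<+1 r w B eq , B , B<+1 r w B eq , eq , λ u _ → h u) })

  subtreeRel : Rel 2
  subtreeRel = define
    (setRel T t T-decided ∙ (x₁ ∷ []) ⩓ ∃< x₀ (inRel ∙ (x₀ ∷ x₁ ∷ []) ⩓ withinRel ∙ (x₂ ∷ x₀ ∷ [])))
    (λ { (c ∷ s ∷ []) → T s × ∃ λ z → InF z c × Within s z })
    (λ { (c ∷ s ∷ []) (t , z , _ , h) → return (t , z , h) })
    (λ { (c ∷ s ∷ []) (t , z , i , h) → return (t , z , in<code i , i , h) })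

  subtreeᶜ : ℕ
  subtreeᶜ = compᶜ (code subtreeRel) (pairᶜ (compᶜ levelᶜ (pairᶜ (constᶜ 0) idᶜ)) (pairᶜ idᶜ (constᶜ 0)))

  subtree-decides : ∀ s → Decides subtreeᶜ s (InS s)
  subtree-decides s = (λ h → dec >>= λ d → proj₁ d h) , λ h → dec >>= λ d → proj₂ d h
    where
    dec : ¬¬ Decides subtreeᶜ s (InS s)
    dec = do
      c , ev , lev ← level-exists s
      return (decides-comp (ev-pair (ev-comp (ev-pair ev-const ev-id) ev) (ev-pair ev-id ev-const))
        (decides-resp
          (λ (t , z , i , h) → return (t , z , proj₁ (lev z) i , h))
          (λ (t , z , d , h) → return (t , z , proj₂ (lev z) d , h))
          (decides subtreeRel (c ∷ s ∷ []))))

  within⇒ : ∀ {s z r w} → Within s z → State z r w → ∀ u → InF u s → InF u w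
  within⇒ (_ , _ , _ , eq , h) st u i with pair-inj (trans (sym eq) (proj₂ (stateCode st)))
  ... | _ , eq′ with pair-inj eq′
  ... | refl , _ = h u i

  ⇒within : ∀ {s z r w} → State z r w → (∀ u → InF u s → InF u w) → Within s z
  ⇒within {r = r} {w} st h = r , w , proj₁ (stateCode st) , proj₂ (stateCode st) , h

  -- Any level will do: a node above level `s` of the tree has descendants there, and a deeper one
  -- has an ancestor there that already decides the entries of `s`.
  ⇒InS : ∀ {l s z} → T s → Descendant z₀ l z → Within s z → ¬¬ InS s
  ⇒InS {l} {s} {z} s∈T d s⊆z = case ≤-total l s of λ where
    (inj₁ l≤s) → do
      _ , _ , st , _ ← node-good d
      z′ , d′ ← descendant-exists (s ∸ l) st
      _ , _ , st′ , _ , w≼ , _ ← descendant-state st d′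
      return (s∈T , z′ , subst (λ k → Descendant z₀ k z′) (m∸n+n≡m l≤s) (descendant-trans d d′) ,
        ⇒within st′ λ u i → in≼ w≼ (within⇒ s⊆z st u i))
    (inj₂ s≤l) → do
      let y , d₁ , d₂ = descendant-split (l ∸ s) (subst (λ k → Descendant z₀ k z) (sym (m∸n+n≡m s≤l)) d)
      _ , _ , st , g ← node-good d₁
      _ , _ , st′ , _ , w≼ , _ ← descendant-state st d₂
      return (s∈T , y , d₁ , ⇒within st λ u i → case decided g u (in<code i) of λ where
        (inj₁ i′) → i′
        (inj₂ o)  → ⊥-elim (in-out (within⇒ s⊆z st′ u i) (out≼ w≼ o)))

  InS-down : ∀ {s t} → T t → (∀ u → InF u t → InF u s) → InS s → ¬¬ InS t
  InS-down t∈T sub (_ , z , d , r , w , B , eq , h) = ⇒InS t∈T d (r , w , B , eq , λ u i → h u (sub u i))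

  InS-nonempty : ¬¬ ∃ InS
  InS-nonempty = do
    s , seq , s⊆ , _ ← buildSeq 0 {λ _ _ → ⊥} (λ _ ())
    let empty : ∀ u → ¬ InF u s
        empty u i = proj₂ (proj₂ (proj₂ (proj₂ (s⊆ u i))))
    h ← ⇒InS (inTree ≼-refl root-consistent (approxˢ state₀) seq λ u i → ⊥-elim (empty u i))
             here (⇒within state₀ λ u i → ⊥-elim (empty u i))
    return (s , h)

  -- t is a long node of T found below the child of z in direction b.
  record Branch (z b M t : ℕ) : Set where
    field
      {w₁ w₂ q y} : ℕ
      w₁≤M        : w₁ ≤ M
      w₂≼w₁       : w₂ ≼ w₁
      ok₂         : Ok π q w₂
      value       : Evalˢ w₁ e (fork z) y
      value-1     : b ≡ 1 → y ≡ 1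
      value-0     : b ≢ 1 → y ≡ 0
      t⊆w₂        : ∀ u → InF u t → InF u w₂
      total       : ∀ i → i < M → ∃ λ a → InF (pair i a) t

  -- If t is contained in t′, the strings `w₁` of the two branches cannot clash: an entry of either
  -- has an index below `M`, where t and t′ have the same value. Compatible oracles give `e` the
  -- same output.
  branch-value : ∀ {z b b′ M t t′} (β : Branch z b M t) (β′ : Branch z b′ M t′) →
                 (∀ u → InF u t → InF u t′) → Branch.y β ≡ Branch.y β′
  branch-value {M = M} {t} {t′} β β′ t⊆t′ = functional in-clash out-clash β.value β′.value
    where
    module β = Branch β
    module β′ = Branch β′
    entry : ∀ {i a w} → InF (pair i a) w → w ≤ M → i < M
    entry {i} {a} v∈w w≤M = ≤-<-trans (≤pairˡ i a) (<-≤-trans (in<code v∈w) w≤M)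
    in-clash : ∀ {v} → InF v β.w₁ → ¬ OutF v β′.w₁
    in-clash i o with pairsᵒ β.ok₂ (in≼ β.w₂≼w₁ i)
    ... | k , a , refl with β.total k (entry i β.w₁≤M)
    ... | a′ , at with singleᵒ β.ok₂ (β.t⊆w₂ _ at) (in≼ β.w₂≼w₁ i)
    ... | refl = in-out (β′.t⊆w₂ _ (t⊆t′ _ at)) (out≼ β′.w₂≼w₁ o)
    out-clash : ∀ {v} → OutF v β.w₁ → ¬ InF v β′.w₁
    out-clash o i with pairsᵒ β′.ok₂ (in≼ β′.w₂≼w₁ i)
    ... | k , a , refl with β.total k (entry i β′.w₁≤M)
    ... | a′ , at with singleᵒ β′.ok₂ (β′.t⊆w₂ _ (t⊆t′ _ at)) (in≼ β′.w₂≼w₁ i)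
    ... | refl = in-out (β.t⊆w₂ _ at) (out≼ β.w₂≼w₁ o)

  make-branch : ∀ {s z b r w z′ r′ w′} M → Descendant z₀ s z → State z r w → (∀ u → InF u s → InF u w) →
    b < 2 → Child z′ z b → Extension z b r w z′ r′ w′ → w′ ≤ M → s ≤ M →
    ¬¬ ∃ λ t → InS t × (∀ u → InF u s → InF u t) × Branch z b M t
  make-branch {s} {z} {b} {w′ = w′} M d st s⊆w b<2 c x w′≤M s≤M = do
    -- `M` more generations make the node good beyond `M`, so `t` is defined below `M`.
    y , d′ ← descendant-exists M (state x)
    r″ , w″ , st″ , r″≼ , w″≼ , _ ← descendant-state (state x) d′
    let d″ = descendant-trans (grow d b<2 c) d′
    _ , _ , st₃ , g ← node-good d″
    case state-inj st″ st₃ of λ where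
      (refl , refl) → do
        t , _ , t∈T , t⊆ , tot ← extract (below st″) (agrees st″) g
        t∈S ← ⇒InS t∈T d″ (⇒within st″ t⊆)
        ok ← ok-below (below st″) (approxˢ st″)
        ok₁ ← ok-below (below (state x)) (approxˢ (state x))
        let v , ev = reduces (good x) (fork z) ≤-refl
            col : Col n′ (fork z)
            col = n , z , refl , n<n′
        return (t , t∈S ,
          (λ u i → let i″ = in≼ w″≼ (in≼ (w-ext x) (s⊆w u i)) in case pairsᵒ ok i″ of λ where
            (k , a , refl) → case tot k (<-≤-trans (≤-<-trans (≤pairˡ k a) (<-≤-trans (in<code i) s≤M)) (m≤m+n M _)) of λ where
              (a′ , at) → case singleᵒ ok (t⊆ _ at) i″ of λ where refl → at) ,
          record
            { w₁≤M = w′≤M ; w₂≼w₁ = w″≼ ; ok₂ = ok ; value = ev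
            ; value-1 = λ b≡1 → proj₁ (reduceᵒ ok₁ col ev) (proj₁ (forced x) b≡1)
            ; value-0 = λ b≢1 → proj₂ (reduceᵒ ok₁ col ev) (proj₂ (forced x) b≢1)
            ; t⊆w₂ = t⊆ ; total = λ i i<M → tot i (<-≤-trans i<M (m≤m+n M _)) })

  -- The two children of the node containing `s` force different bits at its fork. The fork lies in
  -- column n < `n′`, so `e` returns different values, and `branch-value` excludes either inclusion.
  InS-perfect : ∀ {s} → InS s → ¬¬ ∃ λ t → ∃ λ t′ → InS t × InS t′ ×
    (∀ u → InF u s → InF u t) × (∀ u → InF u s → InF u t′) ×
    ¬ (∀ u → InF u t → InF u t′) × ¬ (∀ u → InF u t′ → InF u t)
  InS-perfect {s} (_ , z , d , s⊆z) = do
    _ , _ , st , _ ← node-good d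
    _ , c₀ ← child-exists 0 st
    _ , c₁ ← child-exists 1 st
    _ , w₀ , e₀ ← child-extension st c₀
    _ , w₁ , e₁ ← child-extension st c₁
    let M = s + (w₀ + w₁)
        w₀≤ = ≤-trans (m≤m+n w₀ w₁) (m≤n+m _ s)
        w₁≤ = ≤-trans (m≤n+m w₁ w₀) (m≤n+m _ s)
    t₀ , i₀ , s⊆₀ , β₀ ← make-branch M d st (within⇒ s⊆z st) (s≤s z≤n) c₀ e₀ w₀≤ (m≤m+n s _)
    t₁ , i₁ , s⊆₁ , β₁ ← make-branch M d st (within⇒ s⊆z st) (s≤s (s≤s z≤n)) c₁ e₁ w₁≤ (m≤m+n s _)
    let y₀ : Branch.y β₀ ≡ 0
        y₀ = Branch.value-0 β₀ λ ()
        y₁ : Branch.y β₁ ≡ 1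
        y₁ = Branch.value-1 β₁ refl
    return (t₀ , t₁ , i₀ , i₁ , s⊆₀ , s⊆₁ ,
      (λ h → case trans (sym y₀) (trans (branch-value β₀ β₁ h) y₁) of λ ()) ,
      (λ h → case trans (sym y₀) (trans (sym (branch-value β₁ β₀ h)) y₁) of λ ()))

  -- Recovering the columns below n from a path

  reduction-correct : ∀ {q w v b} → q ≼ p → Consistent q → Approx π w q → Col n v → Evalˢ w e v b →
                      ¬¬ ((G v → b ≡ 1) × (¬ G v → b ≡ 0))
  reduction-correct {q} {v = v} q≼p A ap col ev = do
    c ← ¬¬-string (q ⊔ suc v) (Mixed q)
    let c≼q = mixed-≼ A (m≤m⊔n q (suc v)) c
        v< = m≤n⊔m q (suc v)
    ok ← ok-below (≼-trans c≼q q≼p) (approx-≼ c≼q ap)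
    let f , g = reduceᵒ ok (col-mono (<⇒≤ n<n′) col) ev
    return ((λ Gv → f (⇒in c v< (inj₁ (col , Gv)))) ,
            λ ¬Gv → g (⇒out c v< λ { (inj₁ (_ , Gv)) → ¬Gv Gv ; (inj₂ (¬col , _)) → ¬col col }))

  module Above {S Z : ℕ → Set} (S⇒ : ∀ {s} → S s → ¬¬ InS s) (path : IsPath S Z) where

    -- The level above v is finite, so all its approximations are settled by
    -- a long enough initial segment of Z.
    path-reduction : ∀ v → ¬¬ ∃ λ b → Eval Z (¬_ ∘ Z) e v b × (Col n v → (G v → b ≡ 1) × (¬ G v → b ≡ 0))
    path-reduction v = do
      c , _ , lev ← level-exists (suc v)
      -- Nodes of the level coded by `c`, and with them their strings, lie below `c`; so `L` exceeds
      -- the indices of their entries. The summand `suc v` makes the code of the segment exceed v.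
      let L = suc (c + suc v)
      s , seq , s⊆ , tot ← buildSeq L {λ i a → Z (pair i a)} λ i _ → totalᵖ path i
      let s⊆Z : ∀ u → InF u s → Z u
          s⊆Z u i = case s⊆ u i of λ { (_ , _ , refl , _ , h) → h }
          v<s : suc v ≤ s
          v<s = let (a , i) = tot (c + suc v) ≤-refl in
            ≤-trans (m≤n+m (suc v) c) (≤-trans (≤pairˡ _ a) (<⇒≤ (in<code i)))
      _ , z , d , s⊆z ← S⇒ (followᵖ path seq s⊆Z)
      let y , d₁ , d₂ = descendant-split (s ∸ suc v) (subst (λ k → Descendant z₀ k z) (sym (m∸n+n≡m v<s)) d)
      _ , w , st , g ← node-good d₁
      _ , w′ , st′ , _ , w′≼w , _ ← descendant-state st d₂
      ok ← ok-below (below st) (approxˢ st)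
      ok′ ← ok-below (below st′) (approxˢ st′)
      let b , ev = reduces g v ≤-refl
          w<L : w < L
          w<L = s≤s (≤-trans (state-w≤ st) (≤-trans (<⇒≤ (in<code (proj₂ (lev y) d₁))) (m≤m+n c _)))
          index< : ∀ {i a} → pair i a < w → i < L
          index< = λ {i} {a} h → ≤-<-trans (≤pairˡ i a) (<-trans h w<L)
      correct ← em (Col n v) >>= λ where
        (yes col) → reduction-correct (below st) (agrees st) (approxˢ st) col ev >>= λ h → return λ _ → h
        (no ¬col) → return λ col → ⊥-elim (¬col col)
      return (b , monotone
        (λ {u} i → case pairsᵒ ok i of λ where
          (k , a , refl) → case tot k (index< (in<code i)) of λ where
            (a′ , at) → case singleᵒ ok′ (within⇒ s⊆z st′ _ at) (in≼ w′≼w i) of λ where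
              refl → s⊆Z _ at)
        (λ {u} o u∈Z → case pairsᵖ path u∈Z of λ where
          (k , a , refl) → case tot k (index< (out<code o)) of λ where
            (a′ , at) → case singleᵖ path (s⊆Z _ at) u∈Z of λ where
              refl → in-out (within⇒ s⊆z st′ _ at) (out≼ w′≼w o))
        ev , correct)

    module OverZ = Relations Z (¬_ ∘ Z)

    -- Along Z the program `e` halts everywhere, but its answers are used only in the columns below
    -- n; the factor for `Col` gives 0 elsewhere.
    columnᶜ : ℕ
    columnᶜ = compᶜ mulᶜ (pairᶜ e (compᶜ (OverZ.code OverZ.colRel) (pairᶜ (constᶜ n) (pairᶜ idᶜ (constᶜ 0)))))

    column-decides : ∀ v → OverZ.Decides columnᶜ v (Gₙ n v)
    column-decides v = (λ (col , Gv) → do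
        b , ev , h ← path-reduction v
        ev′ ← proj₁ colDecides col
        case proj₁ (h col) Gv of λ where
          refl → return (OverZ.ev-comp (OverZ.ev-pair ev ev′) (OverZ.ev-mul 1 1))) ,
      λ ¬g → do
        b , ev , h ← path-reduction v
        case col? n v of λ where
          (yes col) → proj₁ colDecides col >>= λ ev′ → case proj₂ (h col) (λ Gv → ¬g (col , Gv)) of λ where
            refl → return (OverZ.ev-comp (OverZ.ev-pair ev ev′) (OverZ.ev-mul 0 1))
          (no ¬col) → proj₂ colDecides ¬col >>= λ ev′ →
            return (OverZ.ev-comp (OverZ.ev-pair ev ev′) (OverZ.ev-mul b 0))
      where
      colDecides : OverZ.Decides (compᶜ (OverZ.code OverZ.colRel) (pairᶜ (constᶜ n) (pairᶜ idᶜ (constᶜ 0)))) v (Col n v)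
      colDecides = OverZ.decides-comp
        (OverZ.ev-pair OverZ.ev-const (OverZ.ev-pair OverZ.ev-id OverZ.ev-const))
        (OverZ.decides OverZ.colRel (n ∷ v ∷ []))

    subtree-reduces : ∃ λ f → Reduces f InS Z
    subtree-reduces = _ , λ s → Transitivity.simulate-decides Z (¬_ ∘ Z) (Gₙ n) columnᶜ column-decides (subtree-decides s)

-- The subtree as a set of the model

⇒perfect : ∀ {n m} (ρ : Vec ℕ n) (δ : Vec Real m) T → IsTree (mem (lookup δ T)) → ¬¬ ∃ (mem (lookup δ T)) →
  (∀ {s} → mem (lookup δ T) s → ¬¬ ∃ λ t → ∃ λ t′ → mem (lookup δ T) t × mem (lookup δ T) t′ ×
    (∀ u → InF u s → InF u t) × (∀ u → InF u s → InF u t′) ×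
    ¬ (∀ u → InF u t → InF u t′) × ¬ (∀ u → InF u t′ → InF u t)) →
  ⟦ Perfect T ⟧ ρ δ
⇒perfect ρ δ T tree nonempty split =
  ⇒tree ρ δ T tree , ∃-intro¬¬ nonempty , λ s s∈T →
  ∃-intro¬¬ (split s∈T >>= λ (t , t′ , t∈T , t′∈T , s⊆t , s⊆t′ , t⊈t′ , t′⊈t) →
    return (t , ∃-intro t′
      (t∈T , t′∈T , ⇒initial (t′ ∷ t ∷ s ∷ ρ) δ v₂ v₁ s⊆t , ⇒initial (t′ ∷ t ∷ s ∷ ρ) δ v₂ v₀ s⊆t′ ,
       (λ h → seq tree t∈T λ q → t⊈t′ (initial⇒ (t′ ∷ t ∷ s ∷ ρ) δ v₁ v₀ q h)) ,
       (λ h → seq tree t′∈T λ q → t′⊈t (initial⇒ (t′ ∷ t ∷ s ∷ ρ) δ v₀ v₁ q h)))))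

columns : ℕ → Real
columns n = real {n} (decides-oracle n)

module PointedSubtree (T Y : Real) (e : ℕ) (tree : IsTree (mem T))
  (sit : Situation (par (index Y) e (index T) (level T) (suc (level T)) (level Y)) (mem T) (mem Y))
  {p : ℕ} (rt : Forcing.Root sit p) where

  open Subtree sit ≤-refl rt

  S : Real
  S = real {level T} subtree-decides

  S⇒ : ∀ {s} → mem S s → ¬¬ InS s
  S⇒ = real⇒ {level T} subtree-decides _

  ⇒S : ∀ {s} → InS s → mem S s
  ⇒S = ⇒real {level T} subtree-decides _

  S-stable : ∀ {s} → ¬¬ mem S s → mem S s
  S-stable h k = h λ m → m k

  S⊆T : ∀ s → mem S s → mem T s
  S⊆T s s∈S k = S⇒ s∈S λ (s∈T , _) → s∈T k

  S-tree : IsTree (mem S)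
  S-tree = record
    { seq  = λ {s} s∈S → seq tree (S⊆T s s∈S)
    ; down = λ {s} s∈S q sub → S-stable (S⇒ s∈S >>= λ h →
        InS-down (down tree (S⊆T s s∈S) q sub) sub h >>= λ h′ → return (⇒S h′)) }

  S-perfect : ∀ (δ : Vec Real 1) → ⟦ Perfect zero ⟧ [] (S ∷ δ)
  S-perfect δ = ⇒perfect [] (S ∷ δ) zero S-tree
    (InS-nonempty >>= λ (s , h) → return (s , ⇒S h))
    λ s∈S → S⇒ s∈S >>= InS-perfect >>= λ (t , t′ , h , h′ , rest) → return (t , t′ , ⇒S h , ⇒S h′ , rest)

  S-reduces : ∀ Z → IsPath (mem S) (mem Z) → ∃ λ f → Reduces f (mem S) (mem Z)
  S-reduces Z path = let (f , red) = subtree-reduces in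
    f , λ s → Computability.decides-resp (mem Z) (¬_ ∘ mem Z) (return ∘ ⇒S) S⇒ (red s)
    where open Above S⇒ path

  S-pointed : ⟦ Pointed zero ⟧ [] (S ∷ T ∷ [])
  S-pointed = S-perfect (T ∷ []) , λ Z path →
    let (f , red) = S-reduces Z (path⇒ [] (Z ∷ S ∷ T ∷ []) (suc zero) zero path)
    in ⇒≤T [] (Z ∷ S ∷ T ∷ []) (suc zero) zero f red

MPT-true : ⟦ MPT ⟧ [] []
MPT-true T (tree , cofinal) none = run do
  -- One column more than `T` is computed from, as room for the branching.
  let X = columns (suc (level T))
  ∃-elim (cofinal X) λ Y (path , X≤Y) → do
    e , red ← ≤T⇒ [] (Y ∷ X ∷ T ∷ []) (suc zero) zero X≤Y
    let sit = situation {T} {Y} {e} {suc (level T)}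
          (path⇒ [] (Y ∷ X ∷ T ∷ []) (suc (suc zero)) zero path)
          λ v → Computability.decides-resp (mem Y) (¬_ ∘ mem Y)
            (real⇒ (decides-oracle (suc (level T))) v)
            (λ g → return (⇒real (decides-oracle (suc (level T))) v g)) (red v)
    p , rt ← Forcing.root sit
    let open PointedSubtree T Y e (tree⇒ [] (T ∷ []) zero tree) sit rt
    return (none S (S⊆T , S-pointed))

theorem3p2 : RCA₀ ∪ ｛ MPT ｝ ⊬ WKL
theorem3p2 d = WKL-false (soundness (λ { (inj₁ ax) → RCA₀-true ax ; (inj₂ refl) → MPT-true }) d [] [] All.[])
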